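{- Let $\Lambda^{1,2}(n)$ and $\Lambda^{2,2}(n)$ and the statistic $\omega$ be as defined in the context. Then, as formal power series in $x$ with coefficients Laurent polynomials in $y$, \[ \sum_{n\ge 0} \sum_{\mu\in \Lambda^{1,2}(n)} y^{\omega(\mu)} x^{n} =\prod_{n\ge 1} \frac{1+x^{2n}}{1-x^{2n}} \prod_{n\ge 1} (1+ yx^{2n-1}) (1+y^{ -1} x^{2n-1}) (1-x^{2n}), \] and \[ \sum_{n\ge 0} \sum_{\mu\in \Lambda^{2,2}(n)} y^{\omega(\mu)} x^{n} = \frac{1}{2} \prod_{n\ge 1}(1+x^{2n-1})(1+yx^{2n-2})(1+y^{ -1}x^{2n}) + \frac{1}{2}\prod_{n\ge 1}(1-x^{2n-1})(1-yx^{2n-2})(1-y^{ -1}x^{2n}). \]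
   Context: For integers $m\ge 1$ and $0\le a\le m$, put $t_1=\cdots=t_a=0$ and $t_{a+1}=\cdots=t_m=1$. Let $\Lambda^{a,m}(n)$ be the set of $m$-tuples $\pi=(\pi^{(1)},\ldots,\pi^{(m)})$ of partitions such that each $\pi^{(i)}$ has distinct parts, $\sum_i|\pi^{(i)}|=n$, and $\pi^{(i)}_1+t_i\le \ell(\pi^{(i+1)})+t_{i+1}$ for $1\le i\le m-1$ (here $\pi^{(i)}_1$ is the largest part, taken to be $0$ for the empty partition, and $\ell$ is the number of parts). (Equivalently, these are the conjugates of the $(2,\mathbf t)$-restricted $m$-multipartitions of $n$.) For a node $(i,j)$ (row $i$, column $j$) of the Young diagram of $\pi^{(s)}$, its residue is $(j-i+t_s)\bmod 2$. Define $\omega(\pi)=C_0(\pi)-C_1(\pi)$, where $C_r(\pi)$ is the number of nodes in the Young diagrams of all components of $\pi$ having residue $r$. -}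

module Defs where

open import Data.Nat as ℕ using (ℕ; zero; suc; _≤_; _<_; _≤ᵇ_)
open import Data.Integer as ℤ using (ℤ; +_; _%ℕ_)
open import Data.Bool using (Bool; true; false; if_then_else_)
open import Data.Nat.ListAction using (sum)
open import Data.List as L using (List; []; _∷_; _++_; concatMap; map; upTo; length; filterᵇ)
open import Data.List.Relation.Unary.Linked using (Linked)
open import Data.List.Relation.Unary.All as LA using ()
open import Data.Vec as V using (Vec; []; _∷_)
open import Data.Vec.Relation.Unary.All as VA using ()
open import Data.Product using (Σ; _×_; _,_)
open import Data.Unit using (⊤)
open import Relation.Binary.PropositionalEquality using (_≡_)

IsDistinctPartition : List ℕ → Set
IsDistinctPartition xs = Linked ℕ._>_ xs × LA.All (λ p → 0 < p) xs

size : List ℕ → ℕ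
size = sum

largest : List ℕ → ℕ
largest []      = 0
largest (p ∷ _) = p

-- t_i for the multicharge with t_1 = ... = t_a = 0, t_{a+1} = ... = 1
-- (i is 1-based)
tval : ℕ → ℕ → ℕ
tval a i = if i ≤ᵇ a then 0 else 1

ChainFrom : ℕ → ℕ → {k : ℕ} → Vec (List ℕ) k → Set
ChainFrom a i []            = ⊤
ChainFrom a i (p ∷ [])      = ⊤
ChainFrom a i (p ∷ q ∷ rest) =
  (largest p ℕ.+ tval a i ≤ length q ℕ.+ tval a (suc i)) × ChainFrom a (suc i) (q ∷ rest)

totalSize : {k : ℕ} → Vec (List ℕ) k → ℕ
totalSize []       = 0
totalSize (p ∷ ps) = size p ℕ.+ totalSize ps

Λ : (a m n : ℕ) → Vec (List ℕ) m → Set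
Λ a m n π = VA.All IsDistinctPartition π × totalSize π ≡ n × ChainFrom a 1 π

-- nodes (i , j) (row i, column j, 1-based) of the Young diagram
-- whose row lengths are given by the list
nodesFrom : ℕ → List ℕ → List (ℕ × ℕ)
nodesFrom i []       = []
nodesFrom i (p ∷ ps) = map (λ j → (i , suc j)) (upTo p) ++ nodesFrom (suc i) ps

nodes : List ℕ → List (ℕ × ℕ)
nodes = nodesFrom 1

residue : ℕ → ℕ × ℕ → ℕ
residue t (i , j) = ((+ j ℤ.- + i) ℤ.+ + t) %ℕ 2

residuesFrom : ℕ → ℕ → {k : ℕ} → Vec (List ℕ) k → List ℕ
residuesFrom a s []       = []
residuesFrom a s (p ∷ ps) = map (residue (tval a s)) (nodes p) ++ residuesFrom a (suc s) ps

C : ℕ → ℕ → {k : ℕ} → Vec (List ℕ) k → ℕ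
C a r π = length (filterᵇ (λ x → x ℕ.≡ᵇ r) (residuesFrom a 1 π))

ω : ℕ → {k : ℕ} → Vec (List ℕ) k → ℤ
ω a π = + C a 0 π ℤ.- + C a 1 π

LambdaW : (a m n : ℕ) → ℤ → Set
LambdaW a m n k = Σ (Vec (List ℕ) m) λ μ → Λ a m n μ × ω a μ ≡ k

-- Polynomials in x with Laurent-polynomial coefficients in y, as
-- unnormalised lists of terms  coeff · x^e · y^f  represented by
-- (e , f , coeff).

Poly : Set
Poly = List (ℕ × ℤ × ℤ)

one : Poly
one = (0 , + 0 , + 1) ∷ []

_⊕_ : Poly → Poly → Poly
p ⊕ q = p ++ q

infixl 7 _⊗_
infixl 6 _⊕_

_⊗_ : Poly → Poly → Poly
p ⊗ q = concatMap (λ { (e , f , c) → map (λ { (e' , f' , c') → (e ℕ.+ e' , f ℤ.+ f' , c ℤ.* c') }) q }) p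

binom : ℤ → ℤ → ℕ → Poly
binom s f e = (0 , + 0 , + 1) ∷ (e , f , s) ∷ []

-- 1/(1 - x^d) truncated to degree ≤ N:  Σ_{j, d j ≤ N} x^{d j}
geomUpTo : ℕ → ℕ → Poly
geomUpTo N d = map (λ j → (d ℕ.* j , + 0 , + 1)) (filterᵇ (λ j → d ℕ.* j ≤ᵇ N) (upTo (suc N)))

prodFrom1 : ℕ → (ℕ → Poly) → Poly
prodFrom1 zero    f = one
prodFrom1 (suc M) f = prodFrom1 M f ⊗ f (suc M)

coeff : Poly → ℕ → ℤ → ℤ
coeff []              n k = + 0
coeff ((e , f , c) ∷ p) n k =
  (if (e ℕ.≡ᵇ n) Data.Bool.∧ ⌊ f ℤ.≟ k ⌋ then c else + 0) ℤ.+ coeff p n k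
  where open import Relation.Nullary.Decidable using (⌊_⌋)

-- Right-hand side of the first identity, truncated: the factors with
-- index m ≤ N (all factors with m > N are ≡ 1 mod x^{N+1}), and each
-- 1/(1-x^{2m}) expanded up to degree N.  Its coefficient of x^n agrees
-- with that of the infinite product for n ≤ N.
rhs1 : ℕ → Poly
rhs1 N = prodFrom1 N λ m →
  binom (+ 1) (+ 0) (2 ℕ.* m) ⊗ geomUpTo N (2 ℕ.* m)
  ⊗ (binom (+ 1) (+ 1) (2 ℕ.* m ℕ.∸ 1) ⊗ binom (+ 1) (ℤ.- + 1) (2 ℕ.* m ℕ.∸ 1)
  ⊗ binom (ℤ.- + 1) (+ 0) (2 ℕ.* m))

prod2 : ℤ → ℕ → Poly
prod2 s N = prodFrom1 N λ m →
  binom s (+ 0) (2 ℕ.* m ℕ.∸ 1) ⊗ binom s (+ 1) (2 ℕ.* m ℕ.∸ 2) ⊗ binom s (ℤ.- + 1) (2 ℕ.* m)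

twiceRhs2 : ℕ → Poly
twiceRhs2 N = prod2 (+ 1) N ⊕ prod2 (ℤ.- + 1) N

{-# OPTIONS --safe #-}
-- Write q = x². Let G(c) be the generating function of the pairs (λ , μ) of distinct partitions
-- with λ₁ ≤ ℓ(μ) + c, and Ḡ(c) the one with all residues exchanged, i.e. with y replaced by y⁻¹.
-- If λ₁ = ℓ(μ) + c + 1 or ℓ(μ) + c + 2, delete the row λ₁ from λ and add to μ a first column of
-- length ℓ(μ), respectively ℓ(μ) + 1; this gives G(c + 2) = G(c) + k Ḡ(c) with k = x^(c+1) when the
-- charges are (0, 1) and c is odd, and k = x^(c+1) y when they are (0, 0) and c is even. Hence
-- G ± Ḡ, respectively G ± y Ḡ, is multiplied by 1 ± x^(c+1) when c grows by 2, and everything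
-- reduces to c = ∞, where the generating function is a product of two generating functions of all
-- distinct partitions of a given charge. These are E₀ = ∑ y^j x^(2j²-j) / (q;q)_∞ for charge 0 and
-- E₁ = ∑ y^j x^(2j²+j) / (q;q)_∞ for charge 1, by the q-Pascal rules. The products on the right are
-- also theta functions divided by (q;q)_∞, by Jacobi's triple product identity, and the two double
-- sums agree after the rotation (j , k) ↦ (j + k , j - k) of ℤ². All of this takes place in a
-- commutative ring with y invertible and x^(N+1) = 0, and is applied to polynomials modulo x^(N+1).
module Submission where

open import Defs
open import Algebra.Bundles using (CommutativeRing; RawRing)
import Algebra.Properties.AbelianGroup
import Algebra.Properties.CommutativeSemigroup
import Algebra.Properties.CommutativeSemiring.Exp
import Algebra.Properties.Ring
import Algebra.Properties.Semiring.Exp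
import Algebra.Properties.Semiring.Mult.TCOptimised
import Algebra.Solver.Ring
open import Algebra.Solver.Ring.AlmostCommutativeRing using (fromCommutativeRing; _-Raw-AlmostCommutative⟶_)
open import Axiom.UniquenessOfIdentityProofs using (module Decidable⇒UIP)
open import Data.Bool using (Bool; true; false; not; if_then_else_; _∧_; T)
import Data.Bool.Properties as Boolₚ
open import Data.Fin as Fin using (Fin)
open import Data.Integer as ℤ using (ℤ; +_; -[1+_]; ∣_∣)
import Data.Integer.Properties as ℤₚ
open import Data.Integer.Tactic.RingSolver using (solve-∀)
open import Data.List using (List; []; _∷_; _++_; map; upTo; concatMap; filterᵇ; applyUpTo; filter; length; lookup)
open import Data.List.Membership.Propositional using (_∈_; lose; find)
open import Data.List.Membership.Propositional.Properties using (∈-map⁺; ∈-map⁻; ∈-++⁺ˡ; ∈-++⁺ʳ; ∈-++⁻; ∈-concatMap⁺; ∈-concatMap⁻; ∈-filter⁺; ∈-filter⁻; ∈-lookup)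
import Data.List.Properties as Listₚ
open import Data.List.Relation.Unary.All as All using ([]; _∷_)
open import Data.List.Relation.Unary.AllPairs using ([]; _∷_)
open import Data.List.Relation.Unary.Any as Any using (here; there)
import Data.List.Relation.Unary.Any.Properties as Anyₚ
open import Data.List.Relation.Unary.Linked as Linked using (Linked; []; [-]; _∷_)
open import Data.List.Relation.Unary.Unique.Propositional using (Unique)
import Data.List.Relation.Unary.Unique.Propositional.Properties as Uniqueₚ
open import Data.Maybe using (Maybe; just; nothing)
open import Data.Nat as ℕ using (ℕ; zero; suc; _≤_; _<_; s≤s; z≤n)
import Data.Nat.DivMod as ℕ/
import Data.Nat.Properties as ℕₚ
open import Data.Product using (Σ; _×_; _,_; proj₁; proj₂)
open import Data.Product.Properties using (Σ-≡,≡→≡)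
open import Data.Sum using (inj₁; inj₂)
open import Data.Unit using (tt)
open import Data.Vec as Vec using (Vec; []; _∷_)
open import Data.Vec.Relation.Unary.All as VecAll using ([]; _∷_)
open import Function.Bundles using (_↔_; mk↔ₛ′)
open import Level using (Level; 0ℓ)
open import Relation.Binary.PropositionalEquality as ≡ using (_≡_)
import Relation.Binary.Reasoning.Setoid
open import Relation.Nullary using (yes; no; ¬_; contradiction; Dec)
open import Relation.Nullary.Decidable using (⌊_⌋; _×-dec_)

-- The nilpotency of x turns every limit into an equality: c = ∞ means c ≥ N, (q;q)_∞ is (q;q)_N, a
-- theta series is a sum over a finite window, and each 1 + x b is a unit, so that telescoped
-- products may be cancelled. To read off the coefficient of x^n, N = n is enough. Deleting a row of
-- λ and adding a column to μ flips both charges, so G and Ḡ are coupled and neither satisfies a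
-- recursion of its own. The coupling is an exchange, diagonalised by a sign s with s² = 1; both
-- signs are carried through one argument with s as a parameter. Recovering G from the two
-- combinations costs a factor 2, which is not inverted in the ring: the identities stay doubled
-- until coefficients are compared in ℤ. The map (j , k) ↦ (j + k , j - k) reaches only a sublattice
-- of index two. The other coset, reached after adding 1 to the second coordinate, is why a product
-- of two theta series becomes a sum of two products: two equal ones for charges (0, 1), and the
-- squares of E₀ and E₁ for charges (0, 0).

-- Polynomial identities with integer coefficients in an arbitrary commutative ring.

module IntegerSolver {c ℓ : Level} (R : CommutativeRing c ℓ) where
  open CommutativeRing R
  open Algebra.Properties.Semiring.Mult.TCOptimised semiring using (×-homo-+; ×1-homo-*) renaming (_×_ to _·_)
  open Algebra.Properties.Ring ring using (-‿distribˡ-*; -‿distribʳ-*; -‿involutive)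
  open Algebra.Properties.AbelianGroup +-abelianGroup using (⁻¹-∙-comm)
  open Algebra.Properties.CommutativeSemigroup +-commutativeSemigroup using (interchange)
  open Relation.Binary.Reasoning.Setoid setoid

  private
    -- One entry of the result is always 0, so equal integers that arise from different computations
    -- get the same pair.
    normalise : ℕ × ℕ → ℕ × ℕ
    normalise (a , b) = a ℕ.∸ b , b ℕ.∸ a

    -- The coefficient (a , b) stands for the integer a - b.
    differences : RawRing _ _
    differences = record
      { Carrier = ℕ × ℕ
      ; _≈_ = _≡_
      ; _+_ = λ { (a , b) (c , d) → normalise (a ℕ.+ c , b ℕ.+ d) }
      ; _*_ = λ { (a , b) (c , d) → normalise (a ℕ.* c ℕ.+ b ℕ.* d , a ℕ.* d ℕ.+ b ℕ.* c) }
      ; -_ = λ { (a , b) → b , a }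
      ; 0# = 0 , 0
      ; 1# = 1 , 0
      }

    ι : ℕ → Carrier
    ι n = n · 1#

    difference : ℕ × ℕ → Carrier
    difference (a , b) = ι a + - ι b

    -- The special case makes the coefficients 0 and 1 evaluate to 0# and 1# on the nose.
    value : ℕ × ℕ → Carrier
    value (a , zero) = ι a
    value (a , suc b) = ι a + - ι (suc b)

    -0≈0 : - 0# ≈ 0#
    -0≈0 = trans (sym (+-identityˡ (- 0#))) (-‿inverseʳ 0#)

    value≈difference : ∀ u → value u ≈ difference u
    value≈difference (a , zero) = sym (trans (+-congˡ -0≈0) (+-identityʳ (ι a)))
    value≈difference (a , suc b) = refl

    +-homo : ∀ a b c d → difference (a ℕ.+ c , b ℕ.+ d) ≈ difference (a , b) + difference (c , d)
    +-homo a b c d = begin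
      ι (a ℕ.+ c) + - ι (b ℕ.+ d)         ≈⟨ +-cong (×-homo-+ 1# a c) (-‿cong (×-homo-+ 1# b d)) ⟩
      (ι a + ι c) + - (ι b + ι d)         ≈⟨ +-congˡ (⁻¹-∙-comm (ι b) (ι d)) ⟨
      (ι a + ι c) + (- ι b + - ι d)       ≈⟨ interchange (ι a) (ι c) (- ι b) (- ι d) ⟩
      (ι a + - ι b) + (ι c + - ι d)       ∎

    ι-bilinear : ∀ a b c d → ι (a ℕ.* c ℕ.+ b ℕ.* d) ≈ ι a * ι c + ι b * ι d
    ι-bilinear a b c d = trans (×-homo-+ 1# (a ℕ.* c) (b ℕ.* d)) (+-cong (×1-homo-* a c) (×1-homo-* b d))

    *-homo : ∀ a b c d → difference (a ℕ.* c ℕ.+ b ℕ.* d , a ℕ.* d ℕ.+ b ℕ.* c) ≈ difference (a , b) * difference (c , d)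
    *-homo a b c d = begin
      ι (a ℕ.* c ℕ.+ b ℕ.* d) + - ι (a ℕ.* d ℕ.+ b ℕ.* c)
        ≈⟨ +-cong (ι-bilinear a b c d) (-‿cong (ι-bilinear a b d c)) ⟩
      (ι a * ι c + ι b * ι d) + - (ι a * ι d + ι b * ι c)
        ≈⟨ +-congˡ (⁻¹-∙-comm (ι a * ι d) (ι b * ι c)) ⟨
      (ι a * ι c + ι b * ι d) + (- (ι a * ι d) + - (ι b * ι c))
        ≈⟨ +-congˡ (+-comm _ _) ⟩
      (ι a * ι c + ι b * ι d) + (- (ι b * ι c) + - (ι a * ι d))
        ≈⟨ interchange (ι a * ι c) (ι b * ι d) (- (ι b * ι c)) (- (ι a * ι d)) ⟩
      (ι a * ι c + - (ι b * ι c)) + (ι b * ι d + - (ι a * ι d))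
        ≈⟨ +-congˡ (+-comm _ _) ⟩
      (ι a * ι c + - (ι b * ι c)) + (- (ι a * ι d) + ι b * ι d)
        ≈⟨ +-cong (+-congˡ (-‿distribˡ-* (ι b) (ι c))) (+-cong (-‿distribʳ-* (ι a) (ι d)) negsq) ⟩
      (ι a * ι c + - ι b * ι c) + (ι a * - ι d + - ι b * - ι d)
        ≈⟨ +-cong (distribʳ (ι c) (ι a) (- ι b)) (distribʳ (- ι d) (ι a) (- ι b)) ⟨
      (ι a + - ι b) * ι c + (ι a + - ι b) * - ι d
        ≈⟨ distribˡ (ι a + - ι b) (ι c) (- ι d) ⟨
      (ι a + - ι b) * (ι c + - ι d) ∎
      where
      negsq : ι b * ι d ≈ - ι b * - ι d
      negsq = begin
        ι b * ι d         ≈⟨ -‿involutive (ι b * ι d) ⟨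
        - (- (ι b * ι d)) ≈⟨ -‿cong (-‿distribˡ-* (ι b) (ι d)) ⟩
        - (- ι b * ι d)   ≈⟨ -‿distribʳ-* (- ι b) (ι d) ⟩
        - ι b * - ι d     ∎

    crossEqual : ∀ a b c d → a ℕ.+ d ≡ c ℕ.+ b → difference (a , b) ≈ difference (c , d)
    crossEqual a b c d e = begin
      ι a + - ι b                     ≈⟨ +-congʳ (+-identityʳ (ι a)) ⟨
      (ι a + 0#) + - ι b              ≈⟨ +-congʳ (+-congˡ (-‿inverseʳ (ι d))) ⟨
      (ι a + (ι d + - ι d)) + - ι b   ≈⟨ +-congʳ (+-assoc (ι a) (ι d) (- ι d)) ⟨
      ((ι a + ι d) + - ι d) + - ι b   ≈⟨ +-congʳ (+-congʳ cross) ⟩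
      ((ι c + ι b) + - ι d) + - ι b   ≈⟨ +-assoc (ι c + ι b) (- ι d) (- ι b) ⟩
      (ι c + ι b) + (- ι d + - ι b)   ≈⟨ interchange (ι c) (ι b) (- ι d) (- ι b) ⟩
      (ι c + - ι d) + (ι b + - ι b)   ≈⟨ +-congˡ (-‿inverseʳ (ι b)) ⟩
      (ι c + - ι d) + 0#              ≈⟨ +-identityʳ _ ⟩
      ι c + - ι d                     ∎
      where
      cross : ι a + ι d ≈ ι c + ι b
      cross = trans (sym (×-homo-+ 1# a d)) (trans (reflexive (≡.cong ι e)) (×-homo-+ 1# c b))

    value-normalise : ∀ a b → value (normalise (a , b)) ≈ difference (a , b)
    value-normalise a b = trans (value≈difference (normalise (a , b)))
      (crossEqual (a ℕ.∸ b) (b ℕ.∸ a) a b (cross a b))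
      where
      cross : ∀ a b → (a ℕ.∸ b) ℕ.+ b ≡ a ℕ.+ (b ℕ.∸ a)
      cross zero zero = ≡.refl
      cross zero (suc b) = ≡.refl
      cross (suc a) zero = ≡.refl
      cross (suc a) (suc b) = ≡.trans (ℕₚ.+-suc (a ℕ.∸ b) b) (≡.cong suc (cross a b))

    morphism : differences -Raw-AlmostCommutative⟶ fromCommutativeRing R
    morphism = record
      { ⟦_⟧ = value
      ; +-homo = λ { (a , b) (c , d) → trans (value-normalise (a ℕ.+ c) (b ℕ.+ d))
          (trans (+-homo a b c d) (+-cong (sym (value≈difference (a , b))) (sym (value≈difference (c , d))))) }
      ; *-homo = λ { (a , b) (c , d) → trans (value-normalise (a ℕ.* c ℕ.+ b ℕ.* d) (a ℕ.* d ℕ.+ b ℕ.* c))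
          (trans (*-homo a b c d) (*-cong (sym (value≈difference (a , b))) (sym (value≈difference (c , d))))) }
      ; -‿homo = λ { (a , b) → trans (value≈difference (b , a))
          (trans (-‿homo a b) (-‿cong (sym (value≈difference (a , b))))) }
      ; 0-homo = refl
      ; 1-homo = refl
      }
      where
      -‿homo : ∀ a b → difference (b , a) ≈ - difference (a , b)
      -‿homo a b = trans (+-comm (ι b) (- ι a))
        (trans (+-congˡ (sym (-‿involutive (ι b)))) (⁻¹-∙-comm (ι a) (- ι b)))

    _≟value_ : ∀ (u v : ℕ × ℕ) → Maybe (value u ≈ value v)
    (a , b) ≟value (c , d) with a ℕ.+ d ℕₚ.≟ c ℕ.+ b
    ... | yes e = just (trans (value≈difference (a , b))
        (trans (crossEqual a b c d e) (sym (value≈difference (c , d)))))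
    ... | no _ = nothing

  open Algebra.Solver.Ring differences (fromCommutativeRing R) morphism _≟value_ public
    using (Polynomial; solve; con; _:+_; _:*_; _:-_; :-_; _:=_)

  :1 : ∀ {n} → Polynomial n
  :1 = con (1 , 0)

  :0 : ∀ {n} → Polynomial n
  :0 = con (0 , 0)

-- Units and finite geometric series.

module Units {c ℓ : Level} (R : CommutativeRing c ℓ) where
  open CommutativeRing R
  open Algebra.Properties.Semiring.Exp semiring using (_^_)
  open Algebra.Properties.CommutativeSemiring.Exp commutativeSemiring using (^-distrib-*)
  open IntegerSolver R
  open Relation.Binary.Reasoning.Setoid setoid

  IsUnit : Carrier → Set _
  IsUnit a = Σ Carrier λ b → a * b ≈ 1#

  unit-* : ∀ {a b} → IsUnit a → IsUnit b → IsUnit (a * b)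
  unit-* {a} {b} (a' , p) (b' , r) = a' * b' , (begin
    (a * b) * (a' * b') ≈⟨ solve 4 (λ a b c d → (a :* b) :* (c :* d) := (a :* c) :* (b :* d)) refl a b a' b' ⟩
    (a * a') * (b * b') ≈⟨ *-cong p r ⟩
    1# * 1#             ≈⟨ *-identityˡ 1# ⟩
    1# ∎)

  unit-cancel : ∀ {a b d} → IsUnit a → a * b ≈ a * d → b ≈ d
  unit-cancel {a} {b} {d} (a' , p) e = begin
    b            ≈⟨ *-identityˡ b ⟨
    1# * b       ≈⟨ *-congʳ p ⟨
    (a * a') * b ≈⟨ solve 3 (λ a c b → (a :* c) :* b := c :* (a :* b)) refl a a' b ⟩
    a' * (a * b) ≈⟨ *-congˡ e ⟩
    a' * (a * d) ≈⟨ solve 3 (λ a c b → c :* (a :* b) := (a :* c) :* b) refl a a' d ⟩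
    (a * a') * d ≈⟨ *-congʳ p ⟩
    1# * d       ≈⟨ *-identityˡ d ⟩
    d ∎

  geometric : Carrier → ℕ → Carrier
  geometric u zero = 0#
  geometric u (suc n) = 1# + u * geometric u n

  geometric-sum : ∀ u n → (1# - u) * geometric u n ≈ 1# - u ^ n
  geometric-sum u zero = solve 1 (λ u → (:1 :- u) :* :0 := :1 :- :1) refl u
  geometric-sum u (suc n) = begin
    (1# - u) * (1# + u * geometric u n)
      ≈⟨ solve 2 (λ u g → (:1 :- u) :* (:1 :+ u :* g) := (:1 :- u) :+ u :* ((:1 :- u) :* g)) refl u (geometric u n) ⟩
    (1# - u) + u * ((1# - u) * geometric u n) ≈⟨ +-congˡ (*-congˡ (geometric-sum u n)) ⟩
    (1# - u) + u * (1# - u ^ n) ≈⟨ solve 2 (λ u p → (:1 :- u) :+ u :* (:1 :- p) := :1 :- u :* p) refl u (u ^ n) ⟩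
    1# - u * u ^ n ∎

  geometric-inverse : ∀ u n → u ^ n ≈ 0# → (1# - u) * geometric u n ≈ 1#
  geometric-inverse u n z = begin
    (1# - u) * geometric u n ≈⟨ geometric-sum u n ⟩
    1# - u ^ n ≈⟨ +-congˡ (-‿cong z) ⟩
    1# - 0#    ≈⟨ solve 0 (:1 :- :0 := :1) refl ⟩
    1# ∎

  -- The geometric series in `x * - b` stops after n terms.
  unit-1+ : ∀ {x n} → x ^ n ≈ 0# → ∀ b → IsUnit (1# + x * b)
  unit-1+ {x} {n} z b = geometric (x * - b) n , (begin
    (1# + x * b) * geometric (x * - b) n
      ≈⟨ *-congʳ (solve 2 (λ x b → :1 :+ x :* b := :1 :- (x :* (:- b))) refl x b) ⟩
    (1# - x * - b) * geometric (x * - b) n ≈⟨ geometric-inverse (x * - b) n nil ⟩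
    1# ∎)
    where
    nil : (x * - b) ^ n ≈ 0#
    nil = trans (^-distrib-* x (- b) n) (trans (*-congʳ z) (zeroˡ _))

-- Finite products, sums over symmetric intervals of ℤ, and sums over antidiagonals.

module FiniteSums {c ℓ : Level} (R : CommutativeRing c ℓ) where
  open CommutativeRing R
  open Units R
  open IntegerSolver R
  open Relation.Binary.Reasoning.Setoid setoid

  ∏ : ℕ → (ℕ → Carrier) → Carrier
  ∏ zero f = 1#
  ∏ (suc n) f = ∏ n f * f n

  ∏-cong : ∀ n {f g} → (∀ i → f i ≈ g i) → ∏ n f ≈ ∏ n g
  ∏-cong zero e = refl
  ∏-cong (suc n) e = *-cong (∏-cong n e) (e n)

  ∏-* : ∀ n f g → ∏ n (λ i → f i * g i) ≈ ∏ n f * ∏ n g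
  ∏-* zero f g = sym (*-identityˡ 1#)
  ∏-* (suc n) f g = trans (*-congʳ (∏-* n f g))
    (solve 4 (λ a b c d → (a :* b) :* (c :* d) := (a :* c) :* (b :* d)) refl (∏ n f) (∏ n g) (f n) (g n))

  ∏-head : ∀ n f → ∏ (suc n) f ≈ f 0 * ∏ n (λ i → f (suc i))
  ∏-head zero f = *-comm 1# (f 0)
  ∏-head (suc n) f = trans (*-congʳ (∏-head n f)) (*-assoc _ _ _)

  ∏-unit : ∀ n {f} → (∀ i → IsUnit (f i)) → IsUnit (∏ n f)
  ∏-unit zero u = 1# , *-identityˡ 1#
  ∏-unit (suc n) u = unit-* (∏-unit n u) (u n)

  ∏-stable : ∀ {m n f} → m ≤ n → (∀ i → m ≤ i → f i ≈ 1#) → ∏ n f ≈ ∏ m f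
  ∏-stable {m} {n} {f} m≤n one = go (ℕₚ.≤⇒≤′ m≤n)
    where
    go : ∀ {n} → m ℕ.≤′ n → ∏ n f ≈ ∏ m f
    go ℕ.≤′-refl = refl
    go (ℕ.≤′-step p) = trans (*-cong (go p) (one _ (ℕₚ.≤′⇒≤ p))) (*-identityʳ _)

  -- The window grows at both ends at once, so that a reflection only exchanges the two new terms.
  ∑± : ℕ → (ℤ → Carrier) → Carrier
  ∑± zero f = f (+ 0)
  ∑± (suc J) f = ∑± J f + (f (+ suc J) + f -[1+ J ])

  ∑±-cong : ∀ J {f g} → (∀ i → ∣ i ∣ ≤ J → f i ≈ g i) → ∑± J f ≈ ∑± J g
  ∑±-cong zero e = e (+ 0) z≤n
  ∑±-cong (suc J) e = +-cong (∑±-cong J λ i p → e i (ℕₚ.m≤n⇒m≤1+n p))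
    (+-cong (e (+ suc J) ℕₚ.≤-refl) (e -[1+ J ] ℕₚ.≤-refl))

  ∑±-+ : ∀ J f g → ∑± J (λ i → f i + g i) ≈ ∑± J f + ∑± J g
  ∑±-+ zero f g = refl
  ∑±-+ (suc J) f g = trans (+-congʳ (∑±-+ J f g))
    (solve 6 (λ a b c d e f → (a :+ b) :+ ((c :+ d) :+ (e :+ f)) := (a :+ (c :+ e)) :+ (b :+ (d :+ f))) refl
      (∑± J f) (∑± J g) (f (+ suc J)) (g (+ suc J)) (f -[1+ J ]) (g -[1+ J ]))

  ∑±-*ˡ : ∀ J a f → ∑± J (λ i → a * f i) ≈ a * ∑± J f
  ∑±-*ˡ zero a f = refl
  ∑±-*ˡ (suc J) a f = trans (+-congʳ (∑±-*ˡ J a f))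
    (solve 4 (λ a s p m → a :* s :+ (a :* p :+ a :* m) := a :* (s :+ (p :+ m))) refl
      a (∑± J f) (f (+ suc J)) (f -[1+ J ]))

  ∑±-*ʳ : ∀ J a f → ∑± J (λ i → f i * a) ≈ ∑± J f * a
  ∑±-*ʳ J a f = trans (∑±-cong J λ i _ → *-comm (f i) a) (trans (∑±-*ˡ J a f) (*-comm a _))

  ∑±-swap : ∀ I J (f : ℤ → ℤ → Carrier) → ∑± I (λ i → ∑± J (λ j → f i j)) ≈ ∑± J (λ j → ∑± I (λ i → f i j))
  ∑±-swap zero J f = refl
  ∑±-swap (suc I) J f = begin
    ∑± I (λ i → ∑± J (f i)) + (∑± J (f (+ suc I)) + ∑± J (f -[1+ I ]))
      ≈⟨ +-cong (∑±-swap I J f) (sym (∑±-+ J (f (+ suc I)) (f -[1+ I ]))) ⟩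
    ∑± J (λ j → ∑± I (λ i → f i j)) + ∑± J (λ j → f (+ suc I) j + f -[1+ I ] j)
      ≈⟨ ∑±-+ J (λ j → ∑± I (λ i → f i j)) (λ j → f (+ suc I) j + f -[1+ I ] j) ⟨
    ∑± J (λ j → ∑± I (λ i → f i j) + (f (+ suc I) j + f -[1+ I ] j)) ∎

  ∑±-* : ∀ I J f g → ∑± I (λ i → ∑± J (λ j → f i * g j)) ≈ ∑± I f * ∑± J g
  ∑±-* I J f g = trans (∑±-cong I λ i _ → ∑±-*ˡ J (f i) g) (∑±-*ʳ I (∑± J g) f)

  ∑±-neg : ∀ J f → ∑± J (λ i → f (ℤ.- i)) ≈ ∑± J f
  ∑±-neg zero f = refl
  ∑±-neg (suc J) f = +-cong (∑±-neg J f) (+-comm _ _)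

  Supported : ℕ → (ℤ → Carrier) → Set _
  Supported r f = ∀ i → r < ∣ i ∣ → f i ≈ 0#

  ∑±-stable : ∀ {r J f} → Supported r f → r ≤ J → ∑± J f ≈ ∑± r f
  ∑±-stable {r} {J} {f} supp r≤J = go (ℕₚ.≤⇒≤′ r≤J)
    where
    go : ∀ {J} → r ℕ.≤′ J → ∑± J f ≈ ∑± r f
    go ℕ.≤′-refl = refl
    go (ℕ.≤′-step {J} p) = trans
      (+-cong (go p) (trans (+-cong (supp (+ suc J) r<) (supp -[1+ J ] r<)) (+-identityˡ 0#)))
      (+-identityʳ _)
      where
      r< : r < suc J
      r< = s≤s (ℕₚ.≤′⇒≤ p)

  -- Sliding the window by one loses the bottom term and gains a new top term.
  ∑±-suc : ∀ J f → ∑± J (λ i → f (ℤ.suc i)) + f (ℤ.- + J) ≈ ∑± J f + f (+ suc J)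
  ∑±-suc zero f = +-comm _ _
  ∑±-suc (suc J) f = begin
    (∑± J (λ i → f (ℤ.suc i)) + (f (+ suc (suc J)) + f (ℤ.suc -[1+ J ]))) + f -[1+ J ]
      ≈⟨ +-congʳ (+-congˡ (+-congˡ (reflexive (≡.cong f (suc-neg J))))) ⟩
    (∑± J (λ i → f (ℤ.suc i)) + (f (+ suc (suc J)) + f (ℤ.- + J))) + f -[1+ J ]
      ≈⟨ solve 4 (λ s a b c → (s :+ (a :+ b)) :+ c := (s :+ b) :+ (c :+ a)) refl
           (∑± J (λ i → f (ℤ.suc i))) (f (+ suc (suc J))) (f (ℤ.- + J)) (f -[1+ J ]) ⟩
    (∑± J (λ i → f (ℤ.suc i)) + f (ℤ.- + J)) + (f -[1+ J ] + f (+ suc (suc J)))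
      ≈⟨ +-congʳ (∑±-suc J f) ⟩
    (∑± J f + f (+ suc J)) + (f -[1+ J ] + f (+ suc (suc J)))
      ≈⟨ solve 4 (λ s a b c → (s :+ a) :+ (b :+ c) := (s :+ (a :+ b)) :+ c) refl
           (∑± J f) (f (+ suc J)) (f -[1+ J ]) (f (+ suc (suc J))) ⟩
    (∑± J f + (f (+ suc J) + f -[1+ J ])) + f (+ suc (suc J)) ∎
    where
    suc-neg : ∀ J → ℤ.suc -[1+ J ] ≡ ℤ.- + J
    suc-neg zero = ≡.refl
    suc-neg (suc J) = ≡.refl

  private
    -- The bound on J keeps the terms lost and gained in each slide outside the support.
    ∑±-shiftℕ : ∀ {r J f} → Supported r f → ∀ n → r ℕ.+ n ≤ J → ∑± J (λ i → f (+ n ℤ.+ i)) ≈ ∑± J f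
    ∑±-shiftℕ {J = J} {f} supp zero _ = ∑±-cong J λ i _ → reflexive (≡.cong f (ℤₚ.+-identityˡ i))
    ∑±-shiftℕ {r} {J} {f} supp (suc n) r+n<J = begin
      ∑± J (λ i → f (+ suc n ℤ.+ i)) ≈⟨ ∑±-cong J (λ i _ → reflexive (≡.cong f (rearrange n i))) ⟩
      ∑± J (λ i → g (ℤ.suc i))       ≈⟨ +-identityʳ _ ⟨
      ∑± J (λ i → g (ℤ.suc i)) + 0#  ≈⟨ +-congˡ (supp (+ n ℤ.+ (ℤ.- + J)) below) ⟨
      ∑± J (λ i → g (ℤ.suc i)) + g (ℤ.- + J) ≈⟨ ∑±-suc J g ⟩
      ∑± J g + g (+ suc J)           ≈⟨ +-congˡ (supp (+ n ℤ.+ + suc J) above) ⟩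
      ∑± J g + 0#                    ≈⟨ +-identityʳ _ ⟩
      ∑± J g                         ≈⟨ ∑±-shiftℕ supp n (ℕₚ.<⇒≤ r+n<J′) ⟩
      ∑± J f ∎
      where
      g : ℤ → Carrier
      g i = f (+ n ℤ.+ i)
      r+n<J′ : r ℕ.+ n < J
      r+n<J′ = ≡.subst (_≤ J) (ℕₚ.+-suc r n) r+n<J
      rearrange : ∀ n i → + suc n ℤ.+ i ≡ + n ℤ.+ ℤ.suc i
      rearrange n i = ≡.trans (≡.cong (ℤ._+ i) (ℤₚ.+-comm (+ 1) (+ n))) (ℤₚ.+-assoc (+ n) (+ 1) i)
      below : r < ∣ + n ℤ.+ (ℤ.- + J) ∣
      below = ≡.subst (r <_) (≡.sym (≡.trans (≡.cong ∣_∣ (ℤₚ.[+m]-[+n]≡m⊖n n J)) (ℤₚ.∣⊖∣-≤ (ℕₚ.≤-trans (ℕₚ.m≤n+m n r) (ℕₚ.<⇒≤ r+n<J′)))))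
        (ℕₚ.m+n≤o⇒m≤o∸n (suc r) r+n<J′)
      above : r < n ℕ.+ suc J
      above = ℕₚ.≤-<-trans (ℕₚ.m≤m+n r n) (ℕₚ.<-≤-trans r+n<J′ (ℕₚ.≤-trans (ℕₚ.n≤1+n J) (ℕₚ.m≤n+m (suc J) n)))

  ∑±-shift : ∀ {r J f} → Supported r f → ∀ a → r ℕ.+ ∣ a ∣ ≤ J → ∑± J (λ i → f (a ℤ.+ i)) ≈ ∑± J f
  ∑±-shift supp (+ n) b = ∑±-shiftℕ supp n b
  ∑±-shift {r} {J} {f} supp -[1+ n ] b = begin
    -- A negative shift of `f` is a positive shift of its reflection.
    ∑± J (λ i → f (-[1+ n ] ℤ.+ i))          ≈⟨ ∑±-neg J (λ i → f (-[1+ n ] ℤ.+ i)) ⟨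
    ∑± J (λ i → f (-[1+ n ] ℤ.+ (ℤ.- i)))    ≈⟨ ∑±-cong J (λ i _ → reflexive (≡.cong f (≡.sym (ℤₚ.neg-distrib-+ (+ suc n) i)))) ⟩
    ∑± J (λ i → f (ℤ.- (+ suc n ℤ.+ i)))     ≈⟨ ∑±-shiftℕ {f = λ i → f (ℤ.- i)} (λ i p → supp (ℤ.- i) (≡.subst (r <_) (≡.sym (ℤₚ.∣-i∣≡∣i∣ i)) p)) (suc n) b ⟩
    ∑± J (λ i → f (ℤ.- i))                   ≈⟨ ∑±-neg J f ⟩
    ∑± J f ∎

  -- The even indices run from -2J to 2J, the odd ones from -2J + 1 to 2J + 1; this leaves one term
  -- above the symmetric window.
  ∑±-parity : ∀ J f → ∑± J (λ j → f (j ℤ.+ j)) + ∑± J (λ j → f (ℤ.suc (j ℤ.+ j))) ≈ ∑± (J ℕ.+ J) f + f (+ suc (J ℕ.+ J))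
  ∑±-parity zero f = refl
  ∑±-parity (suc J) f rewrite ℕₚ.+-suc J J = begin
    (∑± J (λ j → f (j ℤ.+ j)) + (p₂ + m₂)) + (∑± J (λ j → f (ℤ.suc (j ℤ.+ j))) + (p₃ + m₁))
      ≈⟨ solve 6 (λ a b p m q n → (a :+ (p :+ m)) :+ (b :+ (q :+ n)) := (a :+ b) :+ ((p :+ m) :+ (q :+ n))) refl
           (∑± J (λ j → f (j ℤ.+ j))) (∑± J (λ j → f (ℤ.suc (j ℤ.+ j)))) p₂ m₂ p₃ m₁ ⟩
    (∑± J (λ j → f (j ℤ.+ j)) + ∑± J (λ j → f (ℤ.suc (j ℤ.+ j)))) + ((p₂ + m₂) + (p₃ + m₁))
      ≈⟨ +-congʳ (∑±-parity J f) ⟩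
    (∑± (J ℕ.+ J) f + f (+ suc (J ℕ.+ J))) + ((p₂ + m₂) + (p₃ + m₁))
      ≈⟨ solve 6 (λ s a p m q n → (s :+ a) :+ ((p :+ m) :+ (q :+ n)) := ((s :+ (a :+ n)) :+ (p :+ m)) :+ q) refl
           (∑± (J ℕ.+ J) f) (f (+ suc (J ℕ.+ J))) p₂ m₂ p₃ m₁ ⟩
    ((∑± (J ℕ.+ J) f + (f (+ suc (J ℕ.+ J)) + m₁)) + (p₂ + m₂)) + p₃ ∎
    where
    p₂ p₃ m₁ m₂ : Carrier
    p₂ = f (+ suc (suc (J ℕ.+ J)))
    p₃ = f (+ suc (suc (suc (J ℕ.+ J))))
    m₁ = f -[1+ J ℕ.+ J ]
    m₂ = f -[1+ suc (J ℕ.+ J) ]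

  -- (j , k) ↦ (j + k , j - k) and (j , k) ↦ (j + k , j - k + 1) together cover ℤ² exactly once.
  ∑±-rotate : ∀ r {f g} → Supported r f → Supported r g →
    let r₂ = r ℕ.+ r ; r₃ = r ℕ.+ r₂ in
    ∑± r₂ (λ j → ∑± r₃ (λ k → f (j ℤ.+ k) * g (j ℤ.- k)))
      + ∑± r₂ (λ j → ∑± r₃ (λ k → f (j ℤ.+ k) * g (ℤ.suc (j ℤ.- k))))
      ≈ ∑± r f * ∑± r g
  ∑±-rotate r {f} {g} fs gs = begin
    ∑± r₂ (λ j → ∑± r₃ (λ k → f (j ℤ.+ k) * g (j ℤ.- k)))
      + ∑± r₂ (λ j → ∑± r₃ (λ k → f (j ℤ.+ k) * g (ℤ.suc (j ℤ.- k))))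
        ≈⟨ +-cong (shear (λ j → j ℤ.+ j) (λ j k → j ℤ.- k) even) (shear (λ j → ℤ.suc (j ℤ.+ j)) (λ j k → ℤ.suc (j ℤ.- k)) odd) ⟩
    ∑± r₃ (λ K → f K * ∑± r₂ (λ j → g (j ℤ.+ j ℤ.- K))) + ∑± r₃ (λ K → f K * ∑± r₂ (λ j → g (ℤ.suc (j ℤ.+ j) ℤ.- K)))
        ≈⟨ ∑±-+ r₃ _ _ ⟨
    ∑± r₃ (λ K → f K * ∑± r₂ (λ j → g (j ℤ.+ j ℤ.- K)) + f K * ∑± r₂ (λ j → g (ℤ.suc (j ℤ.+ j) ℤ.- K)))
        ≈⟨ ∑±-cong r₃ (λ K K≤ → trans (sym (distribˡ (f K) _ _)) (*-congˡ (column K K≤))) ⟩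
    ∑± r₃ (λ K → f K * ∑± r₄ g)
        ≈⟨ ∑±-*ʳ r₃ (∑± r₄ g) f ⟩
    ∑± r₃ f * ∑± r₄ g
        ≈⟨ *-cong (∑±-stable fs (ℕₚ.m≤m+n r r₂)) (∑±-stable gs (ℕₚ.≤-trans (ℕₚ.m≤m+n r r) (ℕₚ.m≤m+n r₂ r₂))) ⟩
    ∑± r f * ∑± r g ∎
    where
    -- A shift by |j| ≤ 2r of something supported in r fits into the window 3r, and a shift by |K| ≤
    -- 3r fits into 4r, so nothing in the support is cut off.
    r₂ r₃ r₄ : ℕ
    r₂ = r ℕ.+ r
    r₃ = r ℕ.+ r₂
    r₄ = r₂ ℕ.+ r₂
    r+r₃≡r₄ : r ℕ.+ r₃ ≡ r₄
    r+r₃≡r₄ = ≡.sym (ℕₚ.+-assoc r r r₂)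
    even : ∀ j k → j ℤ.- k ≡ j ℤ.+ j ℤ.- (j ℤ.+ k)
    even = solve-∀
    odd : ∀ j k → ℤ.suc (j ℤ.- k) ≡ ℤ.suc (j ℤ.+ j) ℤ.- (j ℤ.+ k)
    odd j k = ≡.trans (≡.cong ℤ.suc (even j k)) (≡.sym (ℤₚ.+-assoc (+ 1) (j ℤ.+ j) (ℤ.- (j ℤ.+ k))))
    shear : (d : ℤ → ℤ) (e : ℤ → ℤ → ℤ) → (∀ j k → e j k ≡ d j ℤ.- (j ℤ.+ k)) →
      ∑± r₂ (λ j → ∑± r₃ (λ k → f (j ℤ.+ k) * g (e j k))) ≈ ∑± r₃ (λ K → f K * ∑± r₂ (λ j → g (d j ℤ.- K)))
    shear d e eq = begin
      ∑± r₂ (λ j → ∑± r₃ (λ k → f (j ℤ.+ k) * g (e j k)))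
        ≈⟨ ∑±-cong r₂ (λ j _ → ∑±-cong r₃ λ k _ → *-congˡ (reflexive (≡.cong g (eq j k)))) ⟩
      ∑± r₂ (λ j → ∑± r₃ (λ k → f (j ℤ.+ k) * g (d j ℤ.- (j ℤ.+ k))))
        ≈⟨ ∑±-cong r₂ (λ j j≤ → ∑±-shift {f = λ K → f K * g (d j ℤ.- K)}
             (λ K r< → trans (*-congʳ (fs K r<)) (zeroˡ _)) j (ℕₚ.+-monoʳ-≤ r j≤)) ⟩
      ∑± r₂ (λ j → ∑± r₃ (λ K → f K * g (d j ℤ.- K)))
        ≈⟨ ∑±-swap r₂ r₃ (λ j K → f K * g (d j ℤ.- K)) ⟩
      ∑± r₃ (λ K → ∑± r₂ (λ j → f K * g (d j ℤ.- K)))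
        ≈⟨ ∑±-cong r₃ (λ K _ → ∑±-*ˡ r₂ (f K) (λ j → g (d j ℤ.- K))) ⟩
      ∑± r₃ (λ K → f K * ∑± r₂ (λ j → g (d j ℤ.- K))) ∎
    -- For fixed K = j + k the second coordinate is 2j - K on one coset and 2j + 1 - K on the other;
    -- together these run through every integer once.
    column : ∀ K → ∣ K ∣ ≤ r₃ → ∑± r₂ (λ j → g (j ℤ.+ j ℤ.- K)) + ∑± r₂ (λ j → g (ℤ.suc (j ℤ.+ j) ℤ.- K)) ≈ ∑± r₄ g
    column K K≤ = begin
      ∑± r₂ (λ j → g (j ℤ.+ j ℤ.- K)) + ∑± r₂ (λ j → g (ℤ.suc (j ℤ.+ j) ℤ.- K))
        ≈⟨ ∑±-parity r₂ (λ e → g (e ℤ.- K)) ⟩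
      ∑± r₄ (λ e → g (e ℤ.- K)) + g (+ suc r₄ ℤ.- K)
        ≈⟨ +-cong (∑±-cong r₄ λ e _ → reflexive (≡.cong g (ℤₚ.+-comm e (ℤ.- K)))) (gs _ far) ⟩
      ∑± r₄ (λ e → g (ℤ.- K ℤ.+ e)) + 0#
        ≈⟨ +-identityʳ _ ⟩
      ∑± r₄ (λ e → g (ℤ.- K ℤ.+ e))
        ≈⟨ ∑±-shift gs (ℤ.- K) (≡.subst₂ _≤_ (≡.cong (r ℕ.+_) (≡.sym (ℤₚ.∣-i∣≡∣i∣ K))) r+r₃≡r₄ (ℕₚ.+-monoʳ-≤ r K≤)) ⟩
      ∑± r₄ g ∎
      where
      -- The lone top index left over by `∑±-parity` is outside the support.
      far : r < ∣ + suc r₄ ℤ.- K ∣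
      far = ℕₚ.+-cancelʳ-< ∣ K ∣ r _ (ℕₚ.<-≤-trans
        (s≤s (≡.subst (r ℕ.+ ∣ K ∣ ≤_) r+r₃≡r₄ (ℕₚ.+-monoʳ-≤ r K≤)))
        (≡.subst (λ z → ∣ z ∣ ≤ ∣ + suc r₄ ℤ.- K ∣ ℕ.+ ∣ K ∣) (recover (+ suc r₄) K) (ℤₚ.∣i+j∣≤∣i∣+∣j∣ (+ suc r₄ ℤ.- K) K)))
        where
        recover : ∀ a b → (a ℤ.- b) ℤ.+ b ≡ a
        recover = solve-∀

  -- The sum over a + b = M. Keeping both indices avoids the subtraction M - b and makes the two
  -- q-Pascal rules mirror images.
  ∑△ : ℕ → (ℕ → ℕ → Carrier) → Carrier
  ∑△ zero g = g 0 0
  ∑△ (suc M) g = g (suc M) 0 + ∑△ M (λ a b → g a (suc b))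

  ∑△-cong : ∀ M {g h} → (∀ a b → a ℕ.+ b ≡ M → g a b ≈ h a b) → ∑△ M g ≈ ∑△ M h
  ∑△-cong zero e = e 0 0 ≡.refl
  ∑△-cong (suc M) e = +-cong (e (suc M) 0 (ℕₚ.+-identityʳ (suc M)))
    (∑△-cong M λ a b p → e a (suc b) (≡.trans (ℕₚ.+-suc a b) (≡.cong suc p)))

  ∑△-+ : ∀ M g h → ∑△ M (λ a b → g a b + h a b) ≈ ∑△ M g + ∑△ M h
  ∑△-+ zero g h = refl
  ∑△-+ (suc M) g h = trans (+-congˡ (∑△-+ M _ _))
    (solve 4 (λ a b c d → (a :+ b) :+ (c :+ d) := (a :+ c) :+ (b :+ d)) refl _ _ _ _)

  ∑△-*ˡ : ∀ M a g → ∑△ M (λ i j → a * g i j) ≈ a * ∑△ M g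
  ∑△-*ˡ zero a g = refl
  ∑△-*ˡ (suc M) a g = trans (+-congˡ (∑△-*ˡ M a _)) (sym (distribˡ a _ _))

  ∑△-last : ∀ M g → ∑△ (suc M) g ≈ ∑△ M (λ a b → g (suc a) b) + g 0 (suc M)
  ∑△-last zero g = refl
  ∑△-last (suc M) g = trans (+-congˡ (∑△-last M (λ a b → g a (suc b)))) (sym (+-assoc _ _ _))

  -- On the edges a = 0 and b = 0 an entry has only one parent. Extending p and q by zero across the
  -- edges makes all entries alike.
  ∑△-pascal : ∀ M (f p q : ℕ → ℕ → Carrier) →
    (∀ a → f (suc a) 0 ≈ p a 0) → (∀ b → f 0 (suc b) ≈ q 0 b) →
    (∀ a b → f (suc a) (suc b) ≈ p a (suc b) + q (suc a) b) →
    ∑△ (suc M) f ≈ ∑△ M p + ∑△ M q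
  ∑△-pascal M f p q f₀ f⁰ f⁺ = begin
    ∑△ (suc M) f                              ≈⟨ ∑△-cong (suc M) split ⟩
    ∑△ (suc M) (λ a b → p′ a b + q′ a b)      ≈⟨ ∑△-+ (suc M) p′ q′ ⟩
    ∑△ (suc M) p′ + ∑△ (suc M) q′             ≈⟨ +-cong (trans (∑△-last M p′) (+-identityʳ _)) (+-identityˡ _) ⟩
    ∑△ M p + ∑△ M q                           ∎
    where
    p′ q′ : ℕ → ℕ → Carrier
    p′ zero b = 0#
    p′ (suc a) b = p a b
    q′ a zero = 0#
    q′ a (suc b) = q a b
    split : ∀ a b → a ℕ.+ b ≡ suc M → f a b ≈ p′ a b + q′ a b
    split zero (suc b) _ = trans (f⁰ b) (sym (+-identityˡ _))
    split (suc a) zero _ = trans (f₀ a) (sym (+-identityʳ _))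
    split (suc a) (suc b) _ = f⁺ a b

  ∑△-centre : ∀ M f → ∑△ (M ℕ.+ M) (λ a b → f (+ b ℤ.- + M)) ≈ ∑± M f
  ∑△-centre zero f = refl
  ∑△-centre (suc M) f rewrite ℕₚ.+-suc M M = begin
    f -[1+ M ] + ∑△ (suc (M ℕ.+ M)) (λ a b → f (+ suc b ℤ.- + suc M))
      ≈⟨ +-congˡ (∑△-cong (suc (M ℕ.+ M)) λ a b _ → reflexive (≡.cong f (step (+ b) (+ M)))) ⟩
    f -[1+ M ] + ∑△ (suc (M ℕ.+ M)) (λ a b → f (+ b ℤ.- + M))
      ≈⟨ +-congˡ (∑△-last (M ℕ.+ M) (λ a b → f (+ b ℤ.- + M))) ⟩
    f -[1+ M ] + (∑△ (M ℕ.+ M) (λ a b → f (+ b ℤ.- + M)) + f (+ suc (M ℕ.+ M) ℤ.- + M))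
      ≈⟨ +-congˡ (+-cong (∑△-centre M f) (reflexive (≡.cong f (top (+ M))))) ⟩
    f -[1+ M ] + (∑± M f + f (+ suc M))
      ≈⟨ solve 3 (λ a s b → a :+ (s :+ b) := s :+ (b :+ a)) refl (f -[1+ M ]) (∑± M f) (f (+ suc M)) ⟩
    ∑± M f + (f (+ suc M) + f -[1+ M ]) ∎
    where
    step : ∀ b M → (+ 1 ℤ.+ b) ℤ.- (+ 1 ℤ.+ M) ≡ b ℤ.- M
    step = solve-∀
    top : ∀ M → + 1 ℤ.+ (M ℤ.+ M) ℤ.- M ≡ + 1 ℤ.+ M
    top = solve-∀

-- Quadratic exponents of the theta series.

n²-n : ℤ → ℕ
n²-n (+ zero) = 0
n²-n (+ suc p) = p ℕ.* suc p
n²-n -[1+ p ] = suc p ℕ.* suc (suc p)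

n²-n-correct : ∀ i → + n²-n i ≡ i ℤ.* i ℤ.- i
n²-n-correct (+ zero) = ≡.refl
n²-n-correct (+ suc p) = ≡.trans (ℤₚ.pos-* p (suc p)) (identity (+ p))
  where
  identity : ∀ p → p ℤ.* (+ 1 ℤ.+ p) ≡ (+ 1 ℤ.+ p) ℤ.* (+ 1 ℤ.+ p) ℤ.- (+ 1 ℤ.+ p)
  identity = solve-∀
n²-n-correct -[1+ p ] = ≡.trans (ℤₚ.pos-* (suc p) (suc (suc p))) (identity (+ p))
  where
  identity : ∀ p → (+ 1 ℤ.+ p) ℤ.* (+ 2 ℤ.+ p) ≡ (ℤ.- (+ 1 ℤ.+ p)) ℤ.* (ℤ.- (+ 1 ℤ.+ p)) ℤ.- (ℤ.- (+ 1 ℤ.+ p))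
  identity = solve-∀

n²-n-bound : ∀ i → ∣ i ∣ ≤ suc (n²-n i)
n²-n-bound (+ zero) = z≤n
n²-n-bound (+ suc p) = s≤s (ℕₚ.≤-trans (ℕₚ.≤-reflexive (≡.sym (ℕₚ.*-identityʳ p))) (ℕₚ.*-monoʳ-≤ p (s≤s z≤n)))
n²-n-bound -[1+ p ] = ℕₚ.m≤n⇒m≤1+n (ℕₚ.m≤m*n (suc p) (suc (suc p)))

i*i≡+ : ∀ i → i ℤ.* i ≡ + (∣ i ∣ ℕ.* ∣ i ∣)
i*i≡+ (+ n) = ≡.sym (ℤₚ.pos-* n n)
i*i≡+ -[1+ n ] = ≡.refl

-- `square` and `pronic` are the exponents of the product sides, `double⁻` and `double⁺` those of
-- distinct partitions of charge 0 and 1.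
data Theta : Set where
  square pronic double⁻ double⁺ : Theta

exponent : Theta → ℤ → ℤ
exponent square i = i ℤ.* i
exponent pronic i = i ℤ.* i ℤ.- i
exponent double⁻ i = + 2 ℤ.* (i ℤ.* i) ℤ.- i
exponent double⁺ i = + 2 ℤ.* (i ℤ.* i) ℤ.+ i

exponentℕ : Theta → ℤ → ℕ
exponentℕ square i = ∣ i ∣ ℕ.* ∣ i ∣
exponentℕ pronic i = n²-n i
exponentℕ double⁻ i = ∣ i ∣ ℕ.* ∣ i ∣ ℕ.+ n²-n i
exponentℕ double⁺ i = ∣ i ∣ ℕ.* ∣ i ∣ ℕ.+ n²-n (ℤ.- i)

exponent≡ : ∀ t i → exponent t i ≡ + exponentℕ t i
exponent≡ square i = i*i≡+ i
exponent≡ pronic i = ≡.sym (n²-n-correct i)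
exponent≡ double⁻ i = ≡.trans (split i) (≡.cong₂ ℤ._+_ (i*i≡+ i) (≡.sym (n²-n-correct i)))
  where
  split : ∀ i → + 2 ℤ.* (i ℤ.* i) ℤ.- i ≡ i ℤ.* i ℤ.+ (i ℤ.* i ℤ.- i)
  split = solve-∀
exponent≡ double⁺ i = ≡.trans (split i) (≡.cong₂ ℤ._+_ (i*i≡+ i) (≡.sym (n²-n-correct (ℤ.- i))))
  where
  split : ∀ i → + 2 ℤ.* (i ℤ.* i) ℤ.+ i ≡ i ℤ.* i ℤ.+ ((ℤ.- i) ℤ.* (ℤ.- i) ℤ.- (ℤ.- i))
  split = solve-∀

exponent-nonneg : ∀ t i → + 0 ℤ.≤ exponent t i
exponent-nonneg t i = ≡.subst (+ 0 ℤ.≤_) (≡.sym (exponent≡ t i)) (ℤ.+≤+ z≤n)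

square-bound : ∀ n → n ≤ n ℕ.* n
square-bound zero = z≤n
square-bound (suc n) = ℕₚ.m≤m*n (suc n) (suc n)

-- This gives theta terms the support radius N + 1. The `suc` is forced by `pronic`, whose exponent
-- at 1 is 0.
exponent-bound : ∀ t i → ∣ i ∣ ≤ suc ∣ exponent t i ∣
exponent-bound t i = ≡.subst (λ e → ∣ i ∣ ≤ suc ∣ e ∣) (≡.sym (exponent≡ t i)) (bound t)
  where
  bound : ∀ t → ∣ i ∣ ≤ suc (exponentℕ t i)
  bound square = ℕₚ.m≤n⇒m≤1+n (square-bound ∣ i ∣)
  bound pronic = n²-n-bound i
  bound double⁻ = ℕₚ.m≤n⇒m≤1+n (ℕₚ.≤-trans (square-bound ∣ i ∣) (ℕₚ.m≤m+n _ _))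
  bound double⁺ = ℕₚ.m≤n⇒m≤1+n (ℕₚ.≤-trans (square-bound ∣ i ∣) (ℕₚ.m≤m+n _ _))

-- Gaussian binomial coefficients over a ring in which x is nilpotent.

module QSeries {c ℓ : Level} (R : CommutativeRing c ℓ) where
  open CommutativeRing R
  open Algebra.Properties.Semiring.Exp semiring using (_^_; ^-homo-*; ^-congʳ)
  open Units R
  open FiniteSums R
  open IntegerSolver R
  open Relation.Binary.Reasoning.Setoid setoid

  module Truncated (x : Carrier) (N : ℕ) (x-nilpotent : x ^ suc N ≈ 0#) where

    x^-vanishes : ∀ n → N < n → x ^ n ≈ 0#
    x^-vanishes n N<n = begin
      x ^ n                           ≈⟨ ^-congʳ x (ℕₚ.m+[n∸m]≡n N<n) ⟨
      x ^ (suc N ℕ.+ (n ℕ.∸ suc N))   ≈⟨ ^-homo-* x (suc N) (n ℕ.∸ suc N) ⟩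
      x ^ suc N * x ^ (n ℕ.∸ suc N)   ≈⟨ *-congʳ x-nilpotent ⟩
      0# * x ^ (n ℕ.∸ suc N)          ≈⟨ zeroˡ _ ⟩
      0# ∎

    1+x^-unit : ∀ n a → IsUnit (1# + x ^ suc n * a)
    1+x^-unit n a = let (b , e) = unit-1+ {x} {suc N} x-nilpotent (x ^ n * a)
                    in b , trans (*-congʳ (+-congˡ (*-assoc x (x ^ n) a))) e

    -- The base of the q-binomial coefficients is q = x².
    q^_ : ℕ → Carrier
    q^ n = x ^ (n ℕ.+ n)

    q^-+ : ∀ m n → q^ (m ℕ.+ n) ≈ q^ m * q^ n
    q^-+ m n = trans (^-congʳ x (≡.trans (ℕₚ.+-assoc m n (m ℕ.+ n)) (≡.trans (≡.cong (m ℕ.+_) swap) (≡.sym (ℕₚ.+-assoc m m (n ℕ.+ n))))))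
      (^-homo-* x (m ℕ.+ m) (n ℕ.+ n))
      where
      swap : n ℕ.+ (m ℕ.+ n) ≡ m ℕ.+ (n ℕ.+ n)
      swap = ≡.trans (≡.sym (ℕₚ.+-assoc n m n)) (≡.trans (≡.cong (ℕ._+ n) (ℕₚ.+-comm n m)) (ℕₚ.+-assoc m n n))

    q^-vanishes : ∀ n → N ≤ n → q^ suc n ≈ 0#
    q^-vanishes n N≤n = x^-vanishes _ (s≤s (ℕₚ.≤-trans N≤n (ℕₚ.m≤m+n n (suc n))))

    1-q^-unit : ∀ n → IsUnit (1# - q^ suc n)
    1-q^-unit n = let (b , e) = 1+x^-unit (n ℕ.+ suc n) (- 1#)
      in b , trans (*-congʳ (+-congˡ (solve 1 (λ a → :- a := a :* (:- :1)) refl (q^ suc n)))) e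

    -- The q-Pochhammer symbol (q;q)_n.
    [q]_ : ℕ → Carrier
    [q] n = ∏ n (λ k → 1# - q^ suc k)

    [q]⁻¹_ : ℕ → Carrier
    [q]⁻¹ n = ∏ n (λ k → proj₁ (1-q^-unit k))

    [q]-inverse : ∀ n → [q] n * [q]⁻¹ n ≈ 1#
    [q]-inverse zero = *-identityˡ 1#
    [q]-inverse (suc n) = proj₂ (unit-* ([q]⁻¹ n , [q]-inverse n) (1-q^-unit n))

    [q]⁻¹-step : ∀ n → [q]⁻¹ n ≈ (1# - q^ suc n) * [q]⁻¹ (suc n)
    [q]⁻¹-step n = begin
      [q]⁻¹ n                                              ≈⟨ *-identityʳ _ ⟨
      [q]⁻¹ n * 1#                                         ≈⟨ *-congˡ (proj₂ (1-q^-unit n)) ⟨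
      [q]⁻¹ n * ((1# - q^ suc n) * proj₁ (1-q^-unit n))
        ≈⟨ solve 3 (λ i f g → i :* (f :* g) := f :* (i :* g)) refl ([q]⁻¹ n) (1# - q^ suc n) (proj₁ (1-q^-unit n)) ⟩
      (1# - q^ suc n) * ([q]⁻¹ n * proj₁ (1-q^-unit n))    ∎

    -- The Gaussian coefficient of a + b over b; the quotient makes sense because every `[q] n` is a
    -- unit.
    binomial : ℕ → ℕ → Carrier
    binomial a b = [q] (a ℕ.+ b) * ([q]⁻¹ a * [q]⁻¹ b)

    binomial-0ʳ : ∀ a → binomial a 0 ≈ 1#
    binomial-0ʳ a = begin
      [q] (a ℕ.+ 0) * ([q]⁻¹ a * 1#) ≈⟨ *-cong (reflexive (≡.cong [q]_ (ℕₚ.+-identityʳ a))) (*-identityʳ _) ⟩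
      [q] a * [q]⁻¹ a                ≈⟨ [q]-inverse a ⟩
      1# ∎

    binomial-0ˡ : ∀ b → binomial 0 b ≈ 1#
    binomial-0ˡ b = trans (*-congˡ (*-identityˡ _)) ([q]-inverse b)

    module _ (a b : ℕ) where
      private
        A B P A⁻ B⁻ : Carrier
        A = q^ suc a
        B = q^ suc b
        P = [q] (a ℕ.+ suc b)
        A⁻ = [q]⁻¹ suc a
        B⁻ = [q]⁻¹ suc b

        top : binomial (suc a) (suc b) ≈ (P * (1# - A * B)) * (A⁻ * B⁻)
        top = *-congʳ (*-congˡ (+-congˡ (-‿cong (q^-+ (suc a) (suc b)))))

        left : binomial a (suc b) ≈ P * ((1# - A) * A⁻ * B⁻)
        left = *-congˡ (*-congʳ ([q]⁻¹-step a))

        right : binomial (suc a) b ≈ P * (A⁻ * ((1# - B) * B⁻))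
        right = *-cong (reflexive (≡.cong [q]_ (≡.sym (ℕₚ.+-suc a b)))) (*-congˡ ([q]⁻¹-step b))

      -- With the common factors pulled out this is 1 - AB = (1 - A) + A(1 - B).
      pascalˡ : binomial (suc a) (suc b) ≈ binomial a (suc b) + A * binomial (suc a) b
      pascalˡ = trans top (trans
        (solve 5 (λ P A B I J → (P :* (:1 :- A :* B)) :* (I :* J)
                  := P :* ((:1 :- A) :* I :* J) :+ A :* (P :* (I :* ((:1 :- B) :* J)))) refl P A B A⁻ B⁻)
        (sym (+-cong left (*-congˡ right))))

      -- The other splitting, 1 - AB = B(1 - A) + (1 - B).
      pascalʳ : binomial (suc a) (suc b) ≈ B * binomial a (suc b) + binomial (suc a) b
      pascalʳ = trans top (trans
        (solve 5 (λ P A B I J → (P :* (:1 :- A :* B)) :* (I :* J)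
                  := B :* (P :* ((:1 :- A) :* I :* J)) :+ P :* (I :* ((:1 :- B) :* J))) refl P A B A⁻ B⁻)
        (sym (+-cong (*-congˡ left) right)))

    -- The common value, 1/(q;q)_∞, of all central q-binomial coefficients modulo x^(N+1).
    β : Carrier
    β = [q]⁻¹ N

    private
      factor≈1 : ∀ k → N ≤ k → 1# - q^ suc k ≈ 1#
      factor≈1 k N≤k = trans (+-congˡ (-‿cong (q^-vanishes k N≤k))) (solve 0 (:1 :- :0 := :1) refl)

      [q]⁻¹-stable : ∀ n → N ≤ n → [q]⁻¹ n ≈ β
      [q]⁻¹-stable n N≤n = ∏-stable N≤n λ k N≤k → begin
        proj₁ (1-q^-unit k)                      ≈⟨ *-identityˡ _ ⟨
        1# * proj₁ (1-q^-unit k)                 ≈⟨ *-congʳ (factor≈1 k N≤k) ⟨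
        (1# - q^ suc k) * proj₁ (1-q^-unit k)    ≈⟨ proj₂ (1-q^-unit k) ⟩
        1# ∎

    -- The factors 1 - q^(k+1) with k ≥ N equal 1, so all three symbols have reached their final
    -- values, and (q;q)_N β² = β.
    binomial-stable : ∀ a b → N ≤ a → N ≤ b → binomial a b ≈ β
    binomial-stable a b N≤a N≤b = begin
      [q] (a ℕ.+ b) * ([q]⁻¹ a * [q]⁻¹ b)
        ≈⟨ *-cong (∏-stable (ℕₚ.≤-trans N≤a (ℕₚ.m≤m+n a b)) factor≈1) (*-cong ([q]⁻¹-stable a N≤a) ([q]⁻¹-stable b N≤b)) ⟩
      [q] N * (β * β)   ≈⟨ *-assoc _ _ _ ⟨
      ([q] N * β) * β   ≈⟨ *-congʳ ([q]-inverse N) ⟩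
      1# * β            ≈⟨ *-identityˡ β ⟩
      β ∎

    q-sum : ℕ → (ℕ → ℕ → Carrier) → Carrier
    q-sum M g = ∑△ M (λ a b → binomial a b * g a b)

    q-sum-cong : ∀ M {g h} → (∀ a b → a ℕ.+ b ≡ M → g a b ≈ h a b) → q-sum M g ≈ q-sum M h
    q-sum-cong M e = ∑△-cong M λ a b p → *-congˡ (e a b p)

    q-sum-*ˡ : ∀ M a g → q-sum M (λ i j → a * g i j) ≈ a * q-sum M g
    q-sum-*ˡ M a g = trans (∑△-cong M λ i j _ → solve 3 (λ b a g → b :* (a :* g) := a :* (b :* g)) refl (binomial i j) a (g i j))
      (∑△-*ˡ M a _)

    q-sum-pascalˡ : ∀ M g → q-sum (suc M) g ≈ q-sum M (λ a b → g (suc a) b) + q-sum M (λ a b → q^ a * g a (suc b))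
    q-sum-pascalˡ M g = ∑△-pascal M (λ a b → binomial a b * g a b)
      (λ a b → binomial a b * g (suc a) b) (λ a b → binomial a b * (q^ a * g a (suc b)))
      (λ a → *-congʳ (trans (binomial-0ʳ (suc a)) (sym (binomial-0ʳ a))))
      (λ b → *-cong (trans (binomial-0ˡ (suc b)) (sym (binomial-0ˡ b))) (sym (*-identityˡ _)))
      (λ a b → trans (*-congʳ (pascalˡ a b))
        (solve 4 (λ s A t g → (s :+ A :* t) :* g := s :* g :+ t :* (A :* g)) refl
          (binomial a (suc b)) (q^ suc a) (binomial (suc a) b) (g (suc a) (suc b))))

    q-sum-pascalʳ : ∀ M g → q-sum (suc M) g ≈ q-sum M (λ a b → q^ b * g (suc a) b) + q-sum M (λ a b → g a (suc b))
    q-sum-pascalʳ M g = ∑△-pascal M (λ a b → binomial a b * g a b)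
      (λ a b → binomial a b * (q^ b * g (suc a) b)) (λ a b → binomial a b * g a (suc b))
      (λ a → *-cong (trans (binomial-0ʳ (suc a)) (sym (binomial-0ʳ a))) (sym (*-identityˡ _)))
      (λ b → *-congʳ (trans (binomial-0ˡ (suc b)) (sym (binomial-0ˡ b))))
      (λ a b → trans (*-congʳ (pascalʳ a b))
        (solve 4 (λ s B t g → (B :* s :+ t) :* g := s :* (B :* g) :+ t :* g) refl
          (binomial a (suc b)) (q^ suc b) (binomial (suc a) b) (g (suc a) (suc b))))

    -- This replaces the passage to the limit. Since M ≥ 2N + 1, either a and b are both at least N
    -- and the coefficient is `β`, or b is further than N + 1 from M and f kills the term.
    q-sum-centre : ∀ M {f} → Supported (suc N) f → suc N ℕ.+ N ≤ M → q-sum (M ℕ.+ M) (λ a b → f (+ b ℤ.- + M)) ≈ β * ∑± M f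
    q-sum-centre M {f} supp big = begin
      q-sum (M ℕ.+ M) (λ a b → f (+ b ℤ.- + M))          ≈⟨ ∑△-cong (M ℕ.+ M) term ⟩
      ∑△ (M ℕ.+ M) (λ a b → β * f (+ b ℤ.- + M))         ≈⟨ ∑△-*ˡ (M ℕ.+ M) β _ ⟩
      β * ∑△ (M ℕ.+ M) (λ a b → f (+ b ℤ.- + M))         ≈⟨ *-congˡ (∑△-centre M f) ⟩
      β * ∑± M f ∎
      where
      outside : ∀ {a b} → suc N < ∣ + b ℤ.- + M ∣ → binomial a b * f (+ b ℤ.- + M) ≈ β * f (+ b ℤ.- + M)
      outside p = trans (*-congˡ (supp _ p)) (trans (zeroʳ _) (sym (trans (*-congˡ (supp _ p)) (zeroʳ _))))
      term : ∀ a b → a ℕ.+ b ≡ M ℕ.+ M → binomial a b * f (+ b ℤ.- + M) ≈ β * f (+ b ℤ.- + M)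
      term a b e with N ℕ.≤? a | N ℕ.≤? b
      ... | yes N≤a | yes N≤b = *-congʳ (binomial-stable a b N≤a N≤b)
      ... | no N≰a | _ = outside {a} (≡.subst (suc N <_) dist far)
        where
        a<N : a < N
        a<N = ℕₚ.≰⇒> N≰a
        far : suc N < M ℕ.∸ a
        far = ℕₚ.m+n≤o⇒m≤o∸n (suc (suc N)) (ℕₚ.≤-trans (ℕₚ.≤-reflexive (≡.sym (ℕₚ.+-suc (suc N) a))) (ℕₚ.≤-trans (ℕₚ.+-monoʳ-≤ (suc N) a<N) big))
        a≤M : a ≤ M
        a≤M = ℕₚ.≤-trans (ℕₚ.<⇒≤ a<N) (ℕₚ.≤-trans (ℕₚ.m≤n+m N (suc N)) big)
        regroup : ∀ a b M → (a ℤ.+ b) ℤ.- M ℤ.- a ≡ b ℤ.- M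
        regroup = solve-∀
        cancel : ∀ a M → (M ℤ.+ M) ℤ.- M ℤ.- a ≡ M ℤ.- a
        cancel = solve-∀
        dist : M ℕ.∸ a ≡ ∣ + b ℤ.- + M ∣
        dist = ≡.sym (≡.trans (≡.cong ∣_∣ (≡.trans (≡.sym (regroup (+ a) (+ b) (+ M)))
          (≡.trans (≡.cong (λ s → + s ℤ.- + M ℤ.- + a) e) (≡.trans (cancel (+ a) (+ M)) (ℤₚ.[+m]-[+n]≡m⊖n M a)))))
          (≡.cong ∣_∣ (ℤₚ.⊖-≥ a≤M)))
      ... | yes _ | no N≰b = outside {a} (≡.subst (suc N <_) dist far)
        where
        b<N : b < N
        b<N = ℕₚ.≰⇒> N≰b
        far : suc N < M ℕ.∸ b
        far = ℕₚ.m+n≤o⇒m≤o∸n (suc (suc N)) (ℕₚ.≤-trans (ℕₚ.≤-reflexive (≡.sym (ℕₚ.+-suc (suc N) b))) (ℕₚ.≤-trans (ℕₚ.+-monoʳ-≤ (suc N) b<N) big))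
        dist : M ℕ.∸ b ≡ ∣ + b ℤ.- + M ∣
        dist = ≡.sym (≡.trans (≡.cong ∣_∣ (ℤₚ.[+m]-[+n]≡m⊖n b M)) (ℤₚ.∣⊖∣-≤ (ℕₚ.≤-trans (ℕₚ.<⇒≤ b<N) (ℕₚ.≤-trans (ℕₚ.m≤n+m N (suc N)) big))))

-- Integer powers of a unit.

module UnitPowers {c ℓ : Level} (R : CommutativeRing c ℓ) where
  open CommutativeRing R
  open Algebra.Properties.Semiring.Exp semiring using (_^_)
  open IntegerSolver R
  open Relation.Binary.Reasoning.Setoid setoid

  module Power (w w⁻ : Carrier) (w*w⁻≈1 : w * w⁻ ≈ 1#) where

    w^_ : ℤ → Carrier
    w^ (+ n) = w ^ n
    w^ -[1+ n ] = w⁻ ^ suc n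

    w^-suc : ∀ i → w^ (ℤ.suc i) ≈ w * w^ i
    w^-suc (+ n) = refl
    w^-suc -[1+ zero ] = sym (trans (*-congˡ (*-identityʳ w⁻)) w*w⁻≈1)
    w^-suc -[1+ suc n ] = begin
      w⁻ ^ suc n                  ≈⟨ *-identityˡ _ ⟨
      1# * w⁻ ^ suc n             ≈⟨ *-congʳ w*w⁻≈1 ⟨
      (w * w⁻) * w⁻ ^ suc n       ≈⟨ *-assoc _ _ _ ⟩
      w * (w⁻ * w⁻ ^ suc n)       ∎

    w^-pred : ∀ i → w^ (ℤ.pred i) ≈ w⁻ * w^ i
    w^-pred i = begin
      w^ (ℤ.pred i)               ≈⟨ *-identityˡ _ ⟨
      1# * w^ (ℤ.pred i)          ≈⟨ *-congʳ w*w⁻≈1 ⟨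
      (w * w⁻) * w^ (ℤ.pred i)    ≈⟨ solve 3 (λ a b c → (a :* b) :* c := b :* (a :* c)) refl w w⁻ _ ⟩
      w⁻ * (w * w^ (ℤ.pred i))    ≈⟨ *-congˡ (w^-suc (ℤ.pred i)) ⟨
      w⁻ * w^ (ℤ.suc (ℤ.pred i))  ≈⟨ *-congˡ (reflexive (≡.cong w^_ (ℤₚ.suc-pred i))) ⟩
      w⁻ * w^ i                   ∎

    w^-+ : ∀ i j → w^ (i ℤ.+ j) ≈ w^ i * w^ j
    w^-+ (+ zero) j = trans (reflexive (≡.cong w^_ (ℤₚ.+-identityˡ j))) (sym (*-identityˡ _))
    w^-+ (+ suc n) j = begin
      w^ (+ suc n ℤ.+ j)          ≈⟨ reflexive (≡.cong w^_ (ℤₚ.+-assoc (+ 1) (+ n) j)) ⟩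
      w^ (ℤ.suc (+ n ℤ.+ j))      ≈⟨ w^-suc (+ n ℤ.+ j) ⟩
      w * w^ (+ n ℤ.+ j)          ≈⟨ *-congˡ (w^-+ (+ n) j) ⟩
      w * (w ^ n * w^ j)          ≈⟨ *-assoc _ _ _ ⟨
      (w * w ^ n) * w^ j          ∎
    w^-+ -[1+ zero ] j = trans (w^-pred j) (*-congʳ (sym (*-identityʳ w⁻)))
    w^-+ -[1+ suc n ] j = begin
      w^ (-[1+ suc n ] ℤ.+ j)          ≈⟨ reflexive (≡.cong w^_ (ℤₚ.+-assoc (ℤ.- + 1) -[1+ n ] j)) ⟩
      w^ (ℤ.pred (-[1+ n ] ℤ.+ j))     ≈⟨ w^-pred (-[1+ n ] ℤ.+ j) ⟩
      w⁻ * w^ (-[1+ n ] ℤ.+ j)         ≈⟨ *-congˡ (w^-+ -[1+ n ] j) ⟩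
      w⁻ * (w⁻ ^ suc n * w^ j)         ≈⟨ *-assoc _ _ _ ⟨
      (w⁻ * w⁻ ^ suc n) * w^ j         ∎

-- Jacobi's triple product, in finite form and modulo x^(N+1).

module TripleProduct {c ℓ : Level} (R : CommutativeRing c ℓ) where
  open CommutativeRing R
  open Algebra.Properties.Semiring.Exp semiring using (_^_; ^-homo-*)
  open FiniteSums R
  open QSeries R
  open UnitPowers R
  open IntegerSolver R
  open Relation.Binary.Reasoning.Setoid setoid

  module Monomials (x : Carrier) (N : ℕ) (x-nilpotent : x ^ suc N ≈ 0#) where
    open Truncated x N x-nilpotent

    -- Junk value: negative powers of x are 0#.
    x^ℤ_ : ℤ → Carrier
    x^ℤ (+ n) = x ^ n
    x^ℤ -[1+ n ] = 0#

    x^ℤ-+ : ∀ {i j} → + 0 ℤ.≤ i → + 0 ℤ.≤ j → x^ℤ (i ℤ.+ j) ≈ x^ℤ i * x^ℤ j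
    x^ℤ-+ {+ m} {+ n} _ _ = ^-homo-* x m n

    x^ℤ-vanishes : ∀ i → N < ∣ i ∣ → x^ℤ i ≈ 0#
    x^ℤ-vanishes (+ n) = x^-vanishes n
    x^ℤ-vanishes -[1+ n ] _ = refl

    module Monomial (w w⁻ : Carrier) (w*w⁻≈1 : w * w⁻ ≈ 1#) where
      open Power w w⁻ w*w⁻≈1 public

      mono : ℤ → ℤ → Carrier
      mono e k = x^ℤ e * w^ k

      mono-* : ∀ {d e} → + 0 ℤ.≤ d → + 0 ℤ.≤ e → ∀ j k → mono d j * mono e k ≈ mono (d ℤ.+ e) (j ℤ.+ k)
      mono-* {d} {e} d≥0 e≥0 j k = trans
        (solve 4 (λ a b c d → (a :* b) :* (c :* d) := (a :* c) :* (b :* d)) refl (x^ℤ d) (w^ j) (x^ℤ e) (w^ k))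
        (sym (*-cong (x^ℤ-+ d≥0 e≥0) (w^-+ j k)))

      mono-vanishes : ∀ e k → N < ∣ e ∣ → mono e k ≈ 0#
      mono-vanishes e k N<e = trans (*-congʳ (x^ℤ-vanishes e N<e)) (zeroˡ _)

      mono-cong : ∀ {d e j k} → d ≡ e → j ≡ k → mono d j ≈ mono e k
      mono-cong ≡.refl ≡.refl = refl

      mono-q^* : ∀ n {e} → + 0 ℤ.≤ e → ∀ k → q^ n * mono e k ≈ mono (+ n ℤ.+ + n ℤ.+ e) k
      mono-q^* n {e} e≥0 k = trans (sym (*-assoc _ _ _)) (*-congʳ (sym (x^ℤ-+ {+ (n ℕ.+ n)} {e} (ℤ.+≤+ z≤n) e≥0)))

      ϑ : Theta → ℤ → Carrier
      ϑ t i = mono (exponent t i) i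

      ϑ-supported : ∀ t → Supported (suc N) (ϑ t)
      ϑ-supported t i N<i = mono-vanishes (exponent t i) i (ℕₚ.≤-pred (ℕₚ.≤-trans N<i (exponent-bound t i)))

      ϑ-0 : ∀ t → ϑ t (+ 0) ≈ 1#
      ϑ-0 square = *-identityˡ 1#
      ϑ-0 pronic = *-identityˡ 1#
      ϑ-0 double⁻ = *-identityˡ 1#
      ϑ-0 double⁺ = *-identityˡ 1#

      q-sum-ϑ-0 : ∀ t → q-sum 0 (λ a b → ϑ t (+ b)) ≈ 1#
      q-sum-ϑ-0 t = trans (*-cong (binomial-0ʳ 0) (ϑ-0 t)) (*-identityˡ 1#)

      -- δ and δ′ are the first exponents of the products in w and in w⁻. They add up to 2 because q
      -- = x².
      module _ (t : Theta) (δ δ′ : ℕ) (δ+δ′≡2 : δ ℕ.+ δ′ ≡ 2)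
               (step : ∀ i → exponent t (+ 1 ℤ.+ i) ≡ exponent t i ℤ.+ (i ℤ.+ i) ℤ.+ + δ) where
        private
          up down : ℕ → Carrier
          up n = mono (+ (δ ℕ.+ (n ℕ.+ n))) (+ 1)
          down n = mono (+ (δ′ ℕ.+ (n ℕ.+ n))) (ℤ.- + 1)

          -- The power of q supplies 2a and the increment of the exponent 2b + δ, so the extra
          -- factor depends only on a + b and can be taken out of an antidiagonal sum.
          ascend : ∀ a b → q^ a * ϑ t (+ suc b) ≈ up (a ℕ.+ b) * ϑ t (+ b)
          ascend a b = begin
            q^ a * ϑ t (+ suc b)
              ≈⟨ mono-q^* a (exponent-nonneg t (+ suc b)) (+ suc b) ⟩
            mono (+ a ℤ.+ + a ℤ.+ exponent t (+ suc b)) (+ suc b)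
              ≈⟨ mono-cong (≡.trans (≡.cong (λ e → + a ℤ.+ + a ℤ.+ e) (step (+ b))) (regroup (+ a) (+ b) (+ δ) (exponent t (+ b)))) (≡.refl {x = + suc b}) ⟩
            mono (+ (δ ℕ.+ ((a ℕ.+ b) ℕ.+ (a ℕ.+ b))) ℤ.+ exponent t (+ b)) (+ 1 ℤ.+ + b)
              ≈⟨ mono-* (ℤ.+≤+ z≤n) (exponent-nonneg t (+ b)) (+ 1) (+ b) ⟨
            up (a ℕ.+ b) * ϑ t (+ b) ∎
            where
            regroup : ∀ a b d e → a ℤ.+ a ℤ.+ (e ℤ.+ (b ℤ.+ b) ℤ.+ d) ≡ d ℤ.+ ((a ℤ.+ b) ℤ.+ (a ℤ.+ b)) ℤ.+ e
            regroup = solve-∀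

          -- The power of q cancels the dependence on b of the increment, so the factor is constant
          -- in the sum.
          descend : ∀ b s → q^ b * ϑ t (+ b ℤ.- + suc s) ≈ down s * ϑ t (+ b ℤ.- + s)
          descend b s = begin
            q^ b * ϑ t K
              ≈⟨ mono-q^* b (exponent-nonneg t K) K ⟩
            mono (+ b ℤ.+ + b ℤ.+ exponent t K) K
              ≈⟨ mono-cong exps (regroup′ (+ b) (+ s)) ⟩
            mono (+ (δ′ ℕ.+ (s ℕ.+ s)) ℤ.+ exponent t (+ b ℤ.- + s)) (ℤ.- + 1 ℤ.+ (+ b ℤ.- + s))
              ≈⟨ mono-* (ℤ.+≤+ z≤n) (exponent-nonneg t (+ b ℤ.- + s)) (ℤ.- + 1) (+ b ℤ.- + s) ⟨
            down s * ϑ t (+ b ℤ.- + s) ∎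
            where
            K : ℤ
            K = + b ℤ.- + suc s
            regroup′ : ∀ b s → b ℤ.- (+ 1 ℤ.+ s) ≡ ℤ.- + 1 ℤ.+ (b ℤ.- s)
            regroup′ = solve-∀
            next : ∀ b s → b ℤ.- s ≡ + 1 ℤ.+ (b ℤ.- (+ 1 ℤ.+ s))
            next = solve-∀
            -- The last summand vanishes by δ + δ′ = 2; writing it out makes the identity
            -- unconditional.
            regroup : ∀ b s d d′ e → b ℤ.+ b ℤ.+ e ≡ d′ ℤ.+ (s ℤ.+ s) ℤ.+ (e ℤ.+ ((b ℤ.- (+ 1 ℤ.+ s)) ℤ.+ (b ℤ.- (+ 1 ℤ.+ s))) ℤ.+ d) ℤ.+ (+ 2 ℤ.- (d ℤ.+ d′))
            regroup = solve-∀
            exps : + b ℤ.+ + b ℤ.+ exponent t K ≡ + (δ′ ℕ.+ (s ℕ.+ s)) ℤ.+ exponent t (+ b ℤ.- + s)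
            exps = ≡.trans (regroup (+ b) (+ s) (+ δ) (+ δ′) (exponent t K))
              (≡.trans (≡.cong₂ (λ e d → + (δ′ ℕ.+ (s ℕ.+ s)) ℤ.+ e ℤ.+ (+ 2 ℤ.- + d))
                  (≡.sym (≡.trans (≡.cong (exponent t) (next (+ b) (+ s))) (step K))) δ+δ′≡2)
                (ℤₚ.+-identityʳ _))

          -- The q-binomial theorem: one factor for each use of the q-Pascal rule.
          gauss : ∀ r → q-sum r (λ a b → ϑ t (+ b)) ≈ ∏ r (λ n → 1# + up n)
          gauss zero = q-sum-ϑ-0 t
          gauss (suc r) = begin
            q-sum (suc r) (λ a b → ϑ t (+ b))
              ≈⟨ q-sum-pascalˡ r (λ a b → ϑ t (+ b)) ⟩
            q-sum r (λ a b → ϑ t (+ b)) + q-sum r (λ a b → q^ a * ϑ t (+ suc b))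
              ≈⟨ +-congˡ (trans (q-sum-cong r λ a b e → trans (ascend a b) (*-congʳ (reflexive (≡.cong up e)))) (q-sum-*ˡ r (up r) _)) ⟩
            q-sum r (λ a b → ϑ t (+ b)) + up r * q-sum r (λ a b → ϑ t (+ b))
              ≈⟨ solve 2 (λ s u → s :+ u :* s := s :* (:1 :+ u)) refl _ (up r) ⟩
            q-sum r (λ a b → ϑ t (+ b)) * (1# + up r)
              ≈⟨ *-congʳ (gauss r) ⟩
            ∏ (suc r) (λ n → 1# + up n) ∎

          -- The finite triple product. Each factor with w⁻ moves the centre of the sum by one.
          finite : ∀ s r → q-sum (s ℕ.+ r) (λ a b → ϑ t (+ b ℤ.- + s)) ≈ ∏ r (λ n → 1# + up n) * ∏ s (λ n → 1# + down n)
          finite zero r = trans (q-sum-cong r λ a b _ → reflexive (≡.cong (ϑ t) (ℤₚ.+-identityʳ (+ b))))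
            (trans (gauss r) (sym (*-identityʳ _)))
          finite (suc s) r = begin
            q-sum (suc (s ℕ.+ r)) (λ a b → ϑ t (+ b ℤ.- + suc s))
              ≈⟨ q-sum-pascalʳ (s ℕ.+ r) (λ a b → ϑ t (+ b ℤ.- + suc s)) ⟩
            q-sum (s ℕ.+ r) (λ a b → q^ b * ϑ t (+ b ℤ.- + suc s)) + q-sum (s ℕ.+ r) (λ a b → ϑ t (+ suc b ℤ.- + suc s))
              ≈⟨ +-cong (trans (q-sum-cong (s ℕ.+ r) λ a b _ → descend b s) (q-sum-*ˡ (s ℕ.+ r) (down s) _))
                        (q-sum-cong (s ℕ.+ r) λ a b _ → reflexive (≡.cong (ϑ t) (shift (+ b) (+ s)))) ⟩
            down s * P + P
              ≈⟨ solve 2 (λ d P → d :* P :+ P := P :* (:1 :+ d)) refl (down s) P ⟩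
            P * (1# + down s)
              ≈⟨ *-congʳ (finite s r) ⟩
            (∏ r (λ n → 1# + up n) * ∏ s (λ n → 1# + down n)) * (1# + down s)
              ≈⟨ *-assoc _ _ _ ⟩
            ∏ r (λ n → 1# + up n) * ∏ (suc s) (λ n → 1# + down n) ∎
            where
            P : Carrier
            P = q-sum (s ℕ.+ r) (λ a b → ϑ t (+ b ℤ.- + s))
            shift : ∀ b s → (+ 1 ℤ.+ b) ℤ.- (+ 1 ℤ.+ s) ≡ b ℤ.- s
            shift = solve-∀

        jacobi : ∀ m → suc N ℕ.+ N ≤ m → ∏ m (λ n → 1# + up n) * ∏ m (λ n → 1# + down n) ≈ β * ∑± (suc N) (ϑ t)
        jacobi m big = begin
          ∏ m (λ n → 1# + up n) * ∏ m (λ n → 1# + down n) ≈⟨ finite m m ⟨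
          q-sum (m ℕ.+ m) (λ a b → ϑ t (+ b ℤ.- + m))     ≈⟨ q-sum-centre m (ϑ-supported t) big ⟩
          β * ∑± m (ϑ t)                                  ≈⟨ *-congˡ (∑±-stable (ϑ-supported t) (ℕₚ.≤-trans (ℕₚ.m≤m+n (suc N) N) big)) ⟩
          β * ∑± (suc N) (ϑ t) ∎

      jacobi-square : ∀ m → suc N ℕ.+ N ≤ m →
        ∏ m (λ n → 1# + mono (+ (1 ℕ.+ (n ℕ.+ n))) (+ 1)) * ∏ m (λ n → 1# + mono (+ (1 ℕ.+ (n ℕ.+ n))) (ℤ.- + 1))
          ≈ β * ∑± (suc N) (ϑ square)
      jacobi-square = jacobi square 1 1 ≡.refl step
        where
        step : ∀ i → (+ 1 ℤ.+ i) ℤ.* (+ 1 ℤ.+ i) ≡ i ℤ.* i ℤ.+ (i ℤ.+ i) ℤ.+ + 1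
        step = solve-∀

      jacobi-pronic : ∀ m → suc N ℕ.+ N ≤ m →
        ∏ m (λ n → 1# + mono (+ (n ℕ.+ n)) (+ 1)) * ∏ m (λ n → 1# + mono (+ (2 ℕ.+ (n ℕ.+ n))) (ℤ.- + 1))
          ≈ β * ∑± (suc N) (ϑ pronic)
      jacobi-pronic = jacobi pronic 0 2 ≡.refl step
        where
        step : ∀ i → (+ 1 ℤ.+ i) ℤ.* (+ 1 ℤ.+ i) ℤ.- (+ 1 ℤ.+ i) ≡ i ℤ.* i ℤ.- i ℤ.+ (i ℤ.+ i) ℤ.+ + 0
        step = solve-∀

-- Generating functions of distinct partitions and of restricted pairs.

module DistinctPartitions {c ℓ : Level} (R : CommutativeRing c ℓ) where
  open CommutativeRing R
  open Algebra.Properties.Semiring.Exp semiring using (_^_; ^-congʳ)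
  open IntegerSolver R
  open FiniteSums R
  open QSeries R
  open TripleProduct R
  open Relation.Binary.Reasoning.Setoid setoid

  module Weights (x y y⁻ : Carrier) (y*y⁻≈1 : y * y⁻ ≈ 1#) where

    -- Throughout, a Bool is a charge: false for 0 and true for 1.
    y[_] : Bool → Carrier
    y[ t ] = if t then y⁻ else y

    -- Modulo 2 residues alternate down a column exactly as along a row, so this is also the weight
    -- of a column of p nodes.
    row : Bool → ℕ → Carrier
    row t zero = 1#
    row t (suc p) = (x * y[ t ]) * row (not t) p

    -- ∑ (weight of μ) φ(ℓ(μ)) over the partitions μ into distinct parts ≤ B, with charge t.
    distinct : Bool → ℕ → (ℕ → Carrier) → Carrier
    distinct t zero φ = φ 0
    distinct t (suc B) φ = distinct t B φ + row t (suc B) * distinct (not t) B (λ L → φ (suc L))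

    distinct-cong : ∀ t B {φ ψ} → (∀ L → φ L ≈ ψ L) → distinct t B φ ≈ distinct t B ψ
    distinct-cong t zero e = e 0
    distinct-cong t (suc B) e = +-cong (distinct-cong t B e) (*-congˡ (distinct-cong (not t) B λ L → e (suc L)))

    distinct-+ : ∀ t B φ ψ → distinct t B (λ L → φ L + ψ L) ≈ distinct t B φ + distinct t B ψ
    distinct-+ t zero φ ψ = refl
    distinct-+ t (suc B) φ ψ = trans (+-cong (distinct-+ t B φ ψ) (*-congˡ (distinct-+ (not t) B _ _)))
      (solve 5 (λ a b r c d → (a :+ b) :+ r :* (c :+ d) := (a :+ r :* c) :+ (b :+ r :* d)) refl _ _ _ _ _)

    distinct-*ˡ : ∀ t B a φ → distinct t B (λ L → a * φ L) ≈ a * distinct t B φ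
    distinct-*ˡ t zero a φ = refl
    distinct-*ˡ t (suc B) a φ = trans (+-cong (distinct-*ˡ t B a φ) (*-congˡ (distinct-*ˡ (not t) B a _)))
      (solve 4 (λ a s r t → a :* s :+ r :* (a :* t) := a :* (s :+ r :* t)) refl _ _ _ _)

    -- Deleting the first column, of length L or L + 1 according to whether 1 is not or is a part.
    distinct-column : ∀ t B φ →
      distinct t (suc B) φ ≈ distinct (not t) B (λ L → row t L * φ L + row t (suc L) * φ (suc L))
    distinct-column t zero φ = +-congʳ (sym (*-identityˡ (φ 0)))
    distinct-column t (suc B) φ = begin
      distinct t (suc B) φ + row t (suc (suc B)) * distinct (not t) (suc B) (λ L → φ (suc L))
        ≈⟨ +-cong (distinct-column t B φ) (*-congˡ (distinct-column (not t) B (λ L → φ (suc L)))) ⟩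
      distinct (not t) B ψ + ((x * y[ t ]) * r) * distinct (not (not t)) B ψ′
        ≈⟨ +-congˡ (solve 3 (λ a r d → (a :* r) :* d := r :* (a :* d)) refl (x * y[ t ]) r _) ⟩
      distinct (not t) B ψ + r * ((x * y[ t ]) * distinct (not (not t)) B ψ′)
        ≈⟨ +-congˡ (*-congˡ (distinct-*ˡ (not (not t)) B (x * y[ t ]) ψ′)) ⟨
      distinct (not t) B ψ + r * distinct (not (not t)) B (λ L → (x * y[ t ]) * ψ′ L)
        ≈⟨ +-congˡ (*-congˡ (distinct-cong (not (not t)) B λ L →
             solve 5 (λ a r f s g → a :* (r :* f :+ s :* g) := (a :* r) :* f :+ (a :* s) :* g) refl
               (x * y[ t ]) (row (not t) L) (φ (suc L)) (row (not t) (suc L)) (φ (suc (suc L))))) ⟩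
      distinct (not t) B ψ + r * distinct (not (not t)) B (λ L → ψ (suc L)) ∎
      where
      r : Carrier
      r = row (not t) (suc B)
      ψ ψ′ : ℕ → Carrier
      ψ L = row t L * φ L + row t (suc L) * φ (suc L)
      ψ′ L = row (not t) L * φ (suc L) + row (not t) (suc L) * φ (suc (suc L))

    distinct≤ : Bool → ℕ → Carrier
    distinct≤ t M = distinct t M (λ _ → 1#)

    -- ∑ of weights over the pairs (λ , μ), with charges t and u, such that λ₁ ≤ ℓ(μ) + c and μ₁ ≤ B.
    pairs : Bool → Bool → ℕ → ℕ → Carrier
    pairs t u c B = distinct u B (λ L → distinct≤ t (c ℕ.+ L))

    -- If λ₁ exceeds ℓ(μ) + c by 1 or 2, delete the row λ₁ and add to μ a new first column, of length ℓ(μ) or ℓ(μ) + 1.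
    pairs-step : ∀ t u c B k → (∀ L → row t (suc (c ℕ.+ L)) ≈ k * row (not u) L) →
      pairs t u (suc (suc c)) B ≈ pairs t u c B + k * pairs (not t) (not u) c (suc B)
    pairs-step t u c B k hyp = begin
      distinct u B (λ L → (E t (c ℕ.+ L) + row t (suc (c ℕ.+ L)) * E (not t) (c ℕ.+ L)) + row t (suc (suc (c ℕ.+ L))) * E (not t) (suc (c ℕ.+ L)))
        ≈⟨ distinct-cong u B expand ⟩
      distinct u B (λ L → E t (c ℕ.+ L) + k * ψ L)
        ≈⟨ distinct-+ u B _ _ ⟩
      pairs t u c B + distinct u B (λ L → k * ψ L)
        ≈⟨ +-congˡ (distinct-*ˡ u B k ψ) ⟩
      pairs t u c B + k * distinct u B ψ
        ≈⟨ +-congˡ (*-congˡ (reflexive (≡.cong (λ v → distinct v B ψ) (Boolₚ.not-involutive u)))) ⟨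
      pairs t u c B + k * distinct (not (not u)) B ψ
        ≈⟨ +-congˡ (*-congˡ (distinct-column (not u) B (λ L → E (not t) (c ℕ.+ L)))) ⟨
      pairs t u c B + k * pairs (not t) (not u) c (suc B) ∎
      where
      E : Bool → ℕ → Carrier
      E = distinct≤
      ψ : ℕ → Carrier
      ψ L = row (not u) L * E (not t) (c ℕ.+ L) + row (not u) (suc L) * E (not t) (c ℕ.+ suc L)
      expand : ∀ L → (E t (c ℕ.+ L) + row t (suc (c ℕ.+ L)) * E (not t) (c ℕ.+ L)) + row t (suc (suc (c ℕ.+ L))) * E (not t) (suc (c ℕ.+ L))
        ≈ E t (c ℕ.+ L) + k * ψ L
      expand L = begin
        (E t (c ℕ.+ L) + row t (suc (c ℕ.+ L)) * E (not t) (c ℕ.+ L)) + row t (suc (suc (c ℕ.+ L))) * E (not t) (suc (c ℕ.+ L))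
          ≈⟨ +-cong (+-congˡ (*-congʳ (hyp L)))
               (trans (reflexive (≡.cong (λ n → row t (suc n) * E (not t) n) (≡.sym (ℕₚ.+-suc c L)))) (*-congʳ (hyp (suc L)))) ⟩
        (E t (c ℕ.+ L) + (k * row (not u) L) * E (not t) (c ℕ.+ L)) + (k * row (not u) (suc L)) * E (not t) (c ℕ.+ suc L)
          ≈⟨ solve 6 (λ e k r a s b → (e :+ (k :* r) :* a) :+ (k :* s) :* b := e :+ k :* (r :* a :+ s :* b)) refl _ _ _ _ _ _ ⟩
        E t (c ℕ.+ L) + k * ψ L ∎

    y[]-inverse : ∀ t → y[ t ] * y[ not t ] ≈ 1#
    y[]-inverse false = y*y⁻≈1
    y[]-inverse true = trans (*-comm y⁻ y) y*y⁻≈1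

    -- Adjacent nodes have opposite residues, so their powers of y cancel. The factor k of
    -- `pairs-step` is obtained from this.
    row-even : ∀ t i L → row t (i ℕ.* 2 ℕ.+ L) ≈ x ^ (i ℕ.* 2) * row t L
    row-even t zero L = sym (*-identityˡ _)
    row-even t (suc i) L = begin
      (x * y[ t ]) * ((x * y[ not t ]) * row (not (not t)) (i ℕ.* 2 ℕ.+ L))
        ≈⟨ *-congˡ (*-congˡ (trans (reflexive (≡.cong (λ v → row v (i ℕ.* 2 ℕ.+ L)) (Boolₚ.not-involutive t))) (row-even t i L))) ⟩
      (x * y[ t ]) * ((x * y[ not t ]) * (x ^ (i ℕ.* 2) * row t L))
        ≈⟨ solve 5 (λ x y z p r → (x :* y) :* ((x :* z) :* (p :* r)) := (y :* z) :* ((x :* (x :* p)) :* r)) refl x y[ t ] y[ not t ] (x ^ (i ℕ.* 2)) (row t L) ⟩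
      (y[ t ] * y[ not t ]) * ((x * (x * x ^ (i ℕ.* 2))) * row t L)
        ≈⟨ *-congʳ (y[]-inverse t) ⟩
      1# * ((x * (x * x ^ (i ℕ.* 2))) * row t L)
        ≈⟨ *-identityˡ _ ⟩
      x ^ (suc i ℕ.* 2) * row t L ∎

    row-divisible : ∀ t p → Σ Carrier λ r → row t p ≈ x ^ p * r
    row-divisible t zero = 1# , sym (*-identityˡ 1#)
    row-divisible t (suc p) = let (r , e) = row-divisible (not t) p in
      y[ t ] * r , trans (*-congˡ e) (solve 4 (λ x y p r → (x :* y) :* (p :* r) := (x :* p) :* (y :* r)) refl x y[ t ] (x ^ p) r)

    module Stable (N : ℕ) (x-nilpotent : x ^ suc N ≈ 0#) where
      open Truncated x N x-nilpotent
      open Monomials x N x-nilpotent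
      open Monomial y y⁻ y*y⁻≈1

      distinct-stable : ∀ t {B} φ → N ≤ B → distinct t B φ ≈ distinct t N φ
      distinct-stable t φ N≤B = go (ℕₚ.≤⇒≤′ N≤B)
        where
        go : ∀ {B} → N ℕ.≤′ B → distinct t B φ ≈ distinct t N φ
        go ℕ.≤′-refl = refl
        go (ℕ.≤′-step {B} p) = begin
          distinct t B φ + row t (suc B) * distinct (not t) B (λ L → φ (suc L))
            ≈⟨ +-cong (go p) (*-congʳ (trans (proj₂ (row-divisible t (suc B))) (trans (*-congʳ (x^-vanishes (suc B) (s≤s (ℕₚ.≤′⇒≤ p)))) (zeroˡ _)))) ⟩
          distinct t N φ + 0# * distinct (not t) B (λ L → φ (suc L))
            ≈⟨ solve 2 (λ a b → a :+ :0 :* b := a) refl _ _ ⟩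
          distinct t N φ ∎

      -- Bounding the parts of μ by N loses nothing modulo x^(N+1).
      G : Bool → Bool → ℕ → Carrier
      G t u c = pairs t u c N

      G-step : ∀ t u c k → (∀ L → row t (suc (c ℕ.+ L)) ≈ k * row (not u) L) →
        G t u (suc (suc c)) ≈ G t u c + k * G (not t) (not u) c
      G-step t u c k hyp = trans (pairs-step t u c N k hyp) (+-congˡ (*-congˡ (distinct-stable (not u) _ (ℕₚ.n≤1+n N))))

      E : Bool → Carrier
      E t = distinct≤ t N

      -- Parts larger than N have weight 0, so for c ≥ N the bound on λ₁ excludes nothing.
      G-unrestricted : ∀ t u c → N ≤ c → G t u c ≈ E t * E u
      G-unrestricted t u c N≤c = trans
        (distinct-cong u N λ L → trans (distinct-stable t _ (ℕₚ.≤-trans N≤c (ℕₚ.m≤m+n c L))) (sym (*-identityʳ _)))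
        (distinct-*ˡ u N (E t) (λ _ → 1#))

      private
        double : ∀ m → m ℕ.* 2 ≡ m ℕ.+ m
        double m = ≡.trans (ℕₚ.*-comm m 2) (≡.cong (m ℕ.+_) (ℕₚ.+-identityʳ m))

        row-2m+1 : ∀ t m → row t (suc (m ℕ.* 2)) ≈ mono (+ suc (m ℕ.+ m)) (if t then ℤ.- + 1 else + 1)
        row-2m+1 t m = begin
          (x * y[ t ]) * row (not t) (m ℕ.* 2)            ≈⟨ *-congˡ (row-2m (not t)) ⟩
          (x * y[ t ]) * x ^ (m ℕ.+ m)
            ≈⟨ solve 3 (λ x y p → (x :* y) :* p := (x :* p) :* (y :* :1)) refl x y[ t ] (x ^ (m ℕ.+ m)) ⟩
          x ^ suc (m ℕ.+ m) * (y[ t ] * 1#)               ≈⟨ *-congˡ (power t) ⟩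
          mono (+ suc (m ℕ.+ m)) (if t then ℤ.- + 1 else + 1) ∎
          where
          power : ∀ t → y[ t ] * 1# ≈ w^ (if t then ℤ.- + 1 else + 1)
          power true = refl
          power false = refl
          row-2m : ∀ t → row t (m ℕ.* 2) ≈ x ^ (m ℕ.+ m)
          row-2m t = begin
            row t (m ℕ.* 2)                      ≈⟨ reflexive (≡.cong (row t) (≡.sym (ℕₚ.+-identityʳ (m ℕ.* 2)))) ⟩
            row t (m ℕ.* 2 ℕ.+ 0)                ≈⟨ row-even t m 0 ⟩
            x ^ (m ℕ.* 2) * 1#                   ≈⟨ *-identityʳ _ ⟩
            x ^ (m ℕ.* 2)                        ≈⟨ ^-congʳ x (double m) ⟩
            x ^ (m ℕ.+ m) ∎

        row-2m+2 : ∀ t m → row t (suc (suc (m ℕ.* 2))) ≈ mono (+ (2 ℕ.+ (m ℕ.+ m))) (+ 0)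
        row-2m+2 t m = begin
          row t (suc m ℕ.* 2)                  ≈⟨ reflexive (≡.cong (row t) (≡.sym (ℕₚ.+-identityʳ (suc m ℕ.* 2)))) ⟩
          row t (suc m ℕ.* 2 ℕ.+ 0)            ≈⟨ row-even t (suc m) 0 ⟩
          x ^ (suc m ℕ.* 2) * 1#               ≈⟨ *-congʳ (^-congʳ x (≡.cong (2 ℕ.+_) (double m))) ⟩
          x ^ (2 ℕ.+ (m ℕ.+ m)) * 1# ∎

        transfer : ∀ t t′ n d i i′ j → + n ℤ.+ + n ℤ.+ exponent t i ≡ + d ℤ.+ exponent t′ i′ → i ≡ j ℤ.+ i′ →
          q^ n * ϑ t i ≈ mono (+ d) j * ϑ t′ i′
        transfer t t′ n d i i′ j e k = trans (mono-q^* n (exponent-nonneg t i) i)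
          (trans (mono-cong e k) (sym (mono-* (ℤ.+≤+ z≤n) (exponent-nonneg t′ i′) j i′)))

        -- Eliminating a turns the comparison of exponents into a polynomial identity in b and m.
        complement : ∀ a b M → a ℕ.+ b ≡ M → + a ≡ + M ℤ.- + b
        complement a b M ≡.refl = recover (+ a) (+ b)
          where
          recover : ∀ a b → a ≡ a ℤ.+ b ℤ.- b
          recover = solve-∀

        shift : ∀ b s → (+ 1 ℤ.+ b) ℤ.- (+ 1 ℤ.+ s) ≡ b ℤ.- s
        shift = solve-∀

        -- Splitting by whether the largest allowed part occurs couples the two charges and has the
        -- shape of a q-Pascal rule: `q-sum-pascalˡ` where the centre of the sum stays,
        -- `q-sum-pascalʳ` where it moves by one. For odd bounds the centres differ, since the new
        -- row of odd length contributes y for charge 0 and y⁻ for charge 1.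
        even : ∀ m → (distinct≤ false (m ℕ.* 2) ≈ q-sum (m ℕ.* 2) (λ a b → ϑ double⁻ (+ b ℤ.- + m)))
                   × (distinct≤ true (m ℕ.* 2) ≈ q-sum (m ℕ.* 2) (λ a b → ϑ double⁺ (+ b ℤ.- + m)))
        odd : ∀ m → (distinct≤ false (suc (m ℕ.* 2)) ≈ q-sum (suc (m ℕ.* 2)) (λ a b → ϑ double⁻ (+ b ℤ.- + m)))
                  × (distinct≤ true (suc (m ℕ.* 2)) ≈ q-sum (suc (m ℕ.* 2)) (λ a b → ϑ double⁺ (+ b ℤ.- + suc m)))

        even zero = sym (q-sum-ϑ-0 double⁻) , sym (q-sum-ϑ-0 double⁺)
        even (suc m) = sym E⁰ , sym E¹
          where
          M : ℕ
          M = suc (m ℕ.* 2)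
          E⁰ : q-sum (suc M) (λ a b → ϑ double⁻ (+ b ℤ.- + suc m)) ≈ distinct≤ false (suc M)
          E⁰ = begin
            q-sum (suc M) (λ a b → ϑ double⁻ (+ b ℤ.- + suc m))
              ≈⟨ q-sum-pascalʳ M (λ a b → ϑ double⁻ (+ b ℤ.- + suc m)) ⟩
            q-sum M (λ a b → q^ b * ϑ double⁻ (+ b ℤ.- + suc m)) + q-sum M (λ a b → ϑ double⁻ (+ suc b ℤ.- + suc m))
              ≈⟨ +-cong (trans (q-sum-cong M λ a b _ → transfer double⁻ double⁺ b (2 ℕ.+ (m ℕ.+ m)) (+ b ℤ.- + suc m) (+ b ℤ.- + suc m) (+ 0) (exps (+ b) (+ m)) (≡.sym (ℤₚ.+-identityˡ _)))
                          (q-sum-*ˡ M _ (λ a b → ϑ double⁺ (+ b ℤ.- + suc m))))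
                        (q-sum-cong M λ a b _ → reflexive (≡.cong (ϑ double⁻) (shift (+ b) (+ m)))) ⟩
            mono (+ (2 ℕ.+ (m ℕ.+ m))) (+ 0) * q-sum M (λ a b → ϑ double⁺ (+ b ℤ.- + suc m)) + q-sum M (λ a b → ϑ double⁻ (+ b ℤ.- + m))
              ≈⟨ +-comm _ _ ⟩
            q-sum M (λ a b → ϑ double⁻ (+ b ℤ.- + m)) + mono (+ (2 ℕ.+ (m ℕ.+ m))) (+ 0) * q-sum M (λ a b → ϑ double⁺ (+ b ℤ.- + suc m))
              ≈⟨ +-cong (proj₁ (odd m)) (*-cong (row-2m+2 false m) (proj₂ (odd m))) ⟨
            distinct≤ false (suc M) ∎
            where
            exps : ∀ b m → b ℤ.+ b ℤ.+ (+ 2 ℤ.* ((b ℤ.- (+ 1 ℤ.+ m)) ℤ.* (b ℤ.- (+ 1 ℤ.+ m))) ℤ.- (b ℤ.- (+ 1 ℤ.+ m)))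
              ≡ (+ 2 ℤ.+ (m ℤ.+ m)) ℤ.+ (+ 2 ℤ.* ((b ℤ.- (+ 1 ℤ.+ m)) ℤ.* (b ℤ.- (+ 1 ℤ.+ m))) ℤ.+ (b ℤ.- (+ 1 ℤ.+ m)))
            exps = solve-∀
          E¹ : q-sum (suc M) (λ a b → ϑ double⁺ (+ b ℤ.- + suc m)) ≈ distinct≤ true (suc M)
          E¹ = begin
            q-sum (suc M) (λ a b → ϑ double⁺ (+ b ℤ.- + suc m))
              ≈⟨ q-sum-pascalˡ M (λ a b → ϑ double⁺ (+ b ℤ.- + suc m)) ⟩
            q-sum M (λ a b → ϑ double⁺ (+ b ℤ.- + suc m)) + q-sum M (λ a b → q^ a * ϑ double⁺ (+ suc b ℤ.- + suc m))
              ≈⟨ +-congˡ (trans (q-sum-cong M λ a b e → transfer double⁺ double⁻ a (2 ℕ.+ (m ℕ.+ m)) (+ suc b ℤ.- + suc m) (+ b ℤ.- + m) (+ 0)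
                            (≡.trans (≡.cong (λ z → z ℤ.+ z ℤ.+ exponent double⁺ (+ suc b ℤ.- + suc m))
                              (complement a b _ (≡.trans e (≡.cong suc (double m))))) (exps (+ b) (+ m)))
                            (≡.trans (shift (+ b) (+ m)) (≡.sym (ℤₚ.+-identityˡ _))))
                          (q-sum-*ˡ M _ (λ a b → ϑ double⁻ (+ b ℤ.- + m)))) ⟩
            q-sum M (λ a b → ϑ double⁺ (+ b ℤ.- + suc m)) + mono (+ (2 ℕ.+ (m ℕ.+ m))) (+ 0) * q-sum M (λ a b → ϑ double⁻ (+ b ℤ.- + m))
              ≈⟨ +-cong (proj₂ (odd m)) (*-cong (row-2m+2 true m) (proj₁ (odd m))) ⟨
            distinct≤ true (suc M) ∎
            where
            exps : ∀ b m → (+ 1 ℤ.+ (m ℤ.+ m) ℤ.- b) ℤ.+ (+ 1 ℤ.+ (m ℤ.+ m) ℤ.- b)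
              ℤ.+ (+ 2 ℤ.* (((+ 1 ℤ.+ b) ℤ.- (+ 1 ℤ.+ m)) ℤ.* ((+ 1 ℤ.+ b) ℤ.- (+ 1 ℤ.+ m))) ℤ.+ ((+ 1 ℤ.+ b) ℤ.- (+ 1 ℤ.+ m)))
              ≡ (+ 2 ℤ.+ (m ℤ.+ m)) ℤ.+ (+ 2 ℤ.* ((b ℤ.- m) ℤ.* (b ℤ.- m)) ℤ.- (b ℤ.- m))
            exps = solve-∀
        odd m = sym E⁰ , sym E¹
          where
          M : ℕ
          M = m ℕ.* 2
          E⁰ : q-sum (suc M) (λ a b → ϑ double⁻ (+ b ℤ.- + m)) ≈ distinct≤ false (suc M)
          E⁰ = begin
            q-sum (suc M) (λ a b → ϑ double⁻ (+ b ℤ.- + m))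
              ≈⟨ q-sum-pascalˡ M (λ a b → ϑ double⁻ (+ b ℤ.- + m)) ⟩
            q-sum M (λ a b → ϑ double⁻ (+ b ℤ.- + m)) + q-sum M (λ a b → q^ a * ϑ double⁻ (+ suc b ℤ.- + m))
              ≈⟨ +-congˡ (trans (q-sum-cong M λ a b e → transfer double⁻ double⁺ a (suc (m ℕ.+ m)) (+ suc b ℤ.- + m) (+ b ℤ.- + m) (+ 1)
                            (≡.trans (≡.cong (λ z → z ℤ.+ z ℤ.+ exponent double⁻ (+ suc b ℤ.- + m))
                              (complement a b _ (≡.trans e (double m)))) (exps (+ b) (+ m)))
                            (ℤₚ.+-assoc (+ 1) (+ b) (ℤ.- + m)))
                          (q-sum-*ˡ M _ (λ a b → ϑ double⁺ (+ b ℤ.- + m)))) ⟩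
            q-sum M (λ a b → ϑ double⁻ (+ b ℤ.- + m)) + mono (+ suc (m ℕ.+ m)) (+ 1) * q-sum M (λ a b → ϑ double⁺ (+ b ℤ.- + m))
              ≈⟨ +-cong (proj₁ (even m)) (*-cong (row-2m+1 false m) (proj₂ (even m))) ⟨
            distinct≤ false (suc M) ∎
            where
            exps : ∀ b m → ((m ℤ.+ m) ℤ.- b) ℤ.+ ((m ℤ.+ m) ℤ.- b)
              ℤ.+ (+ 2 ℤ.* (((+ 1 ℤ.+ b) ℤ.- m) ℤ.* ((+ 1 ℤ.+ b) ℤ.- m)) ℤ.- ((+ 1 ℤ.+ b) ℤ.- m))
              ≡ (+ 1 ℤ.+ (m ℤ.+ m)) ℤ.+ (+ 2 ℤ.* ((b ℤ.- m) ℤ.* (b ℤ.- m)) ℤ.+ (b ℤ.- m))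
            exps = solve-∀
          E¹ : q-sum (suc M) (λ a b → ϑ double⁺ (+ b ℤ.- + suc m)) ≈ distinct≤ true (suc M)
          E¹ = begin
            q-sum (suc M) (λ a b → ϑ double⁺ (+ b ℤ.- + suc m))
              ≈⟨ q-sum-pascalʳ M (λ a b → ϑ double⁺ (+ b ℤ.- + suc m)) ⟩
            q-sum M (λ a b → q^ b * ϑ double⁺ (+ b ℤ.- + suc m)) + q-sum M (λ a b → ϑ double⁺ (+ suc b ℤ.- + suc m))
              ≈⟨ +-cong (trans (q-sum-cong M λ a b _ → transfer double⁺ double⁻ b (suc (m ℕ.+ m)) (+ b ℤ.- + suc m) (+ b ℤ.- + m) (ℤ.- + 1) (exps (+ b) (+ m)) (back (+ b) (+ m)))
                          (q-sum-*ˡ M _ (λ a b → ϑ double⁻ (+ b ℤ.- + m))))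
                        (q-sum-cong M λ a b _ → reflexive (≡.cong (ϑ double⁺) (shift (+ b) (+ m)))) ⟩
            mono (+ suc (m ℕ.+ m)) (ℤ.- + 1) * q-sum M (λ a b → ϑ double⁻ (+ b ℤ.- + m)) + q-sum M (λ a b → ϑ double⁺ (+ b ℤ.- + m))
              ≈⟨ +-comm _ _ ⟩
            q-sum M (λ a b → ϑ double⁺ (+ b ℤ.- + m)) + mono (+ suc (m ℕ.+ m)) (ℤ.- + 1) * q-sum M (λ a b → ϑ double⁻ (+ b ℤ.- + m))
              ≈⟨ +-cong (proj₂ (even m)) (*-cong (row-2m+1 true m) (proj₁ (even m))) ⟨
            distinct≤ true (suc M) ∎
            where
            back : ∀ b m → b ℤ.- (+ 1 ℤ.+ m) ≡ ℤ.- + 1 ℤ.+ (b ℤ.- m)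
            back = solve-∀
            exps : ∀ b m → b ℤ.+ b ℤ.+ (+ 2 ℤ.* ((b ℤ.- (+ 1 ℤ.+ m)) ℤ.* (b ℤ.- (+ 1 ℤ.+ m))) ℤ.+ (b ℤ.- (+ 1 ℤ.+ m)))
              ≡ (+ 1 ℤ.+ (m ℤ.+ m)) ℤ.+ (+ 2 ℤ.* ((b ℤ.- m) ℤ.* (b ℤ.- m)) ℤ.- (b ℤ.- m))
            exps = solve-∀

        centre : ∀ t u → (∀ m → distinct≤ u (m ℕ.* 2) ≈ q-sum (m ℕ.* 2) (λ a b → ϑ t (+ b ℤ.- + m))) → E u ≈ β * ∑± (suc N) (ϑ t)
        centre t u e = begin
          distinct≤ u N                                 ≈⟨ distinct-stable u _ (ℕₚ.≤-trans (ℕₚ.m≤n+m N (suc N)) (ℕₚ.m≤m*n m 2)) ⟨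
          distinct≤ u (m ℕ.* 2)                         ≈⟨ e m ⟩
          q-sum (m ℕ.* 2) (λ a b → ϑ t (+ b ℤ.- + m))   ≈⟨ reflexive (≡.cong (λ M → q-sum M (λ a b → ϑ t (+ b ℤ.- + m))) (double m)) ⟩
          q-sum (m ℕ.+ m) (λ a b → ϑ t (+ b ℤ.- + m))   ≈⟨ q-sum-centre m (ϑ-supported t) ℕₚ.≤-refl ⟩
          β * ∑± m (ϑ t)                                ≈⟨ *-congˡ (∑±-stable (ϑ-supported t) (ℕₚ.m≤m+n (suc N) N)) ⟩
          β * ∑± (suc N) (ϑ t)                          ∎
          where
          m : ℕ
          m = suc N ℕ.+ N

      E-theta⁻ : E false ≈ β * ∑± (suc N) (ϑ double⁻)
      E-theta⁻ = centre double⁻ false (λ m → proj₁ (even m))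

      E-theta⁺ : E true ≈ β * ∑± (suc N) (ϑ double⁺)
      E-theta⁺ = centre double⁺ true (λ m → proj₂ (even m))

-- The two product identities over a ring with x nilpotent and y invertible.

module Identities {c ℓ : Level} (R : CommutativeRing c ℓ) where
  open CommutativeRing R
  open Algebra.Properties.Semiring.Exp semiring using (_^_; ^-congʳ)
  open Algebra.Properties.CommutativeSemiring.Exp commutativeSemiring using (^-distrib-*)
  open Units R
  open IntegerSolver R
  open FiniteSums R
  open QSeries R
  open TripleProduct R
  open DistinctPartitions R
  open Relation.Binary.Reasoning.Setoid setoid

  -- If the summand separates on each coset of the rotated lattice, a product of two theta series
  -- becomes a sum of two such products; κ is the constant picked up on the odd coset.
  ∑±-rotate-split : ∀ r {f g F G F′ G′} κ →
    Supported r f → Supported r g → Supported r F → Supported r G → Supported r F′ → Supported r G′ →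
    (∀ j k → f (j ℤ.+ k) * g (j ℤ.- k) ≈ F j * G k) →
    (∀ j k → f (j ℤ.+ k) * g (ℤ.suc (j ℤ.- k)) ≈ κ * (F′ j * G′ k)) →
    ∑± r f * ∑± r g ≈ ∑± r F * ∑± r G + κ * (∑± r F′ * ∑± r G′)
  ∑±-rotate-split r {f} {g} {F} {G} {F′} {G′} κ fs gs Fs Gs F′s G′s even odd = begin
    ∑± r f * ∑± r g
      ≈⟨ ∑±-rotate r fs gs ⟨
    ∑± r₂ (λ j → ∑± r₃ (λ k → f (j ℤ.+ k) * g (j ℤ.- k))) + ∑± r₂ (λ j → ∑± r₃ (λ k → f (j ℤ.+ k) * g (ℤ.suc (j ℤ.- k))))
      ≈⟨ +-cong (∑±-cong r₂ λ j _ → ∑±-cong r₃ λ k _ → even j k)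
                (∑±-cong r₂ λ j _ → trans (∑±-cong r₃ λ k _ → odd j k) (∑±-*ˡ r₃ κ (λ k → F′ j * G′ k))) ⟩
    ∑± r₂ (λ j → ∑± r₃ (λ k → F j * G k)) + ∑± r₂ (λ j → κ * ∑± r₃ (λ k → F′ j * G′ k))
      ≈⟨ +-cong (∑±-* r₂ r₃ F G) (trans (∑±-*ˡ r₂ κ _) (*-congˡ (∑±-* r₂ r₃ F′ G′))) ⟩
    ∑± r₂ F * ∑± r₃ G + κ * (∑± r₂ F′ * ∑± r₃ G′)
      ≈⟨ +-cong (*-cong (∑±-stable Fs r≤r₂) (∑±-stable Gs r≤r₃)) (*-congˡ (*-cong (∑±-stable F′s r≤r₂) (∑±-stable G′s r≤r₃))) ⟩
    ∑± r F * ∑± r G + κ * (∑± r F′ * ∑± r G′) ∎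
    where
    r₂ r₃ : ℕ
    r₂ = r ℕ.+ r
    r₃ = r ℕ.+ r₂
    r≤r₂ : r ≤ r₂
    r≤r₂ = ℕₚ.m≤m+n r r
    r≤r₃ : r ≤ r₃
    r≤r₃ = ℕₚ.m≤m+n r r₂

  module Products (x y y⁻ : Carrier) (y*y⁻≈1 : y * y⁻ ≈ 1#) (N : ℕ) (x-nilpotent : x ^ suc N ≈ 0#) where
    open Truncated x N x-nilpotent
    open Monomials x N x-nilpotent
    open Weights x y y⁻ y*y⁻≈1
    open Stable N x-nilpotent
    module Y = Monomial y y⁻ y*y⁻≈1

    ∏1+ : (ℕ → ℕ) → Carrier → Carrier
    ∏1+ e a = ∏ N (λ n → 1# + a * x ^ e n)

    -- With the factor 2 on the right, passing from n to n + 1 adds two successors by computation,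
    -- as `G-step` requires.
    evens odds : ℕ → ℕ
    evens n = suc n ℕ.* 2
    odds n = suc (n ℕ.* 2)

    private
      n≤n*2 : ∀ n → n ≤ n ℕ.* 2
      n≤n*2 n = ℕₚ.m≤m*n n 2

      m : ℕ
      m = suc N ℕ.+ N

      N≤m : N ≤ m
      N≤m = ℕₚ.m≤n+m N (suc N)

      ∏-truncate : ∀ {k} e a → N ≤ k → (∀ n → N ≤ n → N < e n) → ∏ k (λ n → 1# + a * x ^ e n) ≈ ∏1+ e a
      ∏-truncate e a N≤k big = ∏-stable N≤k λ n N≤n →
        trans (+-congˡ (trans (*-congˡ (x^-vanishes (e n) (big n N≤n))) (zeroʳ a))) (+-identityʳ 1#)

      odds-big : ∀ n → N ≤ n → N < odds n
      odds-big n N≤n = s≤s (ℕₚ.≤-trans N≤n (n≤n*2 n))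

      evens-big : ∀ n → N ≤ n → N < evens n
      evens-big n N≤n = ℕₚ.<⇒≤ (s≤s (odds-big n N≤n))

      factor : ∀ c n a → x ^ (c ℕ.+ (n ℕ.+ n)) * (a * 1#) ≈ a * x ^ (c ℕ.+ n ℕ.* 2)
      factor c n a = trans (*-cong (^-congʳ x (≡.cong (c ℕ.+_) (≡.sym (≡.trans (ℕₚ.*-comm n 2) (≡.cong (n ℕ.+_) (ℕₚ.+-identityʳ n)))))) (*-identityʳ a)) (*-comm _ a)

      collect : ∀ {d e d′ e′ a b a′ b′ κ} → + 0 ℤ.≤ d → + 0 ℤ.≤ e → + 0 ℤ.≤ d′ → + 0 ℤ.≤ e′ → d ℤ.+ e ≡ d′ ℤ.+ e′ →
        a * b ≈ κ * (a′ * b′) → (x^ℤ d * a) * (x^ℤ e * b) ≈ κ * ((x^ℤ d′ * a′) * (x^ℤ e′ * b′))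
      collect {d} {e} {d′} {e′} {a} {b} {a′} {b′} {κ} d≥0 e≥0 d′≥0 e′≥0 de ab = begin
        (x^ℤ d * a) * (x^ℤ e * b)
          ≈⟨ solve 4 (λ d a e b → (d :* a) :* (e :* b) := (d :* e) :* (a :* b)) refl (x^ℤ d) a (x^ℤ e) b ⟩
        (x^ℤ d * x^ℤ e) * (a * b)
          ≈⟨ *-cong (trans (sym (x^ℤ-+ d≥0 e≥0)) (trans (reflexive (≡.cong x^ℤ_ de)) (x^ℤ-+ d′≥0 e′≥0))) ab ⟩
        (x^ℤ d′ * x^ℤ e′) * (κ * (a′ * b′))
          ≈⟨ solve 5 (λ d e k a b → (d :* e) :* (k :* (a :* b)) := k :* ((d :* a) :* (e :* b))) refl (x^ℤ d′) (x^ℤ e′) κ a′ b′ ⟩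
        κ * ((x^ℤ d′ * a′) * (x^ℤ e′ * b′)) ∎

      even-exponent : ∀ j k → (j ℤ.+ k) ℤ.* (j ℤ.+ k) ℤ.+ ((j ℤ.- k) ℤ.* (j ℤ.- k) ℤ.- (j ℤ.- k))
        ≡ (+ 2 ℤ.* (j ℤ.* j) ℤ.- j) ℤ.+ (+ 2 ℤ.* (k ℤ.* k) ℤ.+ k)
      even-exponent = solve-∀

      odd-exponent : ∀ j k → (j ℤ.+ k) ℤ.* (j ℤ.+ k) ℤ.+ ((+ 1 ℤ.+ (j ℤ.- k)) ℤ.* (+ 1 ℤ.+ (j ℤ.- k)) ℤ.- (+ 1 ℤ.+ (j ℤ.- k)))
        ≡ (+ 2 ℤ.* (j ℤ.* j) ℤ.+ j) ℤ.+ (+ 2 ℤ.* (k ℤ.* k) ℤ.- k)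
      odd-exponent = solve-∀

      reflect⁻ : ∀ k → exponent double⁺ k ≡ exponent double⁻ (ℤ.- k)
      reflect⁻ = identity
        where
        identity : ∀ k → + 2 ℤ.* (k ℤ.* k) ℤ.+ k ≡ + 2 ℤ.* ((ℤ.- k) ℤ.* (ℤ.- k)) ℤ.- (ℤ.- k)
        identity = solve-∀

      reflect⁺ : ∀ k → exponent double⁻ k ≡ exponent double⁺ (ℤ.- k)
      reflect⁺ = identity
        where
        identity : ∀ k → + 2 ℤ.* (k ℤ.* k) ℤ.- k ≡ + 2 ℤ.* ((ℤ.- k) ℤ.* (ℤ.- k)) ℤ.+ (ℤ.- k)
        identity = solve-∀

      module One = Monomial 1# 1# (*-identityˡ 1#)

      1^≈1 : ∀ n → 1# ^ n ≈ 1#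
      1^≈1 zero = refl
      1^≈1 (suc n) = trans (*-identityˡ _) (1^≈1 n)

      1^ℤ≈1 : ∀ i → One.w^ i ≈ 1#
      1^ℤ≈1 (+ n) = 1^≈1 n
      1^ℤ≈1 -[1+ n ] = 1^≈1 (suc n)

      two : Carrier
      two = 1# + 1#

    -- The square theta series is taken at w = y and the pronic one at w = 1. Both cosets then give
    -- the same product, which accounts for `two` on the left.
    unrestricted₁ : two * (E false * E true) ≈ (∏1+ odds y * ∏1+ odds y⁻) * (two * (∏1+ evens 1# * ∏1+ evens 1#))
    unrestricted₁ = sym (begin
      (∏1+ odds y * ∏1+ odds y⁻) * (two * (∏1+ evens 1# * ∏1+ evens 1#))
        ≈⟨ *-cong odd-product even-product ⟩
      (β * ∑± r (Y.ϑ square)) * (β * ∑± r (One.ϑ pronic))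
        ≈⟨ solve 3 (λ b f g → (b :* f) :* (b :* g) := (b :* b) :* (f :* g)) refl β _ _ ⟩
      (β * β) * (∑± r (Y.ϑ square) * ∑± r (One.ϑ pronic))
        ≈⟨ *-congˡ (∑±-rotate-split r 1# (Y.ϑ-supported square) (One.ϑ-supported pronic) (Y.ϑ-supported double⁻) (Y.ϑ-supported double⁺)
             (Y.ϑ-supported double⁺) (Y.ϑ-supported double⁻)
             (λ j k → trans (collect (exponent-nonneg square (j ℤ.+ k)) (exponent-nonneg pronic (j ℤ.- k)) (exponent-nonneg double⁻ j) (exponent-nonneg double⁺ k)
                (even-exponent j k) (powers j k (j ℤ.- k))) (*-identityˡ _))
             (λ j k → collect (exponent-nonneg square (j ℤ.+ k)) (exponent-nonneg pronic (ℤ.suc (j ℤ.- k))) (exponent-nonneg double⁺ j) (exponent-nonneg double⁻ k)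
                (odd-exponent j k) (powers j k (ℤ.suc (j ℤ.- k))))) ⟩
      (β * β) * (θ⁻ * θ⁺ + 1# * (θ⁺ * θ⁻))
        ≈⟨ solve 3 (λ b f g → (b :* b) :* (f :* g :+ :1 :* (g :* f)) := (:1 :+ :1) :* ((b :* f) :* (b :* g))) refl β θ⁻ θ⁺ ⟩
      two * ((β * θ⁻) * (β * θ⁺))
        ≈⟨ *-congˡ (*-cong E-theta⁻ E-theta⁺) ⟨
      two * (E false * E true) ∎)
      where
      r : ℕ
      r = suc N
      θ⁻ θ⁺ : Carrier
      θ⁻ = ∑± r (Y.ϑ double⁻)
      θ⁺ = ∑± r (Y.ϑ double⁺)
      powers : ∀ j k i → Y.w^ (j ℤ.+ k) * One.w^ i ≈ 1# * (Y.w^ j * Y.w^ k)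
      powers j k i = begin
        Y.w^ (j ℤ.+ k) * One.w^ i        ≈⟨ *-cong (Y.w^-+ j k) (1^ℤ≈1 i) ⟩
        (Y.w^ j * Y.w^ k) * 1#           ≈⟨ *-comm _ 1# ⟩
        1# * (Y.w^ j * Y.w^ k)           ∎
      odd-product : ∏1+ odds y * ∏1+ odds y⁻ ≈ β * ∑± r (Y.ϑ square)
      odd-product = trans (*-cong (widen y) (widen y⁻)) (Y.jacobi-square m ℕₚ.≤-refl)
        where
        widen : ∀ a → ∏1+ odds a ≈ ∏ m (λ n → 1# + x ^ (1 ℕ.+ (n ℕ.+ n)) * (a * 1#))
        widen a = trans (sym (∏-truncate odds a N≤m odds-big)) (∏-cong m λ n → +-congˡ (sym (factor 1 n a)))
      even-product : two * (∏1+ evens 1# * ∏1+ evens 1#) ≈ β * ∑± r (One.ϑ pronic)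
      even-product = begin
        two * (∏1+ evens 1# * ∏1+ evens 1#)
          ≈⟨ *-assoc _ _ _ ⟨
        (two * ∏1+ evens 1#) * ∏1+ evens 1#
          -- `m` is `suc (N + N)`: the factor of index 0 in the pronic product is 1 + 1, and N + N
          -- factors remain.
          ≈⟨ *-cong (*-congˡ (∏-truncate evens 1# (ℕₚ.m≤n+m N N) evens-big)) (∏-truncate evens 1# N≤m evens-big) ⟨
        (two * ∏ (N ℕ.+ N) (λ n → 1# + 1# * x ^ evens n)) * ∏ m (λ n → 1# + 1# * x ^ evens n)
          ≈⟨ *-congʳ (*-congʳ (+-congˡ (sym (*-identityˡ 1#)))) ⟩
        ((1# + 1# * x ^ 0) * ∏ (N ℕ.+ N) (λ n → 1# + 1# * x ^ (suc n ℕ.* 2))) * ∏ m (λ n → 1# + 1# * x ^ evens n)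
          ≈⟨ *-congʳ (∏-head (N ℕ.+ N) (λ n → 1# + 1# * x ^ (n ℕ.* 2))) ⟨
        ∏ m (λ n → 1# + 1# * x ^ (n ℕ.* 2)) * ∏ m (λ n → 1# + 1# * x ^ evens n)
          ≈⟨ *-cong (∏-cong m λ n → +-congˡ (factor 0 n 1#)) (∏-cong m λ n → +-congˡ (factor 2 n 1#)) ⟨
        ∏ m (λ n → 1# + One.mono (+ (n ℕ.+ n)) (+ 1)) * ∏ m (λ n → 1# + One.mono (+ (2 ℕ.+ (n ℕ.+ n))) (ℤ.- + 1))
          ≈⟨ One.jacobi-pronic m ℕₚ.≤-refl ⟩
        β * ∑± r (One.ϑ pronic) ∎

    -- s stands for `1#` and `- 1#`. Being its own inverse, it can itself be the variable w of a
    -- theta series.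
    module _ (s : Carrier) (s*s≈1 : s * s ≈ 1#) where
      private
        sy*sy⁻≈1 : (s * y) * (s * y⁻) ≈ 1#
        sy*sy⁻≈1 = trans (solve 3 (λ s y z → (s :* y) :* (s :* z) := (s :* s) :* (y :* z)) refl s y y⁻)
          (trans (*-cong s*s≈1 y*y⁻≈1) (*-identityˡ 1#))

        module S = Monomial s s s*s≈1
        module SY = Monomial (s * y) (s * y⁻) sy*sy⁻≈1

        SY-split : ∀ i → SY.w^ i ≈ S.w^ i * Y.w^ i
        SY-split (+ n) = ^-distrib-* s y n
        SY-split -[1+ n ] = ^-distrib-* s y⁻ (suc n)

        S-neg : ∀ i → S.w^ (ℤ.- i) ≈ S.w^ i
        S-neg (+ zero) = refl
        S-neg (+ suc n) = refl
        S-neg -[1+ n ] = refl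

        S-square : ∀ i → S.w^ i * S.w^ i ≈ 1#
        S-square i = begin
          S.w^ i * S.w^ i         ≈⟨ *-congˡ (S-neg i) ⟨
          S.w^ i * S.w^ (ℤ.- i)   ≈⟨ S.w^-+ i (ℤ.- i) ⟨
          S.w^ (i ℤ.- i)          ≈⟨ reflexive (≡.cong S.w^_ (ℤₚ.+-inverseʳ i)) ⟩
          1#                      ∎

        -- The total power of s is 2j, hence trivial.
        even-powers : ∀ j k → S.w^ (j ℤ.+ k) * SY.w^ (j ℤ.- k) ≈ 1# * (Y.w^ j * Y.w^ (ℤ.- k))
        even-powers j k = begin
          S.w^ (j ℤ.+ k) * SY.w^ (j ℤ.- k)
            ≈⟨ *-cong (S.w^-+ j k) (trans (SY-split (j ℤ.- k)) (*-cong (trans (S.w^-+ j (ℤ.- k)) (*-congˡ (S-neg k))) (Y.w^-+ j (ℤ.- k)))) ⟩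
          (S.w^ j * S.w^ k) * ((S.w^ j * S.w^ k) * (Y.w^ j * Y.w^ (ℤ.- k)))
            ≈⟨ solve 3 (λ a b c → (a :* b) :* ((a :* b) :* c) := ((a :* a) :* (b :* b)) :* c) refl _ _ _ ⟩
          ((S.w^ j * S.w^ j) * (S.w^ k * S.w^ k)) * (Y.w^ j * Y.w^ (ℤ.- k))
            ≈⟨ *-congʳ (trans (*-cong (S-square j) (S-square k)) (*-identityˡ 1#)) ⟩
          1# * (Y.w^ j * Y.w^ (ℤ.- k)) ∎

        odd-powers : ∀ j k → S.w^ (j ℤ.+ k) * SY.w^ (ℤ.suc (j ℤ.- k)) ≈ (s * y) * (Y.w^ j * Y.w^ (ℤ.- k))
        odd-powers j k = begin
          S.w^ (j ℤ.+ k) * SY.w^ (ℤ.suc (j ℤ.- k))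
            ≈⟨ *-congˡ (SY.w^-suc (j ℤ.- k)) ⟩
          S.w^ (j ℤ.+ k) * ((s * y) * SY.w^ (j ℤ.- k))
            ≈⟨ solve 3 (λ a b c → a :* (b :* c) := b :* (a :* c)) refl _ _ _ ⟩
          (s * y) * (S.w^ (j ℤ.+ k) * SY.w^ (j ℤ.- k))
            ≈⟨ *-congˡ (trans (even-powers j k) (*-identityˡ _)) ⟩
          (s * y) * (Y.w^ j * Y.w^ (ℤ.- k)) ∎

      -- Now w = s in the square series and w = s y in the pronic one. The surviving power y^(j-k)
      -- forces the reflection of k, which interchanges `double⁻` and `double⁺`; so each coset gives
      -- a square instead of a mixed product.
      unrestricted₂ : 1 ≤ N → E false * E false + s * (y * (E true * E true))
        ≈ (∏1+ odds s * ∏1+ odds s) * (∏1+ (λ n → n ℕ.* 2) (s * y) * ∏1+ evens (s * y⁻))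
      unrestricted₂ 1≤N = sym (begin
        (∏1+ odds s * ∏1+ odds s) * (∏1+ (λ n → n ℕ.* 2) (s * y) * ∏1+ evens (s * y⁻))
          ≈⟨ *-cong odd-product even-product ⟩
        (β * ∑± r (S.ϑ square)) * (β * ∑± r (SY.ϑ pronic))
          ≈⟨ solve 3 (λ b f g → (b :* f) :* (b :* g) := (b :* b) :* (f :* g)) refl β _ _ ⟩
        (β * β) * (∑± r (S.ϑ square) * ∑± r (SY.ϑ pronic))
          ≈⟨ *-congˡ (∑±-rotate-split r (s * y) (S.ϑ-supported square) (SY.ϑ-supported pronic)
               (Y.ϑ-supported double⁻) (reflected double⁻) (Y.ϑ-supported double⁺) (reflected double⁺)
               (λ j k → trans (collect (exponent-nonneg square (j ℤ.+ k)) (exponent-nonneg pronic (j ℤ.- k)) (exponent-nonneg double⁻ j) (exponent-nonneg double⁻ (ℤ.- k))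
                  (≡.trans (even-exponent j k) (≡.cong (λ e → exponent double⁻ j ℤ.+ e) (reflect⁻ k))) (even-powers j k)) (*-identityˡ _))
               (λ j k → collect (exponent-nonneg square (j ℤ.+ k)) (exponent-nonneg pronic (ℤ.suc (j ℤ.- k))) (exponent-nonneg double⁺ j) (exponent-nonneg double⁺ (ℤ.- k))
                  (≡.trans (odd-exponent j k) (≡.cong (λ e → exponent double⁺ j ℤ.+ e) (reflect⁺ k))) (odd-powers j k))) ⟩
        (β * β) * (θ⁻ * ∑± r (λ k → Y.ϑ double⁻ (ℤ.- k)) + (s * y) * (θ⁺ * ∑± r (λ k → Y.ϑ double⁺ (ℤ.- k))))
          ≈⟨ *-congˡ (+-cong (*-congˡ (∑±-neg r (Y.ϑ double⁻))) (*-congˡ (*-congˡ (∑±-neg r (Y.ϑ double⁺))))) ⟩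
        (β * β) * (θ⁻ * θ⁻ + (s * y) * (θ⁺ * θ⁺))
          ≈⟨ solve 5 (λ b f g s y → (b :* b) :* (f :* f :+ (s :* y) :* (g :* g)) := (b :* f) :* (b :* f) :+ s :* (y :* ((b :* g) :* (b :* g)))) refl β θ⁻ θ⁺ s y ⟩
        (β * θ⁻) * (β * θ⁻) + s * (y * ((β * θ⁺) * (β * θ⁺)))
          ≈⟨ +-cong (*-cong E-theta⁻ E-theta⁻) (*-congˡ (*-congˡ (*-cong E-theta⁺ E-theta⁺))) ⟨
        E false * E false + s * (y * (E true * E true)) ∎)
        where
        r : ℕ
        r = suc N
        θ⁻ θ⁺ : Carrier
        θ⁻ = ∑± r (Y.ϑ double⁻)
        θ⁺ = ∑± r (Y.ϑ double⁺)
        reflected : ∀ t → Supported r (λ k → Y.ϑ t (ℤ.- k))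
        reflected t k r<k = Y.ϑ-supported t (ℤ.- k) (≡.subst (r <_) (≡.sym (ℤₚ.∣-i∣≡∣i∣ k)) r<k)
        -- This fails for N = n = 0: the factor 1 + s y of index 0 is not 1, and the empty product
        -- lacks it.
        doubles-big : ∀ n → N ≤ n → N < n ℕ.* 2
        doubles-big (suc n) N≤n = s≤s (ℕₚ.≤-trans N≤n (s≤s (n≤n*2 n)))
        doubles-big zero N≤0 with () ← ℕₚ.≤-trans 1≤N N≤0
        widen : ∀ c a → (∀ n → N ≤ n → N < c ℕ.+ n ℕ.* 2) → ∏1+ (λ n → c ℕ.+ n ℕ.* 2) a ≈ ∏ m (λ n → 1# + x ^ (c ℕ.+ (n ℕ.+ n)) * (a * 1#))
        widen c a big = trans (sym (∏-truncate (λ n → c ℕ.+ n ℕ.* 2) a N≤m big)) (∏-cong m λ n → +-congˡ (sym (factor c n a)))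
        odd-product : ∏1+ odds s * ∏1+ odds s ≈ β * ∑± r (S.ϑ square)
        odd-product = trans (*-cong (widen 1 s odds-big) (widen 1 s odds-big)) (S.jacobi-square m ℕₚ.≤-refl)
        even-product : ∏1+ (λ n → n ℕ.* 2) (s * y) * ∏1+ evens (s * y⁻) ≈ β * ∑± r (SY.ϑ pronic)
        even-product = trans (*-cong (widen 0 (s * y) doubles-big) (widen 2 (s * y⁻) evens-big)) (SY.jacobi-pronic m ℕₚ.≤-refl)

      private
        telescope : (e : ℕ → ℕ) (T : ℕ → Carrier) → (∀ i → T (suc i) ≈ (1# + s * x ^ e i) * T i) →
          ∀ i → T i ≈ ∏ i (λ j → 1# + s * x ^ e j) * T 0
        telescope e T step zero = sym (*-identityˡ _)
        telescope e T step (suc i) = trans (step i) (trans (*-congˡ (telescope e T step i))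
          (solve 3 (λ a b c → a :* (b :* c) := (b :* a) :* c) refl _ _ _))

      -- Eigenvectors of the exchange of charges. The factor y in `S₂` compensates for the two
      -- recursions having the constants k y and k y⁻.
      S₁ S₂ : ℕ → Carrier
      S₁ i = G false true (odds i) + s * G true false (odds i)
      S₂ i = G false false (i ℕ.* 2) + s * (y * G true true (i ℕ.* 2))

      S₁-product : S₁ N ≈ ∏1+ evens s * S₁ 0
      S₁-product = telescope evens S₁ step N
        where
        step : ∀ i → S₁ (suc i) ≈ (1# + s * x ^ evens i) * S₁ i
        step i = begin
          G false true (odds (suc i)) + s * G true false (odds (suc i))
            ≈⟨ +-cong (G-step false true (odds i) k (λ L → row-even false (suc i) L))
                      (*-congˡ (G-step true false (odds i) k (λ L → row-even true (suc i) L))) ⟩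
          (g + k * h) + s * (h + k * g)
            -- Writing 1 as s² in front of k h lets 1 + s k be factored out.
            ≈⟨ +-congʳ (+-congˡ (trans (sym (*-identityˡ _)) (*-congʳ (sym s*s≈1)))) ⟩
          (g + (s * s) * (k * h)) + s * (h + k * g)
            ≈⟨ solve 4 (λ g h k s → (g :+ (s :* s) :* (k :* h)) :+ s :* (h :+ k :* g) := (:1 :+ s :* k) :* (g :+ s :* h)) refl g h k s ⟩
          (1# + s * k) * (g + s * h) ∎
          where
          g h k : Carrier
          g = G false true (odds i)
          h = G true false (odds i)
          k = x ^ evens i

      S₂-product : S₂ N ≈ ∏1+ odds s * S₂ 0
      S₂-product = telescope odds S₂ step N
        where
        step : ∀ i → S₂ (suc i) ≈ (1# + s * x ^ odds i) * S₂ i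
        step i = begin
          G false false (suc i ℕ.* 2) + s * (y * G true true (suc i ℕ.* 2))
            ≈⟨ +-cong (G-step false false (i ℕ.* 2) (k * y) (λ L → trans (*-congˡ (row-even true i L)) (odd-row y (row true L))))
                      (*-congˡ (*-congˡ (G-step true true (i ℕ.* 2) (k * y⁻) (λ L → trans (*-congˡ (row-even false i L)) (odd-row y⁻ (row false L)))))) ⟩
          (g + (k * y) * h) + s * (y * (h + (k * y⁻) * g))
            ≈⟨ solve 6 (λ g h k s y z → (g :+ (k :* y) :* h) :+ s :* (y :* (h :+ (k :* z) :* g))
                 := (g :+ :1 :* (k :* (y :* h))) :+ s :* (y :* h :+ (y :* z) :* (k :* g))) refl g h k s y y⁻ ⟩
          (g + 1# * (k * (y * h))) + s * (y * h + (y * y⁻) * (k * g))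
            ≈⟨ +-cong (+-congˡ (*-congʳ (sym s*s≈1))) (*-congˡ (+-congˡ (trans (*-congʳ y*y⁻≈1) (*-identityˡ _)))) ⟩
          (g + (s * s) * (k * (y * h))) + s * (y * h + k * g)
            ≈⟨ solve 4 (λ g h k s → (g :+ (s :* s) :* (k :* h)) :+ s :* (h :+ k :* g) := (:1 :+ s :* k) :* (g :+ s :* h)) refl g (y * h) k s ⟩
          (1# + s * k) * (g + s * (y * h)) ∎
          where
          g h k : Carrier
          g = G false false (i ℕ.* 2)
          h = G true true (i ℕ.* 2)
          k = x ^ odds i
          odd-row : ∀ a r → (x * a) * (x ^ (i ℕ.* 2) * r) ≈ (k * a) * r
          odd-row a r = solve 4 (λ x a p r → (x :* a) :* (p :* r) := ((x :* p) :* a) :* r) refl x a (x ^ (i ℕ.* 2)) r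

      S₁-unrestricted : S₁ N ≈ E false * E true + s * (E false * E true)
      S₁-unrestricted = +-cong (G-unrestricted false true _ big) (*-congˡ (trans (G-unrestricted true false _ big) (*-comm _ _)))
        where
        big : N ≤ odds N
        big = ℕₚ.m≤n⇒m≤1+n (n≤n*2 N)

      S₂-unrestricted : S₂ N ≈ E false * E false + s * (y * (E true * E true))
      S₂-unrestricted = +-cong (G-unrestricted false false _ (n≤n*2 N)) (*-congˡ (*-congˡ (G-unrestricted true true _ (n≤n*2 N))))

      ∏1+-unit : ∀ e → (∀ n → Σ ℕ λ k → e n ≡ suc k) → ∀ a → IsUnit (∏1+ e a)
      ∏1+-unit e pos a = ∏-unit N λ n → let (k , eq) = pos n ; (b , u) = 1+x^-unit k a in
        b , trans (*-congʳ (+-congˡ (trans (*-comm a _) (*-congʳ (^-congʳ x eq))))) u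

      -- Of the two odd products in `unrestricted₂` one is the telescoped factor and cancels.
      S₂-value : 1 ≤ N → S₂ 0 ≈ ∏1+ odds s * (∏1+ (λ n → n ℕ.* 2) (s * y) * ∏1+ evens (s * y⁻))
      S₂-value 1≤N = unit-cancel (∏1+-unit odds (λ n → n ℕ.* 2 , ≡.refl) s) (begin
        ∏1+ odds s * S₂ 0   ≈⟨ S₂-product ⟨
        S₂ N                ≈⟨ S₂-unrestricted ⟩
        E false * E false + s * (y * (E true * E true)) ≈⟨ unrestricted₂ 1≤N ⟩
        (∏1+ odds s * ∏1+ odds s) * (∏1+ (λ n → n ℕ.* 2) (s * y) * ∏1+ evens (s * y⁻)) ≈⟨ *-assoc _ _ _ ⟩
        ∏1+ odds s * (∏1+ odds s * (∏1+ (λ n → n ℕ.* 2) (s * y) * ∏1+ evens (s * y⁻))) ∎)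

    private
      1*1≈1 : 1# * 1# ≈ 1#
      1*1≈1 = *-identityˡ 1#

      -1*-1≈1 : - 1# * - 1# ≈ 1#
      -1*-1≈1 = solve 0 ((:- :1) :* (:- :1) := :1) refl

      evens-unit : ∀ s → IsUnit (∏1+ evens s)
      evens-unit s = ∏1+-unit 1# 1*1≈1 evens (λ n → suc (n ℕ.* 2) , ≡.refl) s

      S₁⁺-value : S₁ 1# 1*1≈1 0 ≈ two * (∏1+ evens 1# * (∏1+ odds y * ∏1+ odds y⁻))
      S₁⁺-value = unit-cancel (evens-unit 1#) (begin
        q * S₁ 1# 1*1≈1 0                                  ≈⟨ S₁-product 1# 1*1≈1 ⟨
        S₁ 1# 1*1≈1 N                                      ≈⟨ S₁-unrestricted 1# 1*1≈1 ⟩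
        E false * E true + 1# * (E false * E true)
          ≈⟨ solve 1 (λ e → e :+ :1 :* e := (:1 :+ :1) :* e) refl (E false * E true) ⟩
        two * (E false * E true)                           ≈⟨ unrestricted₁ ⟩
        (∏1+ odds y * ∏1+ odds y⁻) * (two * (q * q))
          ≈⟨ solve 3 (λ o t q → o :* (t :* (q :* q)) := q :* (t :* (q :* o))) refl (∏1+ odds y * ∏1+ odds y⁻) two q ⟩
        q * (two * (q * (∏1+ odds y * ∏1+ odds y⁻)))       ∎)
        where
        q : Carrier
        q = ∏1+ evens 1#

      -- For large c both orders of the charges give `E false * E true`; cancelling the telescoped
      -- product carries this equality down to c = 1.
      S₁⁻-value : S₁ (- 1#) -1*-1≈1 0 ≈ 0#
      S₁⁻-value = unit-cancel (evens-unit (- 1#)) (begin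
        ∏1+ evens (- 1#) * S₁ (- 1#) -1*-1≈1 0             ≈⟨ S₁-product (- 1#) -1*-1≈1 ⟨
        S₁ (- 1#) -1*-1≈1 N                                ≈⟨ S₁-unrestricted (- 1#) -1*-1≈1 ⟩
        E false * E true + - 1# * (E false * E true)
          ≈⟨ solve 2 (λ e z → e :+ (:- :1) :* e := z :* :0) refl (E false * E true) (∏1+ evens (- 1#)) ⟩
        ∏1+ evens (- 1#) * 0#                              ∎)

    product₁ : Carrier
    product₁ = ∏1+ evens 1# * (∏1+ odds y * ∏1+ odds y⁻)

    identity₁ : G false true 1 + G false true 1 ≈ product₁ + product₁
    identity₁ = begin
      g + g
        ≈⟨ solve 2 (λ g h → g :+ g := (g :+ :1 :* h) :+ (g :+ (:- :1) :* h)) refl g (G true false 1) ⟩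
      S₁ 1# 1*1≈1 0 + S₁ (- 1#) -1*-1≈1 0
        ≈⟨ +-cong S₁⁺-value S₁⁻-value ⟩
      two * product₁ + 0#
        ≈⟨ solve 1 (λ p → (:1 :+ :1) :* p :+ :0 := p :+ p) refl product₁ ⟩
      product₁ + product₁ ∎
      where
      g : Carrier
      g = G false true 1

    product₂ : Carrier → Carrier
    product₂ s = ∏1+ odds s * (∏1+ (λ n → n ℕ.* 2) (s * y) * ∏1+ evens (s * y⁻))

    identity₂ : 1 ≤ N → G false false 0 + G false false 0 ≈ product₂ 1# + product₂ (- 1#)
    identity₂ 1≤N = begin
      g + g
        ≈⟨ solve 2 (λ g h → g :+ g := (g :+ :1 :* h) :+ (g :+ (:- :1) :* h)) refl g (y * G true true 0) ⟩
      S₂ 1# 1*1≈1 0 + S₂ (- 1#) -1*-1≈1 0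
        ≈⟨ +-cong (S₂-value 1# 1*1≈1 1≤N) (S₂-value (- 1#) -1*-1≈1 1≤N) ⟩
      product₂ 1# + product₂ (- 1#) ∎
      where
      g : Carrier
      g = G false false 0

-- The ring of Laurent polynomials in y with x truncated beyond degree N.

module Polynomials where
  open ≡ using (refl; sym; trans; cong; cong₂)
  open ≡.≡-Reasoning

  Term : Set
  Term = ℕ × ℤ × ℤ

  infixl 7 _·_
  _·_ : Term → Term → Term
  (e , f , c) · (e′ , f′ , c′) = e ℕ.+ e′ , f ℤ.+ f′ , c ℤ.* c′

  scale : Term → Poly → Poly
  scale t = map (t ·_)

  negate : Poly → Poly
  negate = map (λ { (e , f , c) → e , f , ℤ.- c })

  term-coeff : Term → ℕ → ℤ → ℤ
  term-coeff (e , f , c) n k = if (e ℕ.≡ᵇ n) ∧ ⌊ f ℤ.≟ k ⌋ then c else + 0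

  coeff-++ : ∀ p q n k → coeff (p ++ q) n k ≡ coeff p n k ℤ.+ coeff q n k
  coeff-++ [] q n k = sym (ℤₚ.+-identityˡ _)
  coeff-++ (t ∷ p) q n k = trans (cong (λ z → term-coeff t n k ℤ.+ z) (coeff-++ p q n k)) (sym (ℤₚ.+-assoc (term-coeff t n k) (coeff p n k) (coeff q n k)))

  coeff-negate : ∀ p n k → coeff (negate p) n k ≡ ℤ.- coeff p n k
  coeff-negate [] n k = refl
  coeff-negate ((e , f , c) ∷ p) n k = trans (cong₂ ℤ._+_ (negated ((e ℕ.≡ᵇ n) ∧ ⌊ f ℤ.≟ k ⌋)) (coeff-negate p n k))
    (sym (ℤₚ.neg-distrib-+ (term-coeff (e , f , c) n k) _))
    where
    negated : ∀ b → (if b then ℤ.- c else + 0) ≡ ℤ.- (if b then c else + 0)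
    negated true = refl
    negated false = refl

  ·-assoc : ∀ s t u → (s · t) · u ≡ s · (t · u)
  ·-assoc (e , f , c) (e′ , f′ , c′) (e″ , f″ , c″) =
    cong₂ _,_ (ℕₚ.+-assoc e e′ e″) (cong₂ _,_ (ℤₚ.+-assoc f f′ f″) (ℤₚ.*-assoc c c′ c″))

  ·-comm : ∀ s t → s · t ≡ t · s
  ·-comm (e , f , c) (e′ , f′ , c′) = cong₂ _,_ (ℕₚ.+-comm e e′) (cong₂ _,_ (ℤₚ.+-comm f f′) (ℤₚ.*-comm c c′))

  ·-identityˡ : ∀ t → (0 , + 0 , + 1) · t ≡ t
  ·-identityˡ (e , f , c) = cong₂ (λ f c → e , f , c) (ℤₚ.+-identityˡ f) (ℤₚ.*-identityˡ c)

  ⊗-∷ : ∀ t p q → (t ∷ p) ⊗ q ≡ scale t q ++ p ⊗ q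
  ⊗-∷ t p q = cong (_++ p ⊗ q) (Listₚ.map-cong (λ _ → refl) q)

  ⊗-++ : ∀ p q r → (p ++ q) ⊗ r ≡ p ⊗ r ++ q ⊗ r
  ⊗-++ [] q r = refl
  ⊗-++ (t ∷ p) q r = begin
    (t ∷ p ++ q) ⊗ r                  ≡⟨ ⊗-∷ t (p ++ q) r ⟩
    scale t r ++ (p ++ q) ⊗ r         ≡⟨ cong (scale t r ++_) (⊗-++ p q r) ⟩
    scale t r ++ (p ⊗ r ++ q ⊗ r)     ≡⟨ Listₚ.++-assoc (scale t r) (p ⊗ r) (q ⊗ r) ⟨
    (scale t r ++ p ⊗ r) ++ q ⊗ r     ≡⟨ cong (_++ q ⊗ r) (⊗-∷ t p r) ⟨
    (t ∷ p) ⊗ r ++ q ⊗ r              ∎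

  scale-⊗ : ∀ t p q → scale t p ⊗ q ≡ scale t (p ⊗ q)
  scale-⊗ t [] q = refl
  scale-⊗ t (s ∷ p) q = begin
    (t · s ∷ scale t p) ⊗ q               ≡⟨ ⊗-∷ (t · s) (scale t p) q ⟩
    scale (t · s) q ++ scale t p ⊗ q      ≡⟨ cong₂ _++_ (trans (Listₚ.map-cong (·-assoc t s) q) (Listₚ.map-∘ q)) (scale-⊗ t p q) ⟩
    scale t (scale s q) ++ scale t (p ⊗ q) ≡⟨ Listₚ.map-++ (t ·_) (scale s q) (p ⊗ q) ⟨
    scale t (scale s q ++ p ⊗ q)          ≡⟨ cong (scale t) (⊗-∷ s p q) ⟨
    scale t ((s ∷ p) ⊗ q)                 ∎

  -- An equality of lists, since both sides list the triple products in the same order.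
  -- Commutativity changes the order and is proved only for coefficients.
  ⊗-assoc : ∀ p q r → (p ⊗ q) ⊗ r ≡ p ⊗ (q ⊗ r)
  ⊗-assoc [] q r = refl
  ⊗-assoc (t ∷ p) q r = begin
    ((t ∷ p) ⊗ q) ⊗ r                     ≡⟨ cong (_⊗ r) (⊗-∷ t p q) ⟩
    (scale t q ++ p ⊗ q) ⊗ r              ≡⟨ ⊗-++ (scale t q) (p ⊗ q) r ⟩
    scale t q ⊗ r ++ (p ⊗ q) ⊗ r          ≡⟨ cong₂ _++_ (scale-⊗ t q r) (⊗-assoc p q r) ⟩
    scale t (q ⊗ r) ++ p ⊗ (q ⊗ r)        ≡⟨ ⊗-∷ t p (q ⊗ r) ⟨
    (t ∷ p) ⊗ (q ⊗ r)                     ∎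

  ⊗-[] : ∀ p → p ⊗ [] ≡ []
  ⊗-[] [] = refl
  ⊗-[] (t ∷ p) = trans (⊗-∷ t p []) (⊗-[] p)

  ⊗-identityˡ : ∀ p → one ⊗ p ≡ p
  ⊗-identityˡ p = begin
    one ⊗ p                                  ≡⟨ ⊗-∷ (0 , + 0 , + 1) [] p ⟩
    scale (0 , + 0 , + 1) p ++ []            ≡⟨ Listₚ.++-identityʳ _ ⟩
    scale (0 , + 0 , + 1) p                  ≡⟨ Listₚ.map-cong ·-identityˡ p ⟩
    map (λ t → t) p                          ≡⟨ Listₚ.map-id p ⟩
    p ∎

  private
    +-exchange : ∀ a b c d → (a ℤ.+ b) ℤ.+ (c ℤ.+ d) ≡ (a ℤ.+ c) ℤ.+ (b ℤ.+ d)
    +-exchange = solve-∀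

  coeff-⊗-∷ : ∀ t p q n k → coeff ((t ∷ p) ⊗ q) n k ≡ coeff (scale t q) n k ℤ.+ coeff (p ⊗ q) n k
  coeff-⊗-∷ t p q n k = trans (cong (λ r → coeff r n k) (⊗-∷ t p q)) (coeff-++ (scale t q) (p ⊗ q) n k)

  coeff-⊗-∷ʳ : ∀ q t p n k → coeff (q ⊗ (t ∷ p)) n k ≡ coeff (scale t q) n k ℤ.+ coeff (q ⊗ p) n k
  coeff-⊗-∷ʳ [] t p n k = refl
  coeff-⊗-∷ʳ (s ∷ q) t p n k = begin
    coeff ((s ∷ q) ⊗ (t ∷ p)) n k
      ≡⟨ coeff-⊗-∷ s q (t ∷ p) n k ⟩
    (term-coeff (s · t) n k ℤ.+ coeff (scale s p) n k) ℤ.+ coeff (q ⊗ (t ∷ p)) n k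
      ≡⟨ cong₂ ℤ._+_ (cong (λ u → term-coeff u n k ℤ.+ coeff (scale s p) n k) (·-comm s t)) (coeff-⊗-∷ʳ q t p n k) ⟩
    (term-coeff (t · s) n k ℤ.+ coeff (scale s p) n k) ℤ.+ (coeff (scale t q) n k ℤ.+ coeff (q ⊗ p) n k)
      ≡⟨ +-exchange (term-coeff (t · s) n k) _ _ _ ⟩
    (term-coeff (t · s) n k ℤ.+ coeff (scale t q) n k) ℤ.+ (coeff (scale s p) n k ℤ.+ coeff (q ⊗ p) n k)
      ≡⟨ cong (λ z → coeff (scale t (s ∷ q)) n k ℤ.+ z) (coeff-⊗-∷ s q p n k) ⟨
    coeff (scale t (s ∷ q)) n k ℤ.+ coeff ((s ∷ q) ⊗ p) n k ∎

  coeff-⊗-comm : ∀ p q n k → coeff (p ⊗ q) n k ≡ coeff (q ⊗ p) n k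
  coeff-⊗-comm [] q n k = cong (λ r → coeff r n k) (sym (⊗-[] q))
  coeff-⊗-comm (t ∷ p) q n k = begin
    coeff ((t ∷ p) ⊗ q) n k                           ≡⟨ coeff-⊗-∷ t p q n k ⟩
    coeff (scale t q) n k ℤ.+ coeff (p ⊗ q) n k       ≡⟨ cong (λ z → coeff (scale t q) n k ℤ.+ z) (coeff-⊗-comm p q n k) ⟩
    coeff (scale t q) n k ℤ.+ coeff (q ⊗ p) n k       ≡⟨ coeff-⊗-∷ʳ q t p n k ⟨
    coeff (q ⊗ (t ∷ p)) n k                           ∎

  ≡ᵇ-cancel : ∀ e a b → (e ℕ.+ a ℕ.≡ᵇ e ℕ.+ b) ≡ (a ℕ.≡ᵇ b)
  ≡ᵇ-cancel zero a b = refl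
  ≡ᵇ-cancel (suc e) a b = ≡ᵇ-cancel e a b

  ≡ᵇ-big : ∀ e n → n < e → (e ℕ.≡ᵇ n) ≡ false
  ≡ᵇ-big (suc e) zero _ = refl
  ≡ᵇ-big (suc e) (suc n) (s≤s p) = ≡ᵇ-big e n p

  ≟-shift : ∀ f f′ k → ⌊ f ℤ.+ f′ ℤ.≟ k ⌋ ≡ ⌊ f′ ℤ.≟ k ℤ.- f ⌋
  ≟-shift f f′ k with f ℤ.+ f′ ℤ.≟ k | f′ ℤ.≟ k ℤ.- f
  ... | yes _ | yes _ = refl
  ... | no _ | no _ = refl
  ... | yes refl | no q = contradiction (identity f f′) q
    where
    identity : ∀ f f′ → f′ ≡ f ℤ.+ f′ ℤ.- f
    identity = solve-∀
  ... | no p | yes refl = contradiction (identity f k) p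
    where
    identity : ∀ f k → f ℤ.+ (k ℤ.- f) ≡ k
    identity = solve-∀

  coeff-scale : ∀ e f c q m k → coeff (scale (e , f , c) q) (e ℕ.+ m) k ≡ c ℤ.* coeff q m (k ℤ.- f)
  coeff-scale e f c [] m k = sym (ℤₚ.*-zeroʳ c)
  coeff-scale e f c ((e′ , f′ , c′) ∷ q) m k = begin
    (if (e ℕ.+ e′ ℕ.≡ᵇ e ℕ.+ m) ∧ ⌊ f ℤ.+ f′ ℤ.≟ k ⌋ then c ℤ.* c′ else + 0) ℤ.+ coeff (scale (e , f , c) q) (e ℕ.+ m) k
      ≡⟨ cong₂ ℤ._+_ (cong₂ (λ a b → if a ∧ b then c ℤ.* c′ else + 0) (≡ᵇ-cancel e e′ m) (≟-shift f f′ k)) (coeff-scale e f c q m k) ⟩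
    (if (e′ ℕ.≡ᵇ m) ∧ ⌊ f′ ℤ.≟ k ℤ.- f ⌋ then c ℤ.* c′ else + 0) ℤ.+ c ℤ.* coeff q m (k ℤ.- f)
      ≡⟨ cong (ℤ._+ c ℤ.* coeff q m (k ℤ.- f)) (factored ((e′ ℕ.≡ᵇ m) ∧ ⌊ f′ ℤ.≟ k ℤ.- f ⌋)) ⟩
    c ℤ.* term-coeff (e′ , f′ , c′) m (k ℤ.- f) ℤ.+ c ℤ.* coeff q m (k ℤ.- f)
      ≡⟨ ℤₚ.*-distribˡ-+ c (term-coeff (e′ , f′ , c′) m (k ℤ.- f)) (coeff q m (k ℤ.- f)) ⟨
    c ℤ.* (term-coeff (e′ , f′ , c′) m (k ℤ.- f) ℤ.+ coeff q m (k ℤ.- f)) ∎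
    where
    factored : ∀ b → (if b then c ℤ.* c′ else + 0) ≡ c ℤ.* (if b then c′ else + 0)
    factored true = refl
    factored false = sym (ℤₚ.*-zeroʳ c)

  coeff-scale-low : ∀ e f c q n k → n < e → coeff (scale (e , f , c) q) n k ≡ + 0
  coeff-scale-low e f c [] n k n<e = refl
  coeff-scale-low e f c ((e′ , f′ , c′) ∷ q) n k n<e = cong₂ ℤ._+_
    (cong (λ b → if b ∧ ⌊ f ℤ.+ f′ ℤ.≟ k ⌋ then c ℤ.* c′ else + 0) (≡ᵇ-big (e ℕ.+ e′) n (ℕₚ.<-≤-trans n<e (ℕₚ.m≤m+n e e′))))
    (coeff-scale-low e f c q n k n<e)

  module TruncatedPolynomials (N : ℕ) where

    infix 4 _≈_
    -- Wrapping the family of equations in a record lets `p` and `q` be recovered by unification.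
    record _≈_ (p q : Poly) : Set where
      field
        coeffs : ∀ n → n ≤ N → ∀ k → coeff p n k ≡ coeff q n k
    open _≈_ public

    ≡⇒≈ : ∀ {p q} → p ≡ q → p ≈ q
    ≡⇒≈ refl .coeffs n _ k = refl

    private
      ≈-sym : ∀ {p q} → p ≈ q → q ≈ p
      ≈-sym e .coeffs n n≤N k = sym (e .coeffs n n≤N k)

      ≈-trans : ∀ {p q r} → p ≈ q → q ≈ r → p ≈ r
      ≈-trans e f .coeffs n n≤N k = trans (e .coeffs n n≤N k) (f .coeffs n n≤N k)

      ⊕-cong : ∀ {p p′ q q′} → p ≈ p′ → q ≈ q′ → p ⊕ q ≈ p′ ⊕ q′
      ⊕-cong {p} {p′} {q} {q′} e f .coeffs n n≤N k =
        trans (coeff-++ p q n k) (trans (cong₂ ℤ._+_ (e .coeffs n n≤N k) (f .coeffs n n≤N k)) (sym (coeff-++ p′ q′ n k)))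

      ⊕-comm : ∀ p q → p ⊕ q ≈ q ⊕ p
      ⊕-comm p q .coeffs n _ k = trans (coeff-++ p q n k) (trans (ℤₚ.+-comm (coeff p n k) (coeff q n k)) (sym (coeff-++ q p n k)))

      ⊕-inverseʳ : ∀ p → p ⊕ negate p ≈ []
      ⊕-inverseʳ p .coeffs n _ k = trans (coeff-++ p (negate p) n k)
        (trans (cong (λ z → coeff p n k ℤ.+ z) (coeff-negate p n k)) (ℤₚ.+-inverseʳ (coeff p n k)))

      negate-cong : ∀ {p q} → p ≈ q → negate p ≈ negate q
      negate-cong {p} {q} e .coeffs n n≤N k =
        trans (coeff-negate p n k) (trans (cong ℤ.-_ (e .coeffs n n≤N k)) (sym (coeff-negate q n k)))

      -- Exponents of x are natural numbers, so coefficient n of the result depends only on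
      -- coefficient n - e ≤ N of the argument; this makes truncated equality a congruence.
      scale-cong : ∀ t {p q} → p ≈ q → scale t p ≈ scale t q
      scale-cong (e , f , c) {p} {q} eq .coeffs n n≤N k with e ℕ.≤? n
      ... | no e≰n = trans (coeff-scale-low e f c p n k (ℕₚ.≰⇒> e≰n)) (sym (coeff-scale-low e f c q n k (ℕₚ.≰⇒> e≰n)))
      ... | yes e≤n = ≡.subst (λ n → coeff (scale (e , f , c) p) n k ≡ coeff (scale (e , f , c) q) n k) (ℕₚ.m+[n∸m]≡n e≤n)
        (trans (coeff-scale e f c p (n ℕ.∸ e) k)
          (trans (cong (c ℤ.*_) (eq .coeffs (n ℕ.∸ e) (ℕₚ.≤-trans (ℕₚ.m∸n≤m n e) n≤N) (k ℤ.- f))) (sym (coeff-scale e f c q (n ℕ.∸ e) k))))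

      ⊗-congˡ : ∀ p {q q′} → q ≈ q′ → p ⊗ q ≈ p ⊗ q′
      ⊗-congˡ [] e .coeffs n _ k = refl
      ⊗-congˡ (t ∷ p) {q} {q′} e .coeffs n n≤N k = trans (coeff-⊗-∷ t p q n k)
        (trans (cong₂ ℤ._+_ (scale-cong t e .coeffs n n≤N k) (⊗-congˡ p e .coeffs n n≤N k)) (sym (coeff-⊗-∷ t p q′ n k)))

      ⊗-comm : ∀ p q → p ⊗ q ≈ q ⊗ p
      ⊗-comm p q .coeffs n _ k = coeff-⊗-comm p q n k

      ⊗-cong : ∀ {p p′ q q′} → p ≈ p′ → q ≈ q′ → p ⊗ q ≈ p′ ⊗ q′
      ⊗-cong {p} {p′} {q} {q′} e f = ≈-trans (⊗-congˡ p f) (≈-trans (⊗-comm p q′) (≈-trans (⊗-congˡ q′ e) (⊗-comm q′ p′)))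

      ⊗-distribʳ : ∀ r p q → (p ⊕ q) ⊗ r ≈ p ⊗ r ⊕ q ⊗ r
      ⊗-distribʳ r p q = ≡⇒≈ (⊗-++ p q r)

      ⊗-distribˡ : ∀ r p q → r ⊗ (p ⊕ q) ≈ r ⊗ p ⊕ r ⊗ q
      ⊗-distribˡ r p q = ≈-trans (⊗-comm r (p ⊕ q)) (≈-trans (⊗-distribʳ r p q) (⊕-cong (⊗-comm p r) (⊗-comm q r)))

    polynomials : CommutativeRing 0ℓ 0ℓ
    polynomials = record
      { Carrier = Poly
      ; _≈_ = _≈_
      ; _+_ = _⊕_
      ; _*_ = _⊗_
      ; -_ = negate
      ; 0# = []
      ; 1# = one
      ; isCommutativeRing = record
        { isRing = record
          { +-isAbelianGroup = record
            { isGroup = record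
              { isMonoid = record
                { isSemigroup = record
                  { isMagma = record
                    { isEquivalence = record { refl = ≡⇒≈ refl ; sym = ≈-sym ; trans = ≈-trans }
                    ; ∙-cong = ⊕-cong
                    }
                  ; assoc = λ p q r → ≡⇒≈ (Listₚ.++-assoc p q r)
                  }
                ; identity = (λ p → ≡⇒≈ refl) , (λ p → ≡⇒≈ (Listₚ.++-identityʳ p))
                }
              ; inverse = (λ p → ≈-trans (⊕-comm (negate p) p) (⊕-inverseʳ p)) , ⊕-inverseʳ
              ; ⁻¹-cong = negate-cong
              }
            ; comm = ⊕-comm
            }
          ; *-cong = ⊗-cong
          ; *-assoc = λ p q r → ≡⇒≈ (⊗-assoc p q r)
          ; *-identity = (λ p → ≡⇒≈ (⊗-identityˡ p)) , (λ p → ≈-trans (⊗-comm p one) (≡⇒≈ (⊗-identityˡ p)))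
          ; distrib = ⊗-distribˡ , ⊗-distribʳ
          }
        ; *-comm = ⊗-comm
        }
      }

open Polynomials

-- The stated products as elements of the truncated ring.

module RightHandSides (N : ℕ) where
  open TruncatedPolynomials N public
  open CommutativeRing polynomials hiding (_≈_)
  open Algebra.Properties.Semiring.Exp semiring using (_^_; ^-congʳ)
  open FiniteSums polynomials
  open IntegerSolver polynomials
  open Relation.Binary.Reasoning.Setoid setoid

  x y y⁻ : Poly
  x = (1 , + 0 , + 1) ∷ []
  y = (0 , + 1 , + 1) ∷ []
  y⁻ = (0 , ℤ.- + 1 , + 1) ∷ []

  x^≡ : ∀ n → x ^ n ≡ (n , + 0 , + 1) ∷ []
  x^≡ zero = ≡.refl
  x^≡ (suc n) = ≡.cong (x ⊗_) (x^≡ n)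

  term≈0 : ∀ e f c → N < e → (e , f , c) ∷ [] ≈ []
  term≈0 e f c N<e .coeffs n n≤N k =
    ≡.cong (λ b → (if b ∧ ⌊ f ℤ.≟ k ⌋ then c else + 0) ℤ.+ + 0) (≡ᵇ-big e n (ℕₚ.≤-<-trans n≤N N<e))

  x-nilpotent : x ^ suc N ≈ 0#
  x-nilpotent = trans (≡⇒≈ (x^≡ (suc N))) (term≈0 (suc N) (+ 0) (+ 1) ℕₚ.≤-refl)

  y*y⁻≈1 : y * y⁻ ≈ 1#
  y*y⁻≈1 = refl

  open DistinctPartitions polynomials
  open Weights x y y⁻ y*y⁻≈1 public
  open Stable N x-nilpotent public
  open Identities polynomials
  open Products x y y⁻ y*y⁻≈1 N x-nilpotent public

  prodFrom1≈∏ : ∀ M f g → (∀ n → f (suc n) ≈ g n) → prodFrom1 M f ≈ ∏ M g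
  prodFrom1≈∏ zero f g e = refl
  prodFrom1≈∏ (suc M) f g e = *-cong (prodFrom1≈∏ M f g e) (e M)

  private
    2*≡ : ∀ n → 2 ℕ.* n ≡ n ℕ.* 2
    2*≡ n = ℕₚ.*-comm 2 n

  -- The filter removes only terms that vanish modulo x^(N+1). With all j ≤ N restored, the product
  -- telescopes to 1 minus a power of x beyond N.
  geomUpTo-inverse : ∀ d → (1# - x ^ suc d) * geomUpTo N (suc d) ≈ 1#
  geomUpTo-inverse d = begin
    (1# - u) * geomUpTo N (suc d)        ≈⟨ *-congˡ {1# - u} (unfilter (upTo (suc N))) ⟩
    (1# - u) * powers (upTo (suc N))     ≈⟨ telescope (suc N) ⟩
    1# - x ^ (suc d ℕ.* suc N)           ≈⟨ +-congˡ (-‿cong (trans (≡⇒≈ (x^≡ _)) (term≈0 _ (+ 0) (+ 1) (ℕₚ.m≤n*m (suc N) (suc d))))) ⟩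
    1# - 0#                              ≈⟨ solve 0 (:1 :- :0 := :1) refl ⟩
    1# ∎
    where
    u : Poly
    u = x ^ suc d
    term : ℕ → ℕ × ℤ × ℤ
    term j = suc d ℕ.* j , + 0 , + 1
    powers : List ℕ → Poly
    powers = map term
    unfilter : ∀ js → powers (filterᵇ (λ j → suc d ℕ.* j ℕ.≤ᵇ N) js) ≈ powers js
    unfilter [] = refl
    unfilter (j ∷ js) with suc d ℕ.* j ℕ.≤ᵇ N in eq
    ... | true = +-cong {term j ∷ []} {term j ∷ []} refl (unfilter js)
    ... | false = trans (unfilter js) (+-cong {[]} {term j ∷ []} (sym (term≈0 _ (+ 0) (+ 1) big)) refl)
      where
      big : N < suc d ℕ.* j
      big = ℕₚ.≰⇒> λ le → ≡.subst T eq (ℕₚ.≤⇒≤ᵇ le)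
    telescope : ∀ n → (1# - u) * powers (upTo n) ≈ 1# - x ^ (suc d ℕ.* n)
    telescope zero = begin
      (1# - u) * 0#                ≈⟨ solve 1 (λ u → (:1 :- u) :* :0 := :1 :- :1) refl u ⟩
      1# - 1#                      ≈⟨ +-congˡ (-‿cong (^-congʳ x (≡.sym (ℕₚ.*-zeroʳ (suc d))))) ⟩
      1# - x ^ (suc d ℕ.* 0)       ∎
    telescope (suc n) = begin
      (1# - u) * powers (upTo (suc n))
        ≈⟨ *-congˡ {1# - u} (≡⇒≈ (≡.trans (≡.cong powers (≡.sym (Listₚ.upTo-∷ʳ n))) (Listₚ.map-++ term (upTo n) (n ∷ [])))) ⟩
      (1# - u) * (powers (upTo n) + (term n ∷ []))
        ≈⟨ *-congˡ {1# - u} (+-congˡ {powers (upTo n)} (≡⇒≈ (≡.sym (x^≡ (suc d ℕ.* n))))) ⟩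
      (1# - u) * (powers (upTo n) + v)
        ≈⟨ distribˡ (1# - u) (powers (upTo n)) v ⟩
      (1# - u) * powers (upTo n) + (1# - u) * v
        ≈⟨ +-congʳ (telescope n) ⟩
      (1# - v) + (1# - u) * v
        ≈⟨ solve 2 (λ u v → (:1 :- v) :+ (:1 :- u) :* v := :1 :- u :* v) refl u v ⟩
      1# - u * v
        ≈⟨ +-congˡ (-‿cong (trans (*-cong (≡⇒≈ (x^≡ (suc d))) (≡⇒≈ (x^≡ (suc d ℕ.* n)))) (≡⇒≈ (≡.sym (≡.trans (x^≡ (suc d ℕ.* suc n)) (≡.cong (λ e → (e , + 0 , + 1) ∷ []) (ℕₚ.*-suc (suc d) n))))))) ⟩
      1# - x ^ (suc d ℕ.* suc n) ∎
      where
      v : Poly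
      v = x ^ (suc d ℕ.* n)

  private
    -- The equation on shapes holds by computation as soon as s and f are concrete.
    binom≈ : ∀ {s f e e′} a → (∀ n → binom s f n ≡ 1# + a * ((n , + 0 , + 1) ∷ [])) → e ≡ e′ → binom s f e ≈ 1# + a * x ^ e′
    binom≈ {e = e} a shape ≡.refl = trans (≡⇒≈ (shape e)) (+-congˡ {1#} (*-congˡ {a} (≡⇒≈ (≡.sym (x^≡ e)))))

    evens≡ : ∀ n → 2 ℕ.* suc n ≡ evens n
    evens≡ n = 2*≡ (suc n)

    odds≡ : ∀ n → 2 ℕ.* suc n ℕ.∸ 1 ≡ odds n
    odds≡ n = ≡.cong (ℕ._∸ 1) (evens≡ n)

    doubles≡ : ∀ n → 2 ℕ.* suc n ℕ.∸ 2 ≡ n ℕ.* 2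
    doubles≡ n = ≡.cong (ℕ._∸ 2) (evens≡ n)

  -- Each factor 1 - x^(2n) cancels against its geometric series.
  rhs1≈product₁ : rhs1 N ≈ product₁
  rhs1≈product₁ = begin
    rhs1 N ≈⟨ prodFrom1≈∏ N _ (λ n → (1# + 1# * x ^ evens n) * ((1# + y * x ^ odds n) * (1# + y⁻ * x ^ odds n))) factor ⟩
    ∏ N (λ n → (1# + 1# * x ^ evens n) * ((1# + y * x ^ odds n) * (1# + y⁻ * x ^ odds n)))
      ≈⟨ trans (∏-* N _ _) (*-congˡ {∏1+ evens 1#} (∏-* N _ _)) ⟩
    product₁ ∎
    where
    factor : ∀ n → binom (+ 1) (+ 0) (2 ℕ.* suc n) ⊗ geomUpTo N (2 ℕ.* suc n)
        ⊗ (binom (+ 1) (+ 1) (2 ℕ.* suc n ℕ.∸ 1) ⊗ binom (+ 1) (ℤ.- + 1) (2 ℕ.* suc n ℕ.∸ 1) ⊗ binom (ℤ.- + 1) (+ 0) (2 ℕ.* suc n))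
      ≈ (1# + 1# * x ^ evens n) * ((1# + y * x ^ odds n) * (1# + y⁻ * x ^ odds n))
    factor n = begin
      b ⊗ g ⊗ (b⁺ ⊗ b⁻ ⊗ h)
        ≈⟨ solve 5 (λ b g c d h → (b :* g) :* ((c :* d) :* h) := (b :* (c :* d)) :* (h :* g)) refl b g b⁺ b⁻ h ⟩
      (b * (b⁺ * b⁻)) * (h * g)
        ≈⟨ *-cong (*-cong (binom≈ 1# (λ _ → ≡.refl) (evens≡ n)) (*-cong (binom≈ y (λ _ → ≡.refl) (odds≡ n)) (binom≈ y⁻ (λ _ → ≡.refl) (odds≡ n)))) hg ⟩
      ((1# + 1# * x ^ evens n) * ((1# + y * x ^ odds n) * (1# + y⁻ * x ^ odds n))) * 1#
        ≈⟨ *-identityʳ _ ⟩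
      (1# + 1# * x ^ evens n) * ((1# + y * x ^ odds n) * (1# + y⁻ * x ^ odds n)) ∎
      where
      b g b⁺ b⁻ h : Poly
      b = binom (+ 1) (+ 0) (2 ℕ.* suc n)
      g = geomUpTo N (2 ℕ.* suc n)
      b⁺ = binom (+ 1) (+ 1) (2 ℕ.* suc n ℕ.∸ 1)
      b⁻ = binom (+ 1) (ℤ.- + 1) (2 ℕ.* suc n ℕ.∸ 1)
      h = binom (ℤ.- + 1) (+ 0) (2 ℕ.* suc n)
      hg : h * g ≈ 1#
      hg = trans (*-congʳ (trans (binom≈ (- 1#) (λ _ → ≡.refl) ≡.refl) (solve 1 (λ u → :1 :+ (:- :1) :* u := :1 :- u) refl (x ^ (2 ℕ.* suc n)))))
        -- `2 * suc n` computes to the successor of this argument.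
        (geomUpTo-inverse (n ℕ.+ suc (n ℕ.+ 0)))

  prod2≈product₂ : ∀ s a → (∀ n → binom s (+ 0) n ≡ 1# + a * ((n , + 0 , + 1) ∷ [])) →
    (∀ n → binom s (+ 1) n ≡ 1# + (a * y) * ((n , + 0 , + 1) ∷ [])) →
    (∀ n → binom s (ℤ.- + 1) n ≡ 1# + (a * y⁻) * ((n , + 0 , + 1) ∷ [])) → prod2 s N ≈ product₂ a
  prod2≈product₂ s a e₀ e₊ e₋ = begin
    prod2 s N ≈⟨ prodFrom1≈∏ N _ (λ n → (f n * g n) * h n) (λ n → *-cong (*-cong (binom≈ a e₀ (odds≡ n)) (binom≈ (a * y) e₊ (doubles≡ n))) (binom≈ (a * y⁻) e₋ (evens≡ n))) ⟩
    ∏ N (λ n → (f n * g n) * h n) ≈⟨ trans (∏-* N (λ n → f n * g n) h) (*-congʳ {∏ N h} (∏-* N f g)) ⟩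
    (∏ N f * ∏ N g) * ∏ N h       ≈⟨ *-assoc (∏ N f) (∏ N g) (∏ N h) ⟩
    product₂ a ∎
    where
    f g h : ℕ → Poly
    f n = 1# + a * x ^ odds n
    g n = 1# + (a * y) * x ^ (n ℕ.* 2)
    h n = 1# + (a * y⁻) * x ^ evens n

  private
    -- The doubled identity is halved here, coefficient by coefficient.
    double-injective : ∀ i j → i ℤ.+ i ≡ j ℤ.+ j → i ≡ j
    double-injective i j e = ℤₚ.*-cancelˡ-≡ (+ 2) i j (≡.trans (twice i) (≡.trans e (≡.sym (twice j))))
      where
      twice : ∀ i → + 2 ℤ.* i ≡ i ℤ.+ i
      twice i = ≡.trans (ℤₚ.*-distribʳ-+ i (+ 1) (+ 1)) (≡.cong₂ ℤ._+_ (ℤₚ.*-identityˡ i) (ℤₚ.*-identityˡ i))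

  coeff-rhs1 : ∀ k → coeff (rhs1 N) N k ≡ coeff (G false true 1) N k
  coeff-rhs1 k = double-injective _ _ (≡.trans (≡.sym (coeff-++ (rhs1 N) (rhs1 N) N k))
    (≡.trans (trans (+-cong rhs1≈product₁ rhs1≈product₁) (sym identity₁) .coeffs N ℕₚ.≤-refl k)
      (coeff-++ (G false true 1) (G false true 1) N k)))

  coeff-rhs2 : 1 ≤ N → ∀ k → coeff (twiceRhs2 N) N k ≡ coeff (G false false 0) N k ℤ.+ coeff (G false false 0) N k
  coeff-rhs2 1≤N k = ≡.trans
    (trans (+-cong (prod2≈product₂ (+ 1) 1# (λ _ → ≡.refl) (λ _ → ≡.refl) (λ _ → ≡.refl))
                   (prod2≈product₂ (ℤ.- + 1) (- 1#) (λ _ → ≡.refl) (λ _ → ≡.refl) (λ _ → ≡.refl))) (sym (identity₂ 1≤N)) .coeffs N ℕₚ.≤-refl k)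
    (coeff-++ (G false false 0) (G false false 0) N k)

-- The statistic ω through residues, and duplicate-free lists of the pairs.

module Enumerations where
  open ≡ using (refl; sym; trans; cong; cong₂)

  odd? : ℕ → Bool
  odd? zero = false
  odd? (suc n) = not (odd? n)

  bit : Bool → ℕ
  bit false = 0
  bit true = 1

  %2≡bit : ∀ n → n ℕ.% 2 ≡ bit (odd? n)
  %2≡bit zero = refl
  %2≡bit (suc zero) = refl
  %2≡bit (suc (suc n)) = trans (trans (cong (ℕ._% 2) (ℕₚ.+-comm 2 n)) (ℕ/.[m+n]%n≡m%n n 2))
    (trans (%2≡bit n) (cong bit (sym (Boolₚ.not-involutive (odd? n)))))

  %ℕ2≡bit : ∀ i → i ℤ.%ℕ 2 ≡ bit (odd? ∣ i ∣)
  %ℕ2≡bit (+ n) = %2≡bit n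
  -- On negative numbers `%ℕ` branches on the remainder r of the absolute value and returns 0 or 2 -
  -- r, which for modulus 2 is again r.
  %ℕ2≡bit -[1+ n ] with suc n ℕ.% 2 | %2≡bit (suc n)
  ... | _ | e with odd? (suc n)
  %ℕ2≡bit -[1+ n ] | _ | refl | false = refl
  %ℕ2≡bit -[1+ n ] | _ | refl | true = refl

  odd?-suc : ∀ i → odd? ∣ ℤ.suc i ∣ ≡ not (odd? ∣ i ∣)
  odd?-suc (+ n) = refl
  odd?-suc -[1+ zero ] = refl
  odd?-suc -[1+ suc n ] = sym (Boolₚ.not-involutive (odd? (suc n)))

  sign : Bool → ℤ
  sign false = + 1
  sign true = ℤ.- + 1

  row-ω : Bool → ℕ → ℤ
  row-ω t zero = + 0
  row-ω t (suc p) = sign t ℤ.+ row-ω (not t) p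

  partition-ω : Bool → List ℕ → ℤ
  partition-ω t [] = + 0
  partition-ω t (p ∷ ps) = row-ω t p ℤ.+ partition-ω (not t) ps

  -- `ω` is the balance of the list of all residues; unlike the two counts taken separately, it is
  -- followed here as one additive quantity.
  balance : List ℕ → ℤ
  balance rs = + length (filterᵇ (λ r → r ℕ.≡ᵇ 0) rs) ℤ.- + length (filterᵇ (λ r → r ℕ.≡ᵇ 1) rs)

  balance-++ : ∀ rs rs′ → balance (rs ++ rs′) ≡ balance rs ℤ.+ balance rs′
  balance-++ rs rs′ = trans (cong₂ (λ a b → + a ℤ.- + b) (count (λ r → r ℕ.≡ᵇ 0)) (count (λ r → r ℕ.≡ᵇ 1)))
    (exchange (+ number 0 rs) (+ number 0 rs′) (+ number 1 rs) (+ number 1 rs′))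
    where
    number : ℕ → List ℕ → ℕ
    number i rs = length (filterᵇ (λ r → r ℕ.≡ᵇ i) rs)
    count : ∀ p → length (filterᵇ p (rs ++ rs′)) ≡ length (filterᵇ p rs) ℕ.+ length (filterᵇ p rs′)
    count p = trans (cong length (Listₚ.filter-++ _ rs rs′)) (Listₚ.length-++ (filterᵇ p rs))
    exchange : ∀ a b c d → (a ℤ.+ b) ℤ.- (c ℤ.+ d) ≡ (a ℤ.- c) ℤ.+ (b ℤ.- d)
    exchange = solve-∀

  balance-bit : ∀ b → balance (bit b ∷ []) ≡ sign b
  balance-bit false = refl
  balance-bit true = refl

  balance-alternating : ∀ p (f : ℕ → ℕ) (b : ℕ → Bool) → (∀ j → f j ≡ bit (b j)) → (∀ j → b (suc j) ≡ not (b j)) →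
    balance (applyUpTo f p) ≡ row-ω (b 0) p
  balance-alternating zero f b f≡ b≡ = refl
  balance-alternating (suc p) f b f≡ b≡ = trans (balance-++ (f 0 ∷ []) (applyUpTo (λ j → f (suc j)) p))
    (cong₂ ℤ._+_ (trans (cong (λ r → balance (r ∷ [])) (f≡ 0)) (balance-bit (b 0)))
      (trans (balance-alternating p (λ j → f (suc j)) (λ j → b (suc j)) (λ j → f≡ (suc j)) (λ j → b≡ (suc j)))
        (cong (λ t → row-ω t p) (b≡ 0))))

  content : ℕ → ℕ → ℕ → ℤ
  content t i j = (+ suc j ℤ.- + i) ℤ.+ + t

  -- A step to the right raises the content by 1 and a step down lowers it by 1; both flip the
  -- parity, so only the residue of the first node matters.
  balance-residues : ∀ t i ps → balance (map (residue t) (nodesFrom i ps)) ≡ partition-ω (odd? ∣ content t i 0 ∣) ps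
  balance-residues t i [] = refl
  balance-residues t i (p ∷ ps) = begin
    balance (map (residue t) (map (λ j → i , suc j) (upTo p) ++ nodesFrom (suc i) ps))
      ≡⟨ cong balance (Listₚ.map-++ (residue t) (map (λ j → i , suc j) (upTo p)) (nodesFrom (suc i) ps)) ⟩
    balance (map (residue t) (map (λ j → i , suc j) (upTo p)) ++ map (residue t) (nodesFrom (suc i) ps))
      ≡⟨ balance-++ (map (residue t) (map (λ j → i , suc j) (upTo p))) _ ⟩
    balance (map (residue t) (map (λ j → i , suc j) (upTo p))) ℤ.+ balance (map (residue t) (nodesFrom (suc i) ps))
      ≡⟨ cong₂ ℤ._+_ (cong balance (trans (sym (Listₚ.map-∘ (upTo p))) (Listₚ.map-upTo _ p))) (balance-residues t (suc i) ps) ⟩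
    balance (applyUpTo (λ j → residue t (i , suc j)) p) ℤ.+ partition-ω (odd? ∣ content t (suc i) 0 ∣) ps
      ≡⟨ cong₂ (λ a b → a ℤ.+ partition-ω b ps)
           (balance-alternating p _ (λ j → odd? ∣ content t i j ∣) (λ j → %ℕ2≡bit (content t i j))
             (λ j → trans (cong (λ z → odd? ∣ z ∣) (right (+ suc j) (+ i) (+ t))) (odd?-suc (content t i j))))
           (trans (sym (Boolₚ.not-involutive _)) (cong not (trans (sym (odd?-suc (content t (suc i) 0))) (cong (λ z → odd? ∣ z ∣) (down (+ i) (+ t)))))) ⟩
    row-ω (odd? ∣ content t i 0 ∣) p ℤ.+ partition-ω (not (odd? ∣ content t i 0 ∣)) ps ∎
    where
    open ≡.≡-Reasoning
    right : ∀ j i t → ((+ 1 ℤ.+ j) ℤ.- i) ℤ.+ t ≡ + 1 ℤ.+ ((j ℤ.- i) ℤ.+ t)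
    right = solve-∀
    down : ∀ i t → + 1 ℤ.+ ((+ 1 ℤ.- (+ 1 ℤ.+ i)) ℤ.+ t) ≡ (+ 1 ℤ.- i) ℤ.+ t
    down = solve-∀

  ω-pair : ∀ a p q → ω a (p ∷ q ∷ []) ≡ partition-ω (odd? (tval a 1)) p ℤ.+ partition-ω (odd? (tval a 2)) q
  ω-pair a p q = begin
    balance (map (residue (tval a 1)) (nodes p) ++ (map (residue (tval a 2)) (nodes q) ++ []))
      ≡⟨ balance-++ (map (residue (tval a 1)) (nodes p)) _ ⟩
    balance (map (residue (tval a 1)) (nodes p)) ℤ.+ balance (map (residue (tval a 2)) (nodes q) ++ [])
      ≡⟨ cong₂ ℤ._+_ (balance-residues (tval a 1) 1 p) (trans (cong balance (Listₚ.++-identityʳ (map (residue (tval a 2)) (nodes q)))) (balance-residues (tval a 2) 1 q)) ⟩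
    partition-ω (odd? (tval a 1)) p ℤ.+ partition-ω (odd? (tval a 2)) q ∎
    where open ≡.≡-Reasoning

  -- The same recursion as `distinct`, so that sums and enumerations match summand by summand.
  distinctPartitions : ℕ → List (List ℕ)
  distinctPartitions zero = [] ∷ []
  distinctPartitions (suc M) = distinctPartitions M ++ map (suc M ∷_) (distinctPartitions M)

  ∈-distinctPartitions⁻ : ∀ M {μ} → μ ∈ distinctPartitions M → IsDistinctPartition μ × largest μ ≤ M
  ∈-distinctPartitions⁻ zero (here refl) = ([] , []) , z≤n
  ∈-distinctPartitions⁻ (suc M) μ∈ with ∈-++⁻ (distinctPartitions M) μ∈
  ... | inj₁ μ∈M = let (d , l) = ∈-distinctPartitions⁻ M μ∈M in d , ℕₚ.m≤n⇒m≤1+n l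
  ... | inj₂ μ∈map with ∈-map⁻ (suc M ∷_) μ∈map
  ... | [] , ν∈ , refl = ([-] , s≤s z≤n ∷ []) , ℕₚ.≤-refl
  ... | (p ∷ ν) , ν∈ , refl with ∈-distinctPartitions⁻ M ν∈
  ... | (linked , positive) , p≤M = (s≤s p≤M ∷ linked , s≤s z≤n ∷ positive) , ℕₚ.≤-refl

  ∈-distinctPartitions⁺ : ∀ M {μ} → IsDistinctPartition μ → largest μ ≤ M → μ ∈ distinctPartitions M
  ∈-distinctPartitions⁺ zero {[]} _ _ = here refl
  ∈-distinctPartitions⁺ zero {zero ∷ μ} (_ , () ∷ _) _
  ∈-distinctPartitions⁺ (suc M) {[]} d _ = ∈-++⁺ˡ (∈-distinctPartitions⁺ M d z≤n)
  ∈-distinctPartitions⁺ (suc M) {p ∷ μ} d@(linked , _ ∷ positive) p≤ with ℕₚ.m≤n⇒m<n∨m≡n p≤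
  ... | inj₁ (s≤s p≤M) = ∈-++⁺ˡ (∈-distinctPartitions⁺ M d p≤M)
  ... | inj₂ refl = ∈-++⁺ʳ (distinctPartitions M) (∈-map⁺ (suc M ∷_) (∈-distinctPartitions⁺ M (Linked.tail linked , positive) (below linked)))
    where
    below : ∀ {μ} → Linked ℕ._>_ (suc M ∷ μ) → largest μ ≤ M
    below [-] = z≤n
    below (s≤s p≤M ∷ _) = p≤M

  distinctPartitions-unique : ∀ M → Unique (distinctPartitions M)
  distinctPartitions-unique zero = [] ∷ []
  distinctPartitions-unique (suc M) = Uniqueₚ.++⁺ (distinctPartitions-unique M)
    (Uniqueₚ.map⁺ Listₚ.∷-injectiveʳ (distinctPartitions-unique M)) disjoint
    where
    disjoint : ∀ {μ} → ¬ (μ ∈ distinctPartitions M × μ ∈ map (suc M ∷_) (distinctPartitions M))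
    disjoint (μ∈ , μ∈map) with ∈-map⁻ (suc M ∷_) μ∈map
    ... | ν , _ , refl = ℕₚ.<-irrefl refl (proj₂ (∈-distinctPartitions⁻ M μ∈))

  -- `key` recovers the index from an element, which makes lists with different indices disjoint.
  concatMap-unique : ∀ {A B : Set} (f : A → List B) (key : B → A) → (∀ a {b} → b ∈ f a → key b ≡ a) →
    (∀ a → Unique (f a)) → ∀ {as} → Unique as → Unique (concatMap f as)
  concatMap-unique f key key-f f-unique [] = []
  concatMap-unique f key key-f f-unique {a ∷ as} (a∉as ∷ u) =
    Uniqueₚ.++⁺ (f-unique a) (concatMap-unique f key key-f f-unique u) disjoint
    where
    disjoint : ∀ {b} → ¬ (b ∈ f a × b ∈ concatMap f as)
    disjoint (b∈fa , b∈) with find (∈-concatMap⁻ f b∈)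
    ... | a′ , a′∈as , b∈fa′ = All.lookup a∉as a′∈as (trans (sym (key-f a b∈fa)) (key-f a′ b∈fa′))

  index-lookup : ∀ {A : Set} {xs : List A} → Unique xs → ∀ i (p : lookup xs i ∈ xs) → Any.index p ≡ i
  index-lookup (_ ∷ _) Fin.zero (here _) = refl
  index-lookup (x∉ ∷ _) Fin.zero (there p) = contradiction refl (All.lookup x∉ p)
  index-lookup {xs = x ∷ xs} (x∉ ∷ _) (Fin.suc i) (here e) = contradiction (sym e) (All.lookup x∉ (∈-lookup i))
  index-lookup (_ ∷ u) (Fin.suc i) (there p) = cong Fin.suc (index-lookup u i p)

  -- Without repetitions an element determines its position; irrelevance of `P` prevents one element
  -- from being counted with several proofs.
  enumeration : ∀ {A : Set} {P : A → Set} {xs : List A} → (∀ {a} (p q : P a) → p ≡ q) → Unique xs →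
    (∀ {a} → a ∈ xs → P a) → (∀ {a} → P a → a ∈ xs) → Fin (length xs) ↔ Σ A P
  enumeration {xs = xs} irrelevant u sound complete = mk↔ₛ′
    (λ i → lookup xs i , sound (∈-lookup i))
    (λ (a , p) → Any.index (complete p))
    (λ (a , p) → Σ-≡,≡→≡ (sym (Anyₚ.lookup-index (complete p)) , irrelevant _ _))
    (λ i → index-lookup u i (complete (sound (∈-lookup i))))

  size-largest : ∀ μ → largest μ ≤ size μ
  size-largest [] = z≤n
  size-largest (p ∷ μ) = ℕₚ.m≤m+n p (size μ)

  -- The second component is fixed first, as in `pairs`, because its length bounds the parts of the
  -- first.
  pairsWith : ℕ → List ℕ → List (Vec (List ℕ) 2)
  pairsWith c μ = map (λ ν → ν ∷ μ ∷ []) (distinctPartitions (c ℕ.+ length μ))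

  restrictedPairs : ℕ → ℕ → List (Vec (List ℕ) 2)
  restrictedPairs c N = concatMap (pairsWith c) (distinctPartitions N)

  restrictedPairs-unique : ∀ c N → Unique (restrictedPairs c N)
  restrictedPairs-unique c N = concatMap-unique (pairsWith c) (λ v → Vec.head (Vec.tail v))
    (λ μ v∈ → cong (λ v → Vec.head (Vec.tail v)) (proj₂ (proj₂ (∈-map⁻ _ v∈))))
    (λ μ → Uniqueₚ.map⁺ (λ e → cong Vec.head e) (distinctPartitions-unique (c ℕ.+ length μ)))
    (distinctPartitions-unique N)

  module Enumeration (a c : ℕ) (tval₁ : tval a 1 ≡ 0) (tval₂ : tval a 2 ≡ c) (n : ℕ) (k : ℤ) where

    Selected : Vec (List ℕ) 2 → Set
    Selected v = totalSize v ≡ n × ω a v ≡ k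

    selected? : ∀ v → Dec (Selected v)
    selected? v = (totalSize v ℕ.≟ n) ×-dec (ω a v ℤ.≟ k)

    members : List (Vec (List ℕ) 2)
    members = filter selected? (restrictedPairs c n)

    private
      InLambda : Vec (List ℕ) 2 → Set
      InLambda v = Λ a 2 n v × ω a v ≡ k

      left : ∀ l → l ℕ.+ tval a 1 ≡ l
      left l = trans (cong (l ℕ.+_) tval₁) (ℕₚ.+-identityʳ l)

      right : ∀ m → m ℕ.+ tval a 2 ≡ c ℕ.+ m
      right m = trans (cong (m ℕ.+_) tval₂) (ℕₚ.+-comm m c)

      sound : ∀ {v} → v ∈ members → InLambda v
      sound v∈ with ∈-filter⁻ selected? {xs = restrictedPairs c n} v∈
      ... | v∈pairs , size≡ , ω≡ with find (∈-concatMap⁻ (pairsWith c) {xs = distinctPartitions n} v∈pairs)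
      ... | μ , μ∈ , v∈map with ∈-map⁻ (λ ν → ν ∷ μ ∷ []) v∈map
      ... | ν , ν∈ , refl with ∈-distinctPartitions⁻ n μ∈ | ∈-distinctPartitions⁻ (c ℕ.+ length μ) ν∈
      ... | dμ , _ | dν , ν≤ = (dν ∷ dμ ∷ [] , size≡ , chain , tt) , ω≡
        where
        chain : largest ν ℕ.+ tval a 1 ≤ length μ ℕ.+ tval a 2
        chain = ≡.subst₂ _≤_ (sym (left (largest ν))) (sym (right (length μ))) ν≤

      complete : ∀ {v} → InLambda v → v ∈ members
      complete {ν ∷ μ ∷ []} ((dν ∷ dμ ∷ [] , size≡ , chain , _) , ω≡) = ∈-filter⁺ selected?
        (∈-concatMap⁺ (pairsWith c) (lose (∈-distinctPartitions⁺ n dμ μ≤) (∈-map⁺ (λ ν → ν ∷ μ ∷ []) (∈-distinctPartitions⁺ (c ℕ.+ length μ) dν ν≤))))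
        (size≡ , ω≡)
        where
        μ≤ : largest μ ≤ n
        μ≤ = ℕₚ.≤-trans (size-largest μ) (ℕₚ.≤-trans (ℕₚ.m≤m+n (size μ) 0)
          (ℕₚ.≤-trans (ℕₚ.m≤n+m (size μ ℕ.+ 0) (size ν)) (ℕₚ.≤-reflexive size≡)))
        ν≤ : largest ν ≤ c ℕ.+ length μ
        ν≤ = ≡.subst₂ _≤_ (left (largest ν)) (right (length μ)) chain

      isDistinctPartition-irrelevant : ∀ {μ} (p q : IsDistinctPartition μ) → p ≡ q
      isDistinctPartition-irrelevant (l , p) (l′ , p′) =
        cong₂ _,_ (Linked.irrelevant ℕₚ.≤-irrelevant l l′) (All.irrelevant ℕₚ.≤-irrelevant p p′)

      irrelevant : ∀ {v} (p q : InLambda v) → p ≡ q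
      irrelevant {ν ∷ μ ∷ []} ((d , s , l , tt) , w) ((d′ , s′ , l′ , tt) , w′) =
        cong₂ _,_ (cong₂ _,_ (VecAll.irrelevant isDistinctPartition-irrelevant d d′)
          (cong₂ _,_ (ℕₚ.≡-irrelevant s s′) (cong (_, tt) (ℕₚ.≤-irrelevant l l′)))) (Decidable⇒UIP.≡-irrelevant ℤ._≟_ w w′)

    members↔ : Fin (length members) ↔ LambdaW a 2 n k
    members↔ = enumeration irrelevant (Uniqueₚ.filter⁺ selected? (restrictedPairs-unique c n)) sound complete

    coeff-count : ∀ vs → coeff (map (λ v → totalSize v , ω a v , + 1) vs) n k ≡ + length (filter selected? vs)
    coeff-count [] = refl
    coeff-count (v ∷ vs) with totalSize v ℕ.≡ᵇ n | ω a v ℤ.≟ k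
    ... | true | yes _ = cong (λ z → + 1 ℤ.+ z) (coeff-count vs)
    ... | true | no _ = trans (ℤₚ.+-identityˡ _) (coeff-count vs)
    ... | false | _ = trans (ℤₚ.+-identityˡ _) (coeff-count vs)

open Enumerations

-- The series `G` as a sum of monomials over the enumerated pairs.

module GeneratingFunctions (N : ℕ) where
  open RightHandSides N public
  open CommutativeRing polynomials hiding (_≈_)
  open Relation.Binary.Reasoning.Setoid setoid

  monomial : ℕ → ℤ → Poly
  monomial e f = (e , f , + 1) ∷ []

  -- An equality of lists by computation: products of one-term polynomials have one term.
  row≡ : ∀ t p → row t p ≡ monomial p (row-ω t p)
  row≡ t zero = ≡.refl
  row≡ false (suc p) = ≡.cong ((x * y) ⊗_) (row≡ true p)
  row≡ true (suc p) = ≡.cong ((x * y⁻) ⊗_) (row≡ false p)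

  weight : Bool → List ℕ → Poly
  weight t μ = monomial (size μ) (partition-ω t μ)

  weighted : Bool → (ℕ → Poly) → List (List ℕ) → Poly
  weighted t φ = concatMap (λ μ → weight t μ ⊗ φ (length μ))

  -- A new top row pushes the remaining rows down by one, which flips their charge and raises the
  -- length by one.
  weighted-∷ : ∀ t φ p μs → weighted t φ (map (p ∷_) μs) ≈ row t p * weighted (not t) (λ L → φ (suc L)) μs
  weighted-∷ t φ p [] = sym (zeroʳ (row t p))
  weighted-∷ t φ p (μ ∷ μs) = begin
    weight t (p ∷ μ) * φ′ + weighted t φ (map (p ∷_) μs)
      ≈⟨ +-cong (≡⇒≈ (≡.trans (≡.cong (λ r → (r ⊗ weight (not t) μ) ⊗ φ′) (≡.sym (row≡ t p))) (⊗-assoc (row t p) (weight (not t) μ) φ′))) (weighted-∷ t φ p μs) ⟩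
    row t p * (weight (not t) μ * φ′) + row t p * weighted (not t) (λ L → φ (suc L)) μs
      ≈⟨ distribˡ (row t p) (weight (not t) μ * φ′) (weighted (not t) (λ L → φ (suc L)) μs) ⟨
    row t p * (weight (not t) μ * φ′ + weighted (not t) (λ L → φ (suc L)) μs) ∎
    where
    φ′ : Poly
    φ′ = φ (suc (length μ))

  distinct≈weighted : ∀ t B φ → distinct t B φ ≈ weighted t φ (distinctPartitions B)
  distinct≈weighted t zero φ = ≡⇒≈ (≡.sym (≡.trans (Listₚ.++-identityʳ (one ⊗ φ 0)) (⊗-identityˡ (φ 0))))
  distinct≈weighted t (suc B) φ = begin
    distinct t B φ + row t (suc B) * distinct (not t) B (λ L → φ (suc L))
      ≈⟨ +-cong (distinct≈weighted t B φ) (*-congˡ {row t (suc B)} (distinct≈weighted (not t) B (λ L → φ (suc L)))) ⟩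
    weighted t φ μs + row t (suc B) * weighted (not t) (λ L → φ (suc L)) μs
      ≈⟨ +-congˡ {weighted t φ μs} (weighted-∷ t φ (suc B) μs) ⟨
    weighted t φ μs + weighted t φ (map (suc B ∷_) μs)
      ≈⟨ ≡⇒≈ (Listₚ.concatMap-++ (λ μ → weight t μ ⊗ φ (length μ)) μs (map (suc B ∷_) μs)) ⟨
    weighted t φ (μs ++ map (suc B ∷_) μs) ∎
    where
    μs : List (List ℕ)
    μs = distinctPartitions B

  module _ (a c : ℕ) (t u : Bool) (tval₁ : odd? (tval a 1) ≡ t) (tval₂ : odd? (tval a 2) ≡ u) where

    pairTerm : Vec (List ℕ) 2 → Term
    pairTerm v = totalSize v , ω a v , + 1

    private
      pairTerm≡ : ∀ ν μ → pairTerm (ν ∷ μ ∷ []) ≡ (size μ ℕ.+ size ν , partition-ω u μ ℤ.+ partition-ω t ν , + 1)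
      pairTerm≡ ν μ = ≡.cong₂ (λ e f → e , f , + 1)
        (≡.trans (≡.cong (size ν ℕ.+_) (ℕₚ.+-identityʳ (size μ))) (ℕₚ.+-comm (size ν) (size μ)))
        (≡.trans (ω-pair a ν μ) (≡.trans (≡.cong₂ (λ t u → partition-ω t ν ℤ.+ partition-ω u μ) tval₁ tval₂) (ℤₚ.+-comm (partition-ω t ν) (partition-ω u μ))))

      fibre : ∀ μ νs → weight u μ * weighted t (λ _ → one) νs ≈ map pairTerm (map (λ ν → ν ∷ μ ∷ []) νs)
      fibre μ [] = refl
      fibre μ (ν ∷ νs) = begin
        weight u μ * (weight t ν * one + weighted t (λ _ → one) νs)
          ≈⟨ distribˡ (weight u μ) (weight t ν * one) (weighted t (λ _ → one) νs) ⟩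
        weight u μ * (weight t ν * one) + weight u μ * weighted t (λ _ → one) νs
          ≈⟨ +-cong {weight u μ * (weight t ν * one)} {pairTerm (ν ∷ μ ∷ []) ∷ []}
               (trans (*-congˡ {weight u μ} (*-identityʳ (weight t ν))) (≡⇒≈ (≡.cong (_∷ []) (≡.sym (pairTerm≡ ν μ))))) (fibre μ νs) ⟩
        (pairTerm (ν ∷ μ ∷ []) ∷ []) + map pairTerm (map (λ ν → ν ∷ μ ∷ []) νs) ∎

    G≈pairs : G t u c ≈ map pairTerm (restrictedPairs c N)
    G≈pairs = trans (distinct≈weighted u N (λ L → distinct≤ t (c ℕ.+ L))) (fibres (distinctPartitions N))
      where
      fibres : ∀ μs → weighted u (λ L → distinct≤ t (c ℕ.+ L)) μs ≈ map pairTerm (concatMap (pairsWith c) μs)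
      fibres [] = refl
      fibres (μ ∷ μs) = begin
        weight u μ * distinct≤ t (c ℕ.+ length μ) + weighted u (λ L → distinct≤ t (c ℕ.+ L)) μs
          ≈⟨ +-cong (trans (*-congˡ {weight u μ} (distinct≈weighted t (c ℕ.+ length μ) (λ _ → one))) (fibre μ (distinctPartitions (c ℕ.+ length μ)))) (fibres μs) ⟩
        map pairTerm (pairsWith c μ) + map pairTerm (concatMap (pairsWith c) μs)
          ≈⟨ ≡⇒≈ (Listₚ.map-++ pairTerm (pairsWith c μ) (concatMap (pairsWith c) μs)) ⟨
        map pairTerm (pairsWith c μ ++ concatMap (pairsWith c) μs) ∎

-- For n = 0 the truncated products on the right are empty, hence not covered by identity₂.
coeff-twiceRhs2 : ∀ n k → let open GeneratingFunctions n in
  coeff (twiceRhs2 n) n k ≡ coeff (G false false 0) n k ℤ.+ coeff (G false false 0) n k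
coeff-twiceRhs2 zero k = coeff-++ one one 0 k
coeff-twiceRhs2 (suc n) k = GeneratingFunctions.coeff-rhs2 (suc n) (s≤s z≤n) k

-- Comparison of the coefficients of x^n y^k.

module _ (n : ℕ) (k : ℤ) where
  open GeneratingFunctions n

  private
    -- The second argument is c = t₂ - t₁: charges (0, 1) give c = 1, charges (0, 0) give c = 0.
    module E₁ = Enumeration 1 1 ≡.refl ≡.refl n k
    module E₂ = Enumeration 2 0 ≡.refl ≡.refl n k

    count₁ : coeff (G false true 1) n k ≡ + length E₁.members
    count₁ = ≡.trans (G≈pairs 1 1 false true ≡.refl ≡.refl .coeffs n ℕₚ.≤-refl k) (E₁.coeff-count (restrictedPairs 1 n))

    count₂ : coeff (G false false 0) n k ≡ + length E₂.members
    count₂ = ≡.trans (G≈pairs 2 0 false false ≡.refl ≡.refl .coeffs n ℕₚ.≤-refl k) (E₂.coeff-count (restrictedPairs 0 n))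

  Λ¹²-count : Σ ℕ λ c → (coeff (rhs1 n) n k ≡ + c) × (Fin c ↔ LambdaW 1 2 n k)
  Λ¹²-count = length E₁.members , ≡.trans (coeff-rhs1 k) count₁ , E₁.members↔

  Λ²²-count : Σ ℕ λ c → (coeff (twiceRhs2 n) n k ≡ + (2 ℕ.* c)) × (Fin c ↔ LambdaW 2 2 n k)
  Λ²²-count = length E₂.members ,
    ≡.trans (≡.trans (coeff-twiceRhs2 n k) (≡.cong₂ ℤ._+_ count₂ count₂))
      (≡.cong (λ c → + (length E₂.members ℕ.+ c)) (≡.sym (ℕₚ.+-identityʳ (length E₂.members)))) ,
    E₂.members↔

open import Data.Nat using (ℕ; _*_)
open import Data.Integer using (ℤ; +_)
open import Data.Fin using (Fin)
open import Data.Product using (Σ; _×_)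
open import Function.Bundles using (_↔_)
open import Relation.Binary.PropositionalEquality using (_≡_)

theorem1p2 : ((n : ℕ) (k : ℤ) → Σ ℕ λ c → (coeff (rhs1 n) n k ≡ + c) × (Fin c ↔ LambdaW 1 2 n k))
    × ((n : ℕ) (k : ℤ) → Σ ℕ λ c → (coeff (twiceRhs2 n) n k ≡ + (2 * c)) × (Fin c ↔ LambdaW 2 2 n k))
theorem1p2 = Λ¹²-count , Λ²²-count
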